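{- Let $m\ge2$, let $h$ be a positive integer and let $\lambda=(\lambda_1,\ldots,\lambda_m)$ be a partition with $\lambda_m=0$. The Newton polytope $\mathrm{Newt}(G_{h,\lambda}(x_1,\ldots,x_m))$ is reflexive if and only if $(h,\lambda)$ is one of the following: $h\ge1$ and $\lambda=(2,\ldots,2,0,\ldots,0)$, a partition of $m-1$ with $m$ parts, for odd $m\ge3$; $h\ge1$ and $\lambda=(2,\ldots,2,1,0,\ldots,0)$, a partition of $m-1$ with $m$ parts, for even $m\ge4$; $h\ge2$ and $\lambda=(m+1,\ldots,m+1,0)$ (with $m-1$ entries $m+1$), a partition of $m^2-1$, for $m\ge2$; $h=1$ and $\lambda=(4,4,0)$ (so $m=3$).
   Context: $\mathrm{Newt}(f)$ is the convex hull of exponent vectors of monomials with nonzero coefficient in $f$. Schur polynomial $s_\mu(x_1,\ldots,x_m)=\sum_T\mathbf{x}^T$ over semistandard Young tableaux of shape $\mu$ with entries in $\{1,\ldots,m\}$. For a partition $\mu\supseteq\lambda$ with at most $m$ rows, $b_{h,\lambda\mu}$ is the number of fillings of $\mu/\lambda$ with positive integers strictly increasing along rows and columns, entries in row $r$ from $\{1,\ldots,h(r-1)\}$; $A(h,\lambda)=\{\mu\mid b_{h,\lambda\mu}\ne0\}$; $G_{h,\lambda}=\sum_{\mu\in A(h,\lambda)}(-1)^{|\mu/\lambda|}b_{h,\lambda\mu}s_\mu$. A lattice polytope $\mathcal{P}$ is reflexive if there is a lattice point $\mathbf{p}$ in its (relative) interior at lattice distance $1$ from every facet, i.e. for each facet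 $F$ there are no lattice points of $\mathrm{aff}(\mathcal{P})$ strictly between the affine span of $F$ and its parallel translate through $\mathbf{p}$.
   Formalization: A polytope consisting of a single point is counted as not reflexive (distance 1 is required from nonempty facets only); otherwise λ=(0,…,0), where G=1 and the Newton polytope is a point that is vacuously reflexive, would contradict the list. -}

module Defs where

open import Data.Bool using (Bool; true; false; _∧_; not; if_then_else_)
open import Data.Nat as ℕ using (ℕ; zero; suc; _+_; _*_; _∸_; _≤ᵇ_; _<ᵇ_; _≡ᵇ_)
open import Data.Integer as ℤ using (ℤ; +_; -1ℤ)
open import Data.Rational as ℚ using (ℚ; 0ℚ; 1ℚ)
open import Data.Fin as F using (Fin; toℕ)
open import Data.List as L using (List; []; _∷_)
open import Data.Vec as V using (Vec; []; _∷_; lookup)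
open import Data.Maybe using (Maybe; just; nothing)
open import Data.Product using (Σ; _×_; _,_; proj₁; proj₂)
open import Data.Empty using (⊥)
open import Data.Sum using (_⊎_)
open import Relation.Binary.PropositionalEquality using (_≡_; _≢_)
open import Data.List.Relation.Unary.All using (All)

range : ℕ → ℕ → List ℕ
range a b = L.map (λ x → a + x) (L.upTo (suc b ∸ a))

listsOf : ℕ → List ℕ → List (List ℕ)
listsOf zero    xs = [] ∷ []
listsOf (suc n) xs = L.concatMap (λ x → L.map (x ∷_) (listsOf n xs)) xs

prodL : ∀ {A : Set} {m} → Vec (List A) m → List (Vec A m)
prodL []         = [] ∷ []
prodL (xs ∷ xss) = L.concatMap (λ x → L.map (x ∷_) (prodL xss)) xs

count : ∀ {A : Set} → (A → Bool) → List A → ℕ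
count p []       = 0
count p (x ∷ xs) = if p x then suc (count p xs) else count p xs

filterB : ∀ {A : Set} → (A → Bool) → List A → List A
filterB p []       = []
filterB p (x ∷ xs) = if p x then x ∷ filterB p xs else filterB p xs

allL : ∀ {A : Set} → (A → Bool) → List A → Bool
allL p []       = true
allL p (x ∷ xs) = p x ∧ allL p xs

allV : ∀ {A : Set} {m} → (A → Bool) → Vec A m → Bool
allV p []       = true
allV p (x ∷ xs) = p x ∧ allV p xs

chainOK : (ℕ → ℕ → Bool) → List ℕ → Bool
chainOK R []           = true
chainOK R (x ∷ [])     = true
chainOK R (x ∷ y ∷ ys) = R x y ∧ chainOK R (y ∷ ys)

nth : List ℕ → ℕ → Maybe ℕ
nth []       _       = nothing
nth (x ∷ xs) zero    = just x
nth (x ∷ xs) (suc n) = nth xs n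

-- (Skew) tableaux.  A filling of μ/λ (m rows) is a vector of rows; row r is
-- the list of entries in columns λ_r, …, μ_r - 1 (0-indexed columns).

cell : ℕ → List ℕ → ℕ → Maybe ℕ
cell o xs c = if o ≤ᵇ c then nth xs (c ∸ o) else nothing

strictBelow : Maybe ℕ → Maybe ℕ → Bool
strictBelow (just a) (just b) = a <ᵇ b
strictBelow _        _        = true

colPairOK : ℕ → List ℕ → ℕ → List ℕ → Bool
colPairOK o₁ xs o₂ ys =
  allL (λ c → strictBelow (cell o₁ xs c) (cell o₂ ys c)) (L.upTo (o₂ + L.length ys))

columnsOK : ∀ {m} → Vec ℕ m → Vec (List ℕ) m → Bool
columnsOK (o₁ ∷ o₂ ∷ os) (r₁ ∷ r₂ ∷ rs) = colPairOK o₁ r₁ o₂ r₂ ∧ columnsOK (o₂ ∷ os) (r₂ ∷ rs)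
columnsOK _ _ = true

rowsOK : ∀ {m} → (ℕ → ℕ → Bool) → Vec (List ℕ) m → Bool
rowsOK R T = allV (chainOK R) T

size : ∀ {m} → Vec ℕ m → ℕ
size = V.foldr _ _+_ 0

isPartitionB : ∀ {m} → Vec ℕ m → Bool
isPartitionB μ = chainOK (λ a b → b ≤ᵇ a) (V.toList μ)

-- b_{h,λμ}: fillings of μ/λ, strictly increasing along rows and columns,
-- entries of row r (1-indexed) from {1,…,h(r-1)}  (row index toℕ r = r-1).
bCoeff : ∀ {m} → ℕ → Vec ℕ m → Vec ℕ m → ℕ
bCoeff {m} h lam μ =
  count (λ T → rowsOK _<ᵇ_ T ∧ columnsOK lam T)
        (prodL (V.tabulate (λ (r : Fin m) →
            listsOf (lookup μ r ∸ lookup lam r) (range 1 (h * toℕ r)))))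

occ : ∀ {m} → ℕ → Vec (List ℕ) m → ℕ
occ v T = V.foldr _ (λ row acc → count (λ x → x ≡ᵇ v) row + acc) 0 T

-- Kostka number: SSYT of shape μ, entries in {1,…,m}, content α
-- (= coefficient of x^α in s_μ(x_1,…,x_m))
kostka : ∀ {m} → Vec ℕ m → Vec ℕ m → ℕ
kostka {m} μ α =
  count (λ T → rowsOK _≤ᵇ_ T ∧ columnsOK (V.replicate m 0) T
               ∧ allV (λ (i : Fin m) → occ (suc (toℕ i)) T ≡ᵇ lookup α i) (V.allFin m))
        (prodL (V.map (λ k → listsOf k (range 1 m)) μ))

-- A(h,λ): partitions μ ⊇ λ (≤ m rows) with b_{h,λμ} ≠ 0.  Row r (0-indexed)
-- of μ/λ holds strictly increasing entries from a set of size h·r, so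
-- necessarily λ_r ≤ μ_r ≤ λ_r + h·r; we enumerate this box and filter.
Aset : ∀ {m} → ℕ → Vec ℕ m → List (Vec ℕ m)
Aset {m} h lam =
  filterB (λ μ → isPartitionB μ ∧ not (bCoeff h lam μ ≡ᵇ 0))
    (prodL (V.tabulate (λ (r : Fin m) → range (lookup lam r) (lookup lam r + h * toℕ r))))

sumℤ : List ℤ → ℤ
sumℤ = L.foldr ℤ._+_ (+ 0)

-- coefficient of x^α in G_{h,λ}(x_1,…,x_m) = Σ_{μ∈A(h,λ)} (-1)^{|μ/λ|} b_{h,λμ} s_μ
coeffG : ∀ {m} → ℕ → Vec ℕ m → Vec ℕ m → ℤ
coeffG h lam α =
  sumℤ (L.map (λ μ → (-1ℤ ℤ.^ (size μ ∸ size lam)) ℤ.* (+ (bCoeff h lam μ * kostka μ α)))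
              (Aset h lam))

Pt : ℕ → Set
Pt m = Vec ℚ m

ofℕ : ∀ {m} → Vec ℕ m → Pt m
ofℕ = V.map (λ n → + n ℚ./ 1)

ofℤ : ∀ {m} → Vec ℤ m → Pt m
ofℤ = V.map (λ z → z ℚ./ 1)

dot : ∀ {m} → Pt m → Pt m → ℚ
dot u v = V.foldr _ ℚ._+_ 0ℚ (V.zipWith ℚ._*_ u v)

combo : ∀ {m} → List (ℚ × Pt m) → Pt m
combo {m} = L.foldr (λ wv acc → V.zipWith ℚ._+_ (V.map (proj₁ wv ℚ.*_) (proj₂ wv)) acc)
                    (V.replicate m 0ℚ)

weight : ∀ {m} → List (ℚ × Pt m) → ℚ
weight = L.foldr (λ wv acc → proj₁ wv ℚ.+ acc) 0ℚ

ConvHull : ∀ {m} → (Pt m → Set) → Pt m → Set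
ConvHull {m} S q = Σ (List (ℚ × Pt m)) λ ws →
  All (λ wv → (0ℚ ℚ.≤ proj₁ wv) × S (proj₂ wv)) ws × weight ws ≡ 1ℚ × combo ws ≡ q

AffHull : ∀ {m} → (Pt m → Set) → Pt m → Set
AffHull {m} S q = Σ (List (ℚ × Pt m)) λ ws →
  All (λ wv → S (proj₂ wv)) ws × weight ws ≡ 1ℚ × combo ws ≡ q

Supp : ∀ {m} → ℕ → Vec ℕ m → Pt m → Set
Supp {m} h lam q = Σ (Vec ℕ m) λ α → (coeffG h lam α ≢ + 0) × ofℕ α ≡ q

NewtG : ∀ {m} → ℕ → Vec ℕ m → Pt m → Set
NewtG h lam = ConvHull (Supp h lam)

Valid : ∀ {m} → (Pt m → Set) → Pt m → ℚ → Set
Valid P ℓ c = ∀ q → P q → dot ℓ q ℚ.≤ c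

Face : ∀ {m} → (Pt m → Set) → Pt m → ℚ → Pt m → Set
Face P ℓ c q = P q × dot ℓ q ≡ c

ProperFace : ∀ {m} → (Pt m → Set) → Pt m → ℚ → Set
ProperFace {m} P ℓ c = Valid P ℓ c × Σ (Pt m) λ q → P q × dot ℓ q ℚ.< c

Facet : ∀ {m} → (Pt m → Set) → Pt m → ℚ → Set
Facet {m} P ℓ c = ProperFace P ℓ c ×
  (∀ (ℓ' : Pt m) (c' : ℚ) → ProperFace P ℓ' c' →
     (∀ q → Face P ℓ c q → Face P ℓ' c' q) → (∀ q → Face P ℓ' c' q → Face P ℓ c q))

RelInt : ∀ {m} → (Pt m → Set) → Pt m → Set
RelInt {m} P p = P p × (∀ (ℓ : Pt m) (c : ℚ) → Valid P ℓ c → dot ℓ p ≡ c →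
                          ∀ q → P q → dot ℓ q ≡ c)

-- lattice point p at lattice distance 1 from the facet F = P ∩ {ℓ·x = c}:
-- F is nonempty, p lies strictly on the inner side, and no lattice point of
-- aff(P) lies strictly between aff(F) = aff(P) ∩ {ℓ·x = c} and its parallel
-- translate aff(P) ∩ {ℓ·x = ℓ·p} through p.
LatticeDist1 : ∀ {m} → (Pt m → Set) → Vec ℤ m → Pt m → ℚ → Set
LatticeDist1 {m} P p ℓ c =
  (Σ (Pt m) λ q → Face P ℓ c q) ×
  dot ℓ (ofℤ p) ℚ.< c ×
  (∀ (z : Vec ℤ m) → AffHull P (ofℤ z) →
     dot ℓ (ofℤ p) ℚ.< dot ℓ (ofℤ z) → dot ℓ (ofℤ z) ℚ.< c → ⊥)

IsReflexive : ∀ {m} → (Pt m → Set) → Set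
IsReflexive {m} P = Σ (Vec ℤ m) λ p → RelInt P (ofℤ p) ×
  (∀ (ℓ : Pt m) (c : ℚ) → Facet P ℓ c → LatticeDist1 P p ℓ c)

IsPartition : ∀ {m} → Vec ℕ m → Set
IsPartition {m} lam = ∀ (i j : Fin m) → i F.≤ j → lookup lam j ℕ.≤ lookup lam i

-- The four families of (h, λ) in the theorem (h ≥ 1 assumed throughout).
ReflexiveCase : (m : ℕ) → ℕ → Vec ℕ m → Set
ReflexiveCase m h lam =
  -- (2,…,2,0,…,0) ⊢ m-1, m = 2k+1 odd ≥ 3
  (Σ ℕ λ k → 1 ℕ.≤ k × m ≡ 2 * k + 1 ×
     (∀ (i : Fin m) → (toℕ i ℕ.< k → lookup lam i ≡ 2) × (k ℕ.≤ toℕ i → lookup lam i ≡ 0)))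
  ⊎
  -- (2,…,2,1,0,…,0) ⊢ m-1, m = 2k+2 even ≥ 4
  (Σ ℕ λ k → 1 ℕ.≤ k × m ≡ 2 * k + 2 ×
     (∀ (i : Fin m) → (toℕ i ℕ.< k → lookup lam i ≡ 2) × (toℕ i ≡ k → lookup lam i ≡ 1)
                      × (k ℕ.< toℕ i → lookup lam i ≡ 0)))
  ⊎
  (2 ℕ.≤ h × (∀ (i : Fin m) → (suc (toℕ i) ℕ.< m → lookup lam i ≡ m + 1)
                             × (suc (toℕ i) ≡ m → lookup lam i ≡ 0)))
  ⊎
  (h ≡ 1 × m ≡ 3 × (∀ (i : Fin m) → (toℕ i ℕ.< 2 → lookup lam i ≡ 4) × (toℕ i ≡ 2 → lookup lam i ≡ 0)))

{-# OPTIONS --safe #-}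
-- In row r (from 0) a right-justified filling shows b ≠ 0 as soon as λ_r ≤ μ_r ≤ λ_r + h r, and all
-- terms contributing to one coefficient of G have the same sign.  Hence x^α occurs in G exactly when
-- α is majorised by such a partition μ, and Newt(G) is the S_m-invariant polytope given by bounds on
-- the sums over subsets of the coordinates.
--
-- Necessity: if λ ≠ 0 then x_i ≤ λ_1 and Σ x ≥ |λ| define facets, so the interior lattice point is
-- (λ_1 - 1,…,λ_1 - 1) and m (λ_1 - 1) = |λ| + 1.  If λ_1 > λ_{m-1}, then x_i ≥ 0 is a facet too, so
-- λ_1 = 2; two entries 1 in λ would give a further facet, at distance greater than 1.  Otherwise
-- λ = (m+1,…,m+1,0), and when h(m-1) < m+1 the facet bounding Σ x from above forces h(m-1) = 2.
--
-- Sufficiency: the polytope is a box cut by bounds on Σ x (apart from h = 1, λ = (2,0,0)), every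
-- proper face lies in a facet {n · x = n · p + 1} with n = ± an indicator vector, and the points
-- p ± e_i, p + e_i - e_j on this facet determine n up to scaling.
module Submission where

open import Defs
import Algebra.Properties.Group
open import Data.Bool using (Bool; true; false; _∧_; _∨_; not; if_then_else_) renaming (T to True)
open import Data.Empty using (⊥; ⊥-elim)
open import Data.Fin as F using (Fin; zero; suc; toℕ)
import Data.Fin.Properties as FP
open import Data.Integer as ℤ using (ℤ; +_; -1ℤ)
import Data.Integer.Properties as ℤP
open import Data.Integer.Tactic.RingSolver using () renaming (solve-∀ to ℤsolve-∀)
open import Data.List as L using (List; []; _∷_)
open import Data.List.Membership.Propositional using (_∈_; lose; find)
open import Data.List.Membership.Propositional.Properties using (∈-concatMap⁺; ∈-concatMap⁻; ∈-map⁺; ∈-map⁻; ∈-upTo⁺; ∈-upTo⁻)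
import Data.List.Properties as LP
open import Data.List.Relation.Unary.All as All using (All; []; _∷_)
import Data.List.Relation.Unary.All.Properties as AllP
open import Data.List.Relation.Unary.Any using (here; there)
open import Data.Maybe using (just; nothing)
open import Data.Nat as ℕ using (ℕ; zero; suc; _+_; _*_; _∸_; _⊓_; _≤_; _<_; _≤ᵇ_; _<ᵇ_; _≡ᵇ_; z≤n; s≤s; z<s; s<s; pred; s≤s⁻¹; _≤?_; _<?_)
import Data.Nat.Coprimality as Coprime
open import Data.Nat.ListAction using (sum)
import Data.Nat.Properties as ℕP
open import Data.Nat.Tactic.RingSolver using (solve-∀)
open import Data.Product using (∃; _×_; _,_; proj₁; proj₂)
open import Data.Rational as ℚ using (ℚ; 0ℚ; 1ℚ)
import Data.Rational.Properties as ℚP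
open import Data.Rational.Solver using (module +-*-Solver)
open import Data.Sum using (_⊎_; inj₁; inj₂)
open import Data.Unit using (tt)
open import Data.Vec as V using (Vec; []; _∷_; lookup)
import Data.Vec.Properties as VP
open import Function using (_∘_; id; case_of_)
open import Relation.Binary using (Tri; tri<; tri≈; tri>)
open import Relation.Binary.PropositionalEquality using (_≡_; _≢_; refl; sym; trans; cong; cong₂; subst; subst₂; module ≡-Reasoning)
open import Relation.Nullary using (¬_; Dec; yes; no)
open +-*-Solver using (solve; con; _:+_; _:*_; :-_; _:=_)
open Algebra.Properties.Group ℚP.+-0-group using () renaming (∙-cancelʳ to ℚ+-cancelʳ; ⁻¹-involutive to ℚ-involutive)

-- Enumerations and Boolean predicates.

-- Facets are quantified over all rational functionals, whereas Newt(G) is known only through its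
-- exponents. Every statement about a functional is therefore reduced to exponents: a point of the
-- hull that attains a maximum is a convex combination of maximising exponents, and a functional is
-- pinned down by pairs of exponents on a face that differ by a unit vector or by a transposition.
-- The facets are never enumerated: necessity exhibits a few of them, sufficiency shows that no
-- others have to be considered. The constants come from the equation for |λ|. If λ_1 = 2 it reads
-- |λ| = m - 1, and as at most one entry 1 is allowed, the parity of m decides between the two
-- families of 2s. If λ = (a,...,a,0) it reads m (a - 1) = (m - 1) a + 1, hence a = m + 1. The
-- equation h (m - 1) = 2 has the solutions (h, m) = (2, 2), which belongs to the family with h ≥ 2,
-- and (1, 3), which is the isolated case (4,4,0).

∧⁻ : ∀ {a b} → a ∧ b ≡ true → a ≡ true × b ≡ true
∧⁻ {true} eq = refl , eq

∧⁺ : ∀ {a b} → a ≡ true → b ≡ true → a ∧ b ≡ true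
∧⁺ refl refl = refl

T⇒≡ : ∀ {b} → True b → b ≡ true
T⇒≡ {true} _ = refl

≡⇒T : ∀ {b} → b ≡ true → True b
≡⇒T refl = tt

≤ᵇ⁺ : ∀ {m n} → m ≤ n → (m ≤ᵇ n) ≡ true
≤ᵇ⁺ p = T⇒≡ (ℕP.≤⇒≤ᵇ p)

≤ᵇ⁻ : ∀ {m n} → (m ≤ᵇ n) ≡ true → m ≤ n
≤ᵇ⁻ {m} {n} p = ℕP.≤ᵇ⇒≤ m n (≡⇒T p)

<ᵇ⁺ : ∀ {m n} → m < n → (m <ᵇ n) ≡ true
<ᵇ⁺ p = T⇒≡ (ℕP.<⇒<ᵇ p)

<ᵇ⁻ : ∀ {m n} → (m <ᵇ n) ≡ true → m < n
<ᵇ⁻ {m} {n} p = ℕP.<ᵇ⇒< m n (≡⇒T p)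

≡ᵇ⁺ : ∀ {m n} → m ≡ n → (m ≡ᵇ n) ≡ true
≡ᵇ⁺ {m} {n} p = T⇒≡ (ℕP.≡⇒≡ᵇ m n p)

≡ᵇ⁻ : ∀ {m n} → (m ≡ᵇ n) ≡ true → m ≡ n
≡ᵇ⁻ {m} {n} p = ℕP.≡ᵇ⇒≡ m n (≡⇒T p)

≢⇒≡ᵇ-false : ∀ {m n} → m ≢ n → (m ≡ᵇ n) ≡ false
≢⇒≡ᵇ-false {m} {n} p with m ≡ᵇ n in eq
... | false = refl
... | true = ⊥-elim (p (≡ᵇ⁻ eq))

count-∈ : ∀ {A : Set} {p : A → Bool} {x xs} → x ∈ xs → p x ≡ true → count p xs ≢ 0
count-∈ {p = p} (here refl) px eq rewrite px = case eq of λ ()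
count-∈ {p = p} {xs = y ∷ ys} (there x∈) px eq with p y
... | true = case eq of λ ()
... | false = count-∈ x∈ px eq

count-∃ : ∀ {A : Set} (p : A → Bool) xs → count p xs ≢ 0 → ∃ λ x → x ∈ xs × p x ≡ true
count-∃ p [] ne = ⊥-elim (ne refl)
count-∃ p (x ∷ xs) ne with p x in eq
... | true = x , here refl , eq
... | false with count-∃ p xs ne
...   | y , y∈ , py = y , there y∈ , py

∈-filterB⁺ : ∀ {A : Set} {p : A → Bool} {x xs} → x ∈ xs → p x ≡ true → x ∈ filterB p xs
∈-filterB⁺ (here refl) px rewrite px = here refl
∈-filterB⁺ {p = p} {xs = y ∷ ys} (there x∈) px with p y
... | true = there (∈-filterB⁺ x∈ px)
... | false = ∈-filterB⁺ x∈ px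

∈-filterB⁻ : ∀ {A : Set} (p : A → Bool) {x} xs → x ∈ filterB p xs → x ∈ xs × p x ≡ true
∈-filterB⁻ p (y ∷ ys) x∈ with p y in eq
... | false = let a , b = ∈-filterB⁻ p ys x∈ in there a , b
∈-filterB⁻ p (y ∷ ys) (here refl) | true = here refl , eq
∈-filterB⁻ p (y ∷ ys) (there x∈) | true = let a , b = ∈-filterB⁻ p ys x∈ in there a , b

∈-prodL⁺ : ∀ {A : Set} {m} (v : Vec A m) (xss : Vec (List A) m) →
  (∀ i → lookup v i ∈ lookup xss i) → v ∈ prodL xss
∈-prodL⁺ [] [] h = here refl
∈-prodL⁺ (x ∷ v) (xs ∷ xss) h =
  ∈-concatMap⁺ (λ x → L.map (x ∷_) (prodL xss))
    (lose (h zero) (∈-map⁺ (x ∷_) (∈-prodL⁺ v xss (h ∘ suc))))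

∈-prodL⁻ : ∀ {A : Set} {m} (v : Vec A m) (xss : Vec (List A) m) →
  v ∈ prodL xss → ∀ i → lookup v i ∈ lookup xss i
∈-prodL⁻ (x ∷ v) (xs ∷ xss) v∈ i
  with find (∈-concatMap⁻ (λ x → L.map (x ∷_) (prodL xss)) {xs = xs} v∈)
... | y , y∈ , v∈′ with ∈-map⁻ (y ∷_) v∈′
... | w , w∈ , refl with i
...   | zero = y∈
...   | suc i′ = ∈-prodL⁻ w xss w∈ i′

∈-listsOf⁺ : ∀ {n xs} ys → L.length ys ≡ n → All (_∈ xs) ys → ys ∈ listsOf n xs
∈-listsOf⁺ {zero} [] eq h = here refl
∈-listsOf⁺ {suc n} {xs} (y ∷ ys) eq (y∈ ∷ h) =
  ∈-concatMap⁺ (λ x → L.map (x ∷_) (listsOf n xs))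
    (lose y∈ (∈-map⁺ (y ∷_) (∈-listsOf⁺ ys (ℕP.suc-injective eq) h)))

∈-listsOf⁻ : ∀ n xs {ys} → ys ∈ listsOf n xs → L.length ys ≡ n × All (_∈ xs) ys
∈-listsOf⁻ zero xs (here refl) = refl , []
∈-listsOf⁻ (suc n) xs ys∈
  with find (∈-concatMap⁻ (λ x → L.map (x ∷_) (listsOf n xs)) {xs = xs} ys∈)
... | y , y∈ , ys∈′ with ∈-map⁻ (y ∷_) ys∈′
... | zs , zs∈ , refl = let a , b = ∈-listsOf⁻ n xs zs∈ in cong suc a , y∈ ∷ b

∈-range⁺ : ∀ {a b x} → a ≤ x → x ≤ b → x ∈ range a b
∈-range⁺ {a} {b} {x} a≤x x≤b =
  subst (_∈ range a b) (ℕP.m+[n∸m]≡n a≤x)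
    (∈-map⁺ (λ y → a + y) (∈-upTo⁺ (ℕP.∸-monoˡ-< (s≤s x≤b) a≤x)))

∈-range⁻ : ∀ a b {x} → x ∈ range a b → a ≤ x × x ≤ b
∈-range⁻ a b x∈ with ∈-map⁻ (λ y → a + y) x∈
... | y , y∈ , refl = ℕP.m≤m+n a y , s≤s⁻¹ (subst (_≤ suc b) (ℕP.+-suc a y)
   (subst (a + suc y ≤_) (ℕP.m+[n∸m]≡n a≤) (ℕP.+-monoʳ-≤ a (∈-upTo⁻ y∈))))
  where
  a≤ : a ≤ suc b
  a≤ with a ≤? suc b
  ... | yes p = p
  ... | no ¬p with subst (suc y ≤_) (ℕP.m≤n⇒m∸n≡0 (ℕP.<⇒≤ (ℕP.≰⇒> ¬p))) (∈-upTo⁻ y∈)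
  ...   | ()

allL⁺ : ∀ {A : Set} {p : A → Bool} xs → (∀ {x} → x ∈ xs → p x ≡ true) → allL p xs ≡ true
allL⁺ [] h = refl
allL⁺ (x ∷ xs) h = ∧⁺ (h (here refl)) (allL⁺ xs (h ∘ there))

allL⁻ : ∀ {A : Set} {p : A → Bool} {x} xs → allL p xs ≡ true → x ∈ xs → p x ≡ true
allL⁻ (x ∷ xs) h (here refl) = proj₁ (∧⁻ h)
allL⁻ {p = p} (x ∷ xs) h (there x∈) = allL⁻ xs (proj₂ (∧⁻ {p x} h)) x∈

allV⁺ : ∀ {A : Set} {m} {p : A → Bool} (v : Vec A m) → (∀ i → p (lookup v i) ≡ true) → allV p v ≡ true
allV⁺ [] h = refl
allV⁺ (x ∷ v) h = ∧⁺ (h zero) (allV⁺ v (h ∘ suc))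

allV⁻ : ∀ {A : Set} {m} {p : A → Bool} (v : Vec A m) → allV p v ≡ true → ∀ i → p (lookup v i) ≡ true
allV⁻ (x ∷ v) h zero = proj₁ (∧⁻ h)
allV⁻ {p = p} (x ∷ v) h (suc i) = allV⁻ v (proj₂ (∧⁻ {p x} h)) i

-- Entries of a vector indexed by ℕ, with the default d past the end.
atD : ∀ {A : Set} {m} → A → Vec A m → ℕ → A
atD d [] _ = d
atD d (x ∷ v) zero = x
atD d (x ∷ v) (suc i) = atD d v i

at : ∀ {m} → Vec ℕ m → ℕ → ℕ
at = atD 0

row : ∀ {m} → Vec (List ℕ) m → ℕ → List ℕ
row = atD []

atD-lookup : ∀ {A : Set} {m} (d : A) (v : Vec A m) i → atD d v (toℕ i) ≡ lookup v i
atD-lookup d (x ∷ v) zero = refl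
atD-lookup d (x ∷ v) (suc i) = atD-lookup d v i

atD-≥ : ∀ {A : Set} {m} (d : A) (v : Vec A m) {i} → m ≤ i → atD d v i ≡ d
atD-≥ d [] _ = refl
atD-≥ d (x ∷ v) (s≤s p) = atD-≥ d v p

atD-tabulate : ∀ {A : Set} (d : A) (f : ℕ → A) m {i} → i < m → atD d (V.tabulate {n = m} (f ∘ toℕ)) i ≡ f i
atD-tabulate d f (suc m) {zero} p = refl
atD-tabulate d f (suc m) {suc i} (s≤s p) = atD-tabulate d (f ∘ suc) m p

atD-replicate : ∀ {A : Set} (d : A) m i → atD d (V.replicate m d) i ≡ d
atD-replicate d zero i = refl
atD-replicate d (suc m) zero = refl
atD-replicate d (suc m) (suc i) = atD-replicate d m i

fin : ∀ {m i} → i < m → ∃ λ (j : Fin m) → toℕ j ≡ i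
fin p = F.fromℕ< p , FP.toℕ-fromℕ< p

nth-< : ∀ xs {c a} → nth xs c ≡ just a → c < L.length xs
nth-< (x ∷ xs) {zero} eq = z<s
nth-< (x ∷ xs) {suc c} eq = s<s (nth-< xs eq)

nth-just : ∀ xs {c} → c < L.length xs → ∃ λ a → nth xs c ≡ just a
nth-just (x ∷ xs) {zero} p = x , refl
nth-just (x ∷ xs) {suc c} (s≤s p) = nth-just xs p

nth-∈ : ∀ xs {c a} → nth xs c ≡ just a → a ∈ xs
nth-∈ (x ∷ xs) {zero} refl = here refl
nth-∈ (x ∷ xs) {suc c} eq = there (nth-∈ xs eq)

cell-< : ∀ o xs {c a} → cell o xs c ≡ just a → c < o + L.length xs
cell-< o xs {c} eq with o ≤ᵇ c in le
... | true = subst (_< o + L.length xs) (ℕP.m+[n∸m]≡n (≤ᵇ⁻ {o} le)) (ℕP.+-monoʳ-< o (nth-< xs eq))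

strictBelow⁺ : ∀ x y → (∀ a b → x ≡ just a → y ≡ just b → a < b) → strictBelow x y ≡ true
strictBelow⁺ (just a) (just b) h = <ᵇ⁺ (h a b refl refl)
strictBelow⁺ (just a) nothing h = refl
strictBelow⁺ nothing y h = refl

columnsOK⁺ : ∀ {m} (os : Vec ℕ m) (T : Vec (List ℕ) m) →
  (∀ i c a b → suc i < m → cell (at os i) (row T i) c ≡ just a →
     cell (at os (suc i)) (row T (suc i)) c ≡ just b → a < b) →
  columnsOK os T ≡ true
columnsOK⁺ [] [] h = refl
columnsOK⁺ (o ∷ []) (r ∷ []) h = refl
columnsOK⁺ (o₁ ∷ o₂ ∷ os) (r₁ ∷ r₂ ∷ rs) h =
  ∧⁺ (allL⁺ (L.upTo (o₂ + L.length r₂)) λ {c} _ → strictBelow⁺ _ _ λ a b → h 0 c a b (s<s z<s))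
     (columnsOK⁺ (o₂ ∷ os) (r₂ ∷ rs) λ i c a b p → h (suc i) c a b (s<s p))

columnsOK⁻ : ∀ {m} (os : Vec ℕ m) (T : Vec (List ℕ) m) → columnsOK os T ≡ true →
  ∀ i c a b → suc i < m → cell (at os i) (row T i) c ≡ just a →
     cell (at os (suc i)) (row T (suc i)) c ≡ just b → a < b
columnsOK⁻ (o₁ ∷ []) (r₁ ∷ []) h i c a b (s≤s ())
columnsOK⁻ (o₁ ∷ o₂ ∷ os) (r₁ ∷ r₂ ∷ rs) h zero c a b _ eqa eqb =
  <ᵇ⁻ (subst₂ (λ x y → strictBelow x y ≡ true) eqa eqb
    (allL⁻ (L.upTo (o₂ + L.length r₂)) (proj₁ (∧⁻ h)) (∈-upTo⁺ (cell-< o₂ r₂ eqb))))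
columnsOK⁻ (o₁ ∷ o₂ ∷ os) (r₁ ∷ r₂ ∷ rs) h (suc i) c a b (s≤s p) =
  columnsOK⁻ (o₂ ∷ os) (r₂ ∷ rs) (proj₂ (∧⁻ {colPairOK o₁ r₁ o₂ r₂} h)) i c a b p

chainOK-applyUpTo : ∀ (R : ℕ → ℕ → Bool) f n → (∀ i → suc i < n → R (f i) (f (suc i)) ≡ true) →
  chainOK R (L.applyUpTo f n) ≡ true
chainOK-applyUpTo R f zero h = refl
chainOK-applyUpTo R f (suc zero) h = refl
chainOK-applyUpTo R f (suc (suc n)) h =
  ∧⁺ (h 0 (s<s z<s)) (chainOK-applyUpTo R (f ∘ suc) (suc n) λ i p → h (suc i) (s<s p))

nth-applyUpTo : ∀ f n {c a} → nth (L.applyUpTo f n) c ≡ just a → c < n × a ≡ f c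
nth-applyUpTo f (suc n) {zero} refl = z<s , refl
nth-applyUpTo f (suc n) {suc c} eq = let p , q = nth-applyUpTo (f ∘ suc) n eq in s<s p , q

isPartitionB⁺ : ∀ {m} (μ : Vec ℕ m) → (∀ i → at μ (suc i) ≤ at μ i) → isPartitionB μ ≡ true
isPartitionB⁺ [] h = refl
isPartitionB⁺ (x ∷ []) h = refl
isPartitionB⁺ (x ∷ y ∷ μ) h = ∧⁺ (≤ᵇ⁺ (h 0)) (isPartitionB⁺ (y ∷ μ) (h ∘ suc))

isPartitionB⁻ : ∀ {m} (μ : Vec ℕ m) → isPartitionB μ ≡ true → ∀ i → at μ (suc i) ≤ at μ i
isPartitionB⁻ [] h i = z≤n
isPartitionB⁻ (x ∷ []) h i = z≤n
isPartitionB⁻ (x ∷ y ∷ μ) h zero = ≤ᵇ⁻ (proj₁ (∧⁻ h))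
isPartitionB⁻ (x ∷ y ∷ μ) h (suc i) = isPartitionB⁻ (y ∷ μ) (proj₂ (∧⁻ {y ≤ᵇ x} h)) i

-- Semistandard fillings of prescribed content.

sumTo : (ℕ → ℕ) → ℕ → ℕ
sumTo f zero = 0
sumTo f (suc n) = sumTo f n + f n

sumTo-cong : ∀ {f g} n → (∀ i → i < n → f i ≡ g i) → sumTo f n ≡ sumTo g n
sumTo-cong zero h = refl
sumTo-cong (suc n) h = cong₂ _+_ (sumTo-cong n λ i p → h i (ℕP.m<n⇒m<1+n p)) (h n ℕP.≤-refl)

sumTo-mono : ∀ {f g} n → (∀ i → i < n → f i ≤ g i) → sumTo f n ≤ sumTo g n
sumTo-mono zero h = z≤n
sumTo-mono (suc n) h = ℕP.+-mono-≤ (sumTo-mono n λ i p → h i (ℕP.m<n⇒m<1+n p)) (h n ℕP.≤-refl)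

+-interchange : ∀ a b c d → (a + b) + (c + d) ≡ (a + c) + (b + d)
+-interchange = solve-∀

sumTo-+ : ∀ f g n → sumTo (λ i → f i + g i) n ≡ sumTo f n + sumTo g n
sumTo-+ f g zero = refl
sumTo-+ f g (suc n) = trans (cong (_+ (f n + g n)) (sumTo-+ f g n)) (+-interchange (sumTo f n) (sumTo g n) (f n) (g n))

sumTo-shift : ∀ f n → sumTo f (suc n) ≡ f 0 + sumTo (f ∘ suc) n
sumTo-shift f zero = sym (ℕP.+-identityʳ (f 0))
sumTo-shift f (suc n) = trans (cong (_+ f (suc n)) (sumTo-shift f n)) (ℕP.+-assoc (f 0) _ _)

sumTo-0 : ∀ {f} n → (∀ i → i < n → f i ≡ 0) → sumTo f n ≡ 0
sumTo-0 zero h = refl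
sumTo-0 (suc n) h = cong₂ _+_ (sumTo-0 n λ i p → h i (ℕP.m<n⇒m<1+n p)) (h n ℕP.≤-refl)

sumTo-const : ∀ c n → sumTo (λ _ → c) n ≡ n * c
sumTo-const c zero = refl
sumTo-const c (suc n) = trans (cong (_+ c) (sumTo-const c n)) (ℕP.+-comm (n * c) c)

term≤sumTo : ∀ f n {i} → i < n → f i ≤ sumTo f n
term≤sumTo f (suc n) {i} (s≤s i≤n) with ℕP.m≤n⇒m<n∨m≡n i≤n
... | inj₁ i<n = ℕP.≤-trans (term≤sumTo f n i<n) (ℕP.m≤m+n _ _)
... | inj₂ refl = ℕP.m≤n+m _ _

sumTo-mono-length : ∀ f {k n} → k ≤ n → sumTo f k ≤ sumTo f n
sumTo-mono-length f {n = zero} z≤n = z≤n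
sumTo-mono-length f {k} {suc n} k≤ with ℕP.m≤n⇒m<n∨m≡n k≤
... | inj₁ (s≤s k≤n) = ℕP.≤-trans (sumTo-mono-length f k≤n) (ℕP.m≤m+n _ _)
... | inj₂ refl = ℕP.≤-refl

sumTo-stable : ∀ f {k} n → k ≤ n → (∀ i → k ≤ i → f i ≡ 0) → sumTo f n ≡ sumTo f k
sumTo-stable f zero z≤n h = refl
sumTo-stable f {k} (suc n) k≤ h with ℕP.m≤n⇒m<n∨m≡n k≤
... | inj₁ (s≤s k≤n) = trans (cong₂ _+_ (sumTo-stable f n k≤n h) (h n k≤n)) (ℕP.+-identityʳ _)
... | inj₂ refl = refl

sumTo-telescope : ∀ (N : ℕ → ℕ) → N 0 ≡ 0 → (∀ i → N i ≤ N (suc i)) → ∀ n → sumTo (λ i → N (suc i) ∸ N i) n ≡ N n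
sumTo-telescope N N0 mono zero = sym N0
sumTo-telescope N N0 mono (suc n) =
  trans (cong (_+ (N (suc n) ∸ N n)) (sumTo-telescope N N0 mono n)) (ℕP.m+[n∸m]≡n (mono n))

-- t + Σ_{i∈S} α i ≤ P |S| for every subset S of {0,…,k-1}.
Dom : ℕ → (ℕ → ℕ) → ℕ → (ℕ → ℕ) → Set
Dom zero α t P = t ≤ P 0
Dom (suc k) α t P = Dom k α t P × Dom k α (t + α k) (P ∘ suc)

Dom-mono : ∀ k {α t P Q} → (∀ j → P j ≤ Q j) → Dom k α t P → Dom k α t Q
Dom-mono zero h d = ℕP.≤-trans d (h 0)
Dom-mono (suc k) h (d , e) = Dom-mono k h d , Dom-mono k (h ∘ suc) e

Dom-none : ∀ k {α t P} → Dom k α t P → t ≤ P 0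
Dom-none zero d = d
Dom-none (suc k) (d , _) = Dom-none k d

Dom-all : ∀ k {α t P} → Dom k α t P → t + sumTo α k ≤ P k
Dom-all zero {t = t} {P} d = subst (_≤ P 0) (sym (ℕP.+-identityʳ t)) d
Dom-all (suc k) {α} {t} {P} (_ , e) =
  subst (_≤ P (suc k)) (reorder t (α k) (sumTo α k)) (Dom-all k e)
  where
  reorder : ∀ t a s → t + a + s ≡ t + (s + a)
  reorder = solve-∀

-- For `a` the multiplicity of the last letter, the two hypotheses are the halves of `Dom (suc k)`:
-- the subsets without that letter and those with it. The conclusion bounds the remaining letters by
-- the partial sums of the shape that is left when that letter is removed.
Dom-⊓ : ∀ k {α t P Q} a → Dom k α t P → Dom k α (t + a) Q → Dom k α t (λ j → P j ⊓ (Q j ∸ a))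
Dom-⊓ zero {t = t} {Q = Q} a d e =
  ℕP.⊓-glb d (subst (_≤ Q 0 ∸ a) (ℕP.m+n∸n≡m t a) (ℕP.∸-monoˡ-≤ a e))
Dom-⊓ (suc k) {α} {t} {P} {Q} a (d , d′) (e , e′) =
  Dom-⊓ k a d e ,
  Dom-⊓ k a d′ (subst (λ x → Dom k α x (Q ∘ suc)) (reorder t a (α k)) e′)
  where
  reorder : ∀ t a s → t + a + s ≡ t + s + a
  reorder = solve-∀

-- For every c, a subset S of size j satisfies Σ_S α ≤ j c + Σ_i (α_i ∸ c). One threshold c for each
-- j thus replaces the inequalities for all subsets of that size.
Dom-threshold : ∀ k {α t P} → (∀ j → j ≤ k → ∃ λ c → t + j * c + sumTo (λ i → α i ∸ c) k ≤ P j) → Dom k α t P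
Dom-threshold zero {t = t} {P} h with h 0 z≤n
... | c , p = subst (_≤ P 0) (trans (ℕP.+-identityʳ _) (ℕP.+-identityʳ t)) p
Dom-threshold (suc k) {α} {t} {P} h = Dom-threshold k skip , Dom-threshold k take
  where
  skip : ∀ j → j ≤ k → ∃ λ c → t + j * c + sumTo (λ i → α i ∸ c) k ≤ P j
  skip j p with h j (ℕP.m≤n⇒m≤1+n p)
  ... | c , q = c , ℕP.≤-trans (ℕP.+-monoʳ-≤ (t + j * c) (ℕP.m≤m+n _ _)) q
  reorder : ∀ t c jc s e → t + (c + e) + jc + s ≡ t + (c + jc) + (s + e)
  reorder = solve-∀
  take : ∀ j → j ≤ k → ∃ λ c → t + α k + j * c + sumTo (λ i → α i ∸ c) k ≤ P (suc j)
  take j p with h (suc j) (s≤s p)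
  ... | c , q = c , ℕP.≤-trans
    (ℕP.+-monoˡ-≤ (sumTo (λ i → α i ∸ c) k) (ℕP.+-monoˡ-≤ (j * c) (ℕP.+-monoʳ-≤ t (ℕP.m≤n+m∸n (α k) c))))
    (subst (_≤ P (suc j)) (sym (reorder t c (j * c) (sumTo (λ i → α i ∸ c) k) (α k ∸ c))) q)

-- Semistandard fillings of the shape μ by 1,…,k; n is any bound on the number of nonempty rows.
record Filling (k n : ℕ) (α μ : ℕ → ℕ) : Set where
  field
    rows : ℕ → List ℕ
    len : ∀ r → L.length (rows r) ≡ μ r
    entries : ∀ r → All (λ x → 1 ≤ x × x ≤ k) (rows r)
    weak : ∀ r → chainOK _≤ᵇ_ (rows r) ≡ true
    strict : ∀ r c a b → nth (rows r) c ≡ just a → nth (rows (suc r)) c ≡ just b → a < b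
    content : ∀ i → i < k → sumTo (λ r → count (λ x → x ≡ᵇ suc i) (rows r)) n ≡ α i

count-++ : ∀ {A : Set} (p : A → Bool) xs ys → count p (xs L.++ ys) ≡ count p xs + count p ys
count-++ p [] ys = refl
count-++ p (x ∷ xs) ys with p x
... | true = cong suc (count-++ p xs ys)
... | false = count-++ p xs ys

count-none : ∀ {A : Set} (p : A → Bool) {xs} → All (λ x → p x ≡ false) xs → count p xs ≡ 0
count-none p [] = refl
count-none p (px ∷ h) rewrite px = count-none p h

count-replicate : ∀ {A : Set} (p : A → Bool) d {v} → p v ≡ true → count p (L.replicate d v) ≡ d
count-replicate p zero pv = refl
count-replicate p (suc d) pv rewrite pv = cong suc (count-replicate p d pv)

chainOK-++ : ∀ {v} xs d → All (_≤ v) xs → chainOK _≤ᵇ_ xs ≡ true → chainOK _≤ᵇ_ (xs L.++ L.replicate d v) ≡ true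
chainOK-++ [] zero h c = refl
chainOK-++ [] (suc zero) h c = refl
chainOK-++ {v} [] (suc (suc d)) h c = ∧⁺ (≤ᵇ⁺ {v} ℕP.≤-refl) (chainOK-++ [] (suc d) h c)
chainOK-++ (x ∷ []) zero h c = refl
chainOK-++ {v} (x ∷ []) (suc d) (p ∷ h) c = ∧⁺ (≤ᵇ⁺ p) (chainOK-++ [] (suc d) h refl)
chainOK-++ (x ∷ y ∷ xs) d (p ∷ h) c = let a , b = ∧⁻ {x ≤ᵇ y} c in ∧⁺ a (chainOK-++ (y ∷ xs) d h b)

nth-++-< : ∀ xs {ys c} → c < L.length xs → nth (xs L.++ ys) c ≡ nth xs c
nth-++-< (x ∷ xs) {c = zero} p = refl
nth-++-< (x ∷ xs) {c = suc c} (s≤s p) = nth-++-< xs p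

nth-++-≥ : ∀ xs {v d c a} → L.length xs ≤ c → nth (xs L.++ L.replicate d v) c ≡ just a → a ≡ v × c < L.length xs + d
nth-++-≥ [] {d = suc d} {zero} p refl = refl , z<s
nth-++-≥ [] {d = suc d} {suc c} p eq = let q , r = nth-++-≥ [] {d = d} {c} z≤n eq in q , s<s r
nth-++-≥ (x ∷ xs) {c = suc c} (s≤s p) eq = let q , r = nth-++-≥ xs p eq in q , s<s r

-- The horizontal strip μ/ν is filled with the letter k + 1.
extend-filling : ∀ {k n α μ ν} → (∀ r → ν r ≤ μ r) → (∀ r → μ (suc r) ≤ ν r) →
  sumTo μ n ≡ sumTo ν n + α k → Filling k n α ν → Filling (suc k) n α μ
extend-filling {k} {n} {α} {μ} {ν} ν≤μ strip total F = record
  { rows = rows′ ; len = len′ ; entries = entries′ ; weak = weak′ ; strict = strict′ ; content = content′ }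
  where
  open Filling F
  d : ℕ → ℕ
  d r = μ r ∸ ν r
  rows′ : ℕ → List ℕ
  rows′ r = rows r L.++ L.replicate (d r) (suc k)
  len′ : ∀ r → L.length (rows′ r) ≡ μ r
  len′ r = trans (LP.length-++ (rows r))
    (trans (cong₂ _+_ (len r) (LP.length-replicate (d r))) (ℕP.m+[n∸m]≡n (ν≤μ r)))
  entries′ : ∀ r → All (λ x → 1 ≤ x × x ≤ suc k) (rows′ r)
  entries′ r = AllP.++⁺ (All.map (λ (a , b) → a , ℕP.m≤n⇒m≤1+n b) (entries r))
    (AllP.replicate⁺ (d r) (s≤s z≤n , ℕP.≤-refl))
  weak′ : ∀ r → chainOK _≤ᵇ_ (rows′ r) ≡ true
  weak′ r = chainOK-++ (rows r) (d r) (All.map (λ (a , b) → ℕP.m≤n⇒m≤1+n b) (entries r)) (weak r)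
  strict′ : ∀ r c a b → nth (rows′ r) c ≡ just a → nth (rows′ (suc r)) c ≡ just b → a < b
  strict′ r c a b p q with c <? ν (suc r)
  ... | yes c< = strict r c a b
        (trans (sym (nth-++-< (rows r) (subst (c <_) (sym (len r)) (ℕP.<-≤-trans c< (ℕP.≤-trans (ν≤μ (suc r)) (strip r)))))) p)
        (trans (sym (nth-++-< (rows (suc r)) (subst (c <_) (sym (len (suc r))) c<))) q)
  -- Column `c` of row r + 1 lies in the new strip. Interlacing `μ (suc r) ≤ ν r` puts the cell
  -- above it into the old part, whose letters are at most k.
  ... | no c≮ with nth-++-≥ (rows (suc r)) (subst (_≤ c) (sym (len (suc r))) (ℕP.≮⇒≥ c≮)) q
  ...   | refl , c<μ = s≤s (proj₂ (All.lookup (entries r) (nth-∈ (rows r) old)))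
        where
        c<ν : c < ν r
        c<ν = ℕP.<-≤-trans (subst (c <_) (trans (cong (_+ d (suc r)) (len (suc r))) (ℕP.m+[n∸m]≡n (ν≤μ (suc r)))) c<μ) (strip r)
        old : nth (rows r) c ≡ just a
        old = trans (sym (nth-++-< (rows r) (subst (c <_) (sym (len r)) c<ν))) p
  content′ : ∀ i → i < suc k → sumTo (λ r → count (λ x → x ≡ᵇ suc i) (rows′ r)) n ≡ α i
  content′ i (s≤s i≤k) with ℕP.m≤n⇒m<n∨m≡n i≤k
  ... | inj₁ i<k = trans (sumTo-cong n λ r _ → trans (count-++ _ (rows r) _)
          (trans (cong (λ z → count _ (rows r) + z) (count-none _ (AllP.replicate⁺ (d r) (≢⇒≡ᵇ-false λ e → ℕP.<⇒≢ i<k (sym (ℕP.suc-injective e))))))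
            (ℕP.+-identityʳ _)))
        (content i i<k)
  ... | inj₂ refl = trans (sumTo-cong n λ r _ → trans (count-++ _ (rows r) _)
          (cong₂ _+_ (count-none _ (All.map (λ (_ , b) → ≢⇒≡ᵇ-false (ℕP.<⇒≢ (s≤s b))) (entries r)))
            (count-replicate _ (d r) (≡ᵇ⁺ {suc i} refl))))
        (ℕP.+-cancelˡ-≡ (sumTo ν n) _ _ (trans (sym (sumTo-+ ν d n))
          (trans (sumTo-cong n λ r _ → ℕP.m+[n∸m]≡n (ν≤μ r)) total)))

-- Every content dominated by μ is realised.  The last letter is placed on the horizontal strip
-- μ/ν for which the partial sums of ν are min(μ_1+…+μ_j, μ_1+…+μ_{j+1} - a), a its multiplicity.
filling : ∀ k n {α μ} → k ≤ n → (∀ r → μ (suc r) ≤ μ r) → (∀ r → k ≤ r → μ r ≡ 0) →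
  Dom k α 0 (sumTo μ) → sumTo α k ≡ sumTo μ k → Filling k n α μ
filling zero n k≤n dec out d tot = record
  { rows = λ _ → [] ; len = λ r → sym (out r z≤n) ; entries = λ _ → [] ; weak = λ _ → refl
  ; strict = λ r c a b () ; content = λ i () }
filling (suc k) n {α} {μ} k<n dec out (d , e) tot = extend-filling ν≤μ strip total
    (filling k n (ℕP.<⇒≤ k<n) (λ r → ℕP.≤-trans (ν≤μ (suc r)) (strip r)) ν-out
      (Dom-mono k (λ j → ℕP.≤-reflexive (sym (sum-ν j))) (Dom-⊓ k a d e))
      (sym (trans (sum-ν k) (trans (ℕP.m≥n⇒m⊓n≡n Y≤X) (trans (cong (_∸ a) (sym tot)) (ℕP.m+n∸n≡m (sumTo α k) a))))))
  where
  a = α k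
  P : ℕ → ℕ
  P = sumTo μ
  N : ℕ → ℕ
  N j = P j ⊓ (P (suc j) ∸ a)
  a≤P : ∀ j → a ≤ P (suc j)
  a≤P j = ℕP.≤-trans (Dom-none k e) (sumTo-mono-length μ (s≤s z≤n))
  step : ∀ j → P (suc (suc j)) ∸ a ≡ (P (suc j) ∸ a) + μ (suc j)
  step j = ℕP.+-∸-comm (μ (suc j)) (a≤P j)
  -- From j to j + 1 the two terms of the minimum grow by `μ j` and by `μ (suc j)`, the smaller of
  -- the two. So the increments of `N` lie between these numbers, which makes μ/ν a horizontal
  -- strip.
  lower : ∀ j → N j + μ (suc j) ≤ N (suc j)
  lower j = ℕP.⊓-glb
    (ℕP.+-mono-≤ (ℕP.m⊓n≤m (P j) _) (dec j))
    (subst (N j + μ (suc j) ≤_) (sym (step j)) (ℕP.+-monoˡ-≤ (μ (suc j)) (ℕP.m⊓n≤n (P j) _)))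
  upper : ∀ j → N (suc j) ≤ N j + μ j
  upper j = subst (N (suc j) ≤_) (sym (ℕP.+-distribʳ-⊓ (μ j) (P j) (P (suc j) ∸ a)))
    (ℕP.⊓-mono-≤ ℕP.≤-refl (subst (_≤ P (suc j) ∸ a + μ j) (sym (step j)) (ℕP.+-monoʳ-≤ (P (suc j) ∸ a) (dec j))))
  mono : ∀ j → N j ≤ N (suc j)
  mono j = ℕP.≤-trans (ℕP.m≤m+n _ _) (lower j)
  ν : ℕ → ℕ
  ν j = N (suc j) ∸ N j
  sum-ν : ∀ j → sumTo ν j ≡ N j
  sum-ν = sumTo-telescope N refl mono
  ν≤μ : ∀ r → ν r ≤ μ r
  ν≤μ r = ℕP.m≤n+o⇒m∸n≤o (N (suc r)) (N r) (upper r)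
  strip : ∀ r → μ (suc r) ≤ ν r
  strip r = ℕP.m+n≤o⇒m≤o∸n (μ (suc r)) (subst (_≤ N (suc r)) (ℕP.+-comm (N r) (μ (suc r))) (lower r))
  -- By equality of the totals, the left side is α_0 + ... + α_{k-1}, so this is the inequality of
  -- `d` for the set of all remaining letters. From k on the second term of the minimum is therefore
  -- the smaller one, and ν has at most k rows.
  Y≤X : P (suc k) ∸ a ≤ P k
  Y≤X = subst (_≤ P k) (trans (sym (ℕP.m+n∸n≡m (sumTo α k) a)) (cong (_∸ a) tot)) (Dom-all k d)
  N-out : ∀ r → k ≤ r → N r ≡ P (suc k) ∸ a
  N-out r k≤r = trans (ℕP.m≥n⇒m⊓n≡n (ℕP.≤-trans (ℕP.≤-reflexive (cong (_∸ a) Psr)) (ℕP.≤-trans Y≤X (sumTo-mono-length μ k≤r))))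
    (cong (_∸ a) Psr)
    where
    Psr : P (suc r) ≡ P (suc k)
    Psr = sumTo-stable μ (suc r) (s≤s k≤r) out
  ν-out : ∀ r → k ≤ r → ν r ≡ 0
  ν-out r k≤r = trans (cong₂ _∸_ (N-out (suc r) (ℕP.m≤n⇒m≤1+n k≤r)) (N-out r k≤r)) (ℕP.n∸n≡0 (P (suc k) ∸ a))
  total : P n ≡ sumTo ν n + a
  total = trans (sumTo-stable μ n k<n out) (sym (trans (cong (_+ a) (trans (sum-ν n) (N-out n (ℕP.<⇒≤ k<n)))) (ℕP.m∸n+n≡m (a≤P k))))

-- The support of G_{h,λ}.

∈-prodL-tabulate⁺ : ∀ {A : Set} {m} (v : Vec A m) (f : Fin m → List A) → (∀ i → lookup v i ∈ f i) → v ∈ prodL (V.tabulate f)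
∈-prodL-tabulate⁺ v f h = ∈-prodL⁺ v (V.tabulate f) λ i → subst (lookup v i ∈_) (sym (VP.lookup∘tabulate f i)) (h i)

∈-prodL-tabulate⁻ : ∀ {A : Set} {m} (v : Vec A m) (f : Fin m → List A) → v ∈ prodL (V.tabulate f) → ∀ i → lookup v i ∈ f i
∈-prodL-tabulate⁻ v f v∈ i = subst (lookup v i ∈_) (VP.lookup∘tabulate f i) (∈-prodL⁻ v (V.tabulate f) v∈ i)

∈-prodL-map⁺ : ∀ {A B : Set} {m} (v : Vec A m) (f : B → List A) (w : Vec B m) → (∀ i → lookup v i ∈ f (lookup w i)) → v ∈ prodL (V.map f w)
∈-prodL-map⁺ v f w h = ∈-prodL⁺ v (V.map f w) λ i → subst (lookup v i ∈_) (sym (VP.lookup-map i f w)) (h i)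

∈-prodL-map⁻ : ∀ {A B : Set} {m} (v : Vec A m) (f : B → List A) (w : Vec B m) → v ∈ prodL (V.map f w) → ∀ i → lookup v i ∈ f (lookup w i)
∈-prodL-map⁻ v f w v∈ i = subst (lookup v i ∈_) (VP.lookup-map i f w) (∈-prodL⁻ v (V.map f w) v∈ i)

size-sumTo : ∀ {m} (v : Vec ℕ m) → size v ≡ sumTo (at v) m
size-sumTo [] = refl
size-sumTo {suc m} (x ∷ v) = trans (cong (λ z → x + z) (size-sumTo v)) (sym (sumTo-shift (at (x ∷ v)) m))

occ-sumTo : ∀ {m} v (T : Vec (List ℕ) m) → occ v T ≡ sumTo (λ r → count (λ x → x ≡ᵇ v) (row T r)) m
occ-sumTo v [] = refl
occ-sumTo {suc m} v (xs ∷ T) = trans (cong (λ z → count (λ x → x ≡ᵇ v) xs + z) (occ-sumTo v T))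
  (sym (sumTo-shift (λ r → count (λ x → x ≡ᵇ v) (row (xs ∷ T) r)) m))

-- Membership in A(h,λ): b_{h,λμ} ≠ 0 for all of these μ, by b-nonzero.
record Admissible {m} (h : ℕ) (lam μ : Vec ℕ m) : Set where
  field
    decreasing : ∀ i → at μ (suc i) ≤ at μ i
    lower : ∀ i → at lam i ≤ at μ i
    upper : ∀ i → at μ i ≤ at lam i + h * i

-- Right-justify each row: row r ends with h r, so that column strictness is automatic.
b-nonzero : ∀ {m h} {lam μ : Vec ℕ m} → 1 ≤ h → Admissible h lam μ → bCoeff h lam μ ≢ 0
b-nonzero {m} {h} {lam} {μ} 1≤h A = count-∈ T∈ (∧⁺ (allV⁺ T rows) cols)
  where
  open Admissible A
  d : ℕ → ℕ
  d i = at μ i ∸ at lam i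
  d≤ : ∀ i → d i ≤ h * i
  d≤ i = ℕP.m≤n+o⇒m∸n≤o (at μ i) (at lam i) (upper i)
  e : ℕ → ℕ → ℕ
  e i j = suc (h * i ∸ d i) + j
  R : ℕ → List ℕ
  R i = L.applyUpTo (e i) (d i)
  T : Vec (List ℕ) m
  T = V.tabulate (R ∘ toℕ)
  rows : ∀ i → chainOK _<ᵇ_ (lookup T i) ≡ true
  rows i = subst (λ r → chainOK _<ᵇ_ r ≡ true) (sym (VP.lookup∘tabulate (R ∘ toℕ) i))
    (chainOK-applyUpTo _<ᵇ_ (e (toℕ i)) (d (toℕ i)) λ j p → <ᵇ⁺ (ℕP.+-monoʳ-< (suc (h * toℕ i ∸ d (toℕ i))) (ℕP.n<1+n j)))
  inRow : ∀ i → R i ∈ listsOf (d i) (range 1 (h * i))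
  inRow i = ∈-listsOf⁺ (R i) (LP.length-applyUpTo (e i) (d i))
    (AllP.applyUpTo⁺₁ (e i) (d i) λ {j} j< → ∈-range⁺ (s≤s z≤n)
      (subst (e i j ≤_) (ℕP.m∸n+n≡m (d≤ i))
        (subst (_≤ h * i ∸ d i + d i) (ℕP.+-suc (h * i ∸ d i) j) (ℕP.+-monoʳ-≤ (h * i ∸ d i) j<))))
  T∈ : T ∈ prodL (V.tabulate λ (r : Fin m) → listsOf (lookup μ r ∸ lookup lam r) (range 1 (h * toℕ r)))
  T∈ = ∈-prodL-tabulate⁺ T (λ r → listsOf (lookup μ r ∸ lookup lam r) (range 1 (h * toℕ r))) λ i →
    subst₂ _∈_ (sym (VP.lookup∘tabulate (R ∘ toℕ) i))
      (cong₂ (λ x y → listsOf (x ∸ y) (range 1 (h * toℕ i))) (atD-lookup 0 μ i) (atD-lookup 0 lam i))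
      (inRow (toℕ i))
  -- In absolute columns the entry of row i in column c is h i + 1 + c - μ_i. One row further down
  -- it has grown by h + μ_i - μ_{i+1}, which is positive.
  entry : ∀ i c a → cell (at lam i) (R i) c ≡ just a → a + at μ i ≡ suc (h * i) + c
  entry i c a eq with at lam i ≤ᵇ c in le
  ... | true with nth-applyUpTo (e i) (d i) eq
  ...   | _ , refl = trans (cong₂ (λ x y → suc (h * i ∸ d i) + x + y) refl (sym (ℕP.m∸n+n≡m (lower i))))
            (trans (reorder (h * i ∸ d i) (c ∸ at lam i) (d i) (at lam i))
              (cong₂ (λ x y → suc x + y) (ℕP.m∸n+n≡m (d≤ i)) (ℕP.m∸n+n≡m (≤ᵇ⁻ {at lam i} le))))
    where
    reorder : ∀ x y d l → suc x + y + (d + l) ≡ suc (x + d) + (y + l)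
    reorder = solve-∀
  cols : columnsOK lam T ≡ true
  cols = columnsOK⁺ lam T λ i c a b p ea eb → less i c a b
    (entry i c a (trans (cong (λ r → cell (at lam i) r c) (sym (atD-tabulate [] R m (ℕP.<-trans (ℕP.n<1+n i) p)))) ea))
    (entry (suc i) c b (trans (cong (λ r → cell (at lam (suc i)) r c) (sym (atD-tabulate [] R m p))) eb))
    where
    less : ∀ i c a b → a + at μ i ≡ suc (h * i) + c → b + at μ (suc i) ≡ suc (h * suc i) + c → a < b
    less i c a b ea eb = ℕP.+-cancelʳ-< (at μ i) a b (begin-strict
      a + at μ i                      ≡⟨ ea ⟩
      suc (h * i) + c                 <⟨ ℕP.+-monoˡ-< c (s<s (ℕP.*-monoʳ-< h {{ℕ.>-nonZero 1≤h}} (ℕP.n<1+n i))) ⟩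
      suc (h * suc i) + c             ≡⟨ sym eb ⟩
      b + at μ (suc i)                ≤⟨ ℕP.+-monoʳ-≤ b (decreasing i) ⟩
      b + at μ i                      ∎)
      where open ℕP.≤-Reasoning

contributes : ∀ {m} → ℕ → Vec ℕ m → Vec ℕ m → Bool
contributes h lam μ = isPartitionB μ ∧ not (bCoeff h lam μ ≡ᵇ 0)

box : ∀ {m} → ℕ → Vec ℕ m → Fin m → List ℕ
box h lam r = range (lookup lam r) (lookup lam r + h * toℕ r)

∈-Aset⁺ : ∀ {m h} {lam μ : Vec ℕ m} → 1 ≤ h → Admissible h lam μ → μ ∈ Aset h lam
∈-Aset⁺ {m} {h} {lam} {μ} 1≤h A = ∈-filterB⁺ {p = contributes h lam}
  (∈-prodL-tabulate⁺ μ (box h lam) λ i →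
    ∈-range⁺ (subst₂ _≤_ (atD-lookup 0 lam i) (atD-lookup 0 μ i) (lower (toℕ i)))
      (subst₂ (λ x y → x ≤ y + h * toℕ i) (atD-lookup 0 μ i) (atD-lookup 0 lam i) (upper (toℕ i))))
  (∧⁺ (isPartitionB⁺ μ decreasing) (cong not (≢⇒≡ᵇ-false (b-nonzero 1≤h A))))
  where open Admissible A

∈-Aset⁻ : ∀ {m h} {lam μ : Vec ℕ m} → μ ∈ Aset h lam → Admissible h lam μ
∈-Aset⁻ {m} {h} {lam} {μ} μ∈ with ∈-filterB⁻ (contributes h lam) (prodL (V.tabulate (box h lam))) μ∈
... | μ∈′ , ok = record
  { decreasing = isPartitionB⁻ μ (proj₁ (∧⁻ {isPartitionB μ} ok))
  ; lower = λ i → proj₁ (bounds i)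
  ; upper = λ i → proj₂ (bounds i) }
  where
  bounds : ∀ i → at lam i ≤ at μ i × at μ i ≤ at lam i + h * i
  bounds i with i <? m
  ... | no i≮ rewrite atD-≥ 0 μ (ℕP.≮⇒≥ i≮) | atD-≥ 0 lam (ℕP.≮⇒≥ i≮) = z≤n , z≤n
  ... | yes i< with fin i<
  ...   | j , refl rewrite atD-lookup 0 μ j | atD-lookup 0 lam j =
          ∈-range⁻ (lookup lam j) _ (∈-prodL-tabulate⁻ μ (box h lam) μ∈′ j)

kostka-nonzero : ∀ {m} {α μ : Vec ℕ m} → Filling m m (at α) (at μ) → kostka μ α ≢ 0
kostka-nonzero {m} {α} {μ} F = count-∈ T∈ (∧⁺ (allV⁺ T rowsWeak) (∧⁺ cols (allV⁺ (V.allFin m) contents)))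
  where
  open Filling F
  T : Vec (List ℕ) m
  T = V.tabulate (rows ∘ toℕ)
  T∈ : T ∈ prodL (V.map (λ k → listsOf k (range 1 m)) μ)
  T∈ = ∈-prodL-map⁺ T (λ k → listsOf k (range 1 m)) μ λ i → subst (_∈ listsOf (lookup μ i) (range 1 m)) (sym (VP.lookup∘tabulate (rows ∘ toℕ) i))
    (∈-listsOf⁺ (rows (toℕ i)) (trans (len (toℕ i)) (atD-lookup 0 μ i)) (All.map (λ (a , b) → ∈-range⁺ a b) (entries (toℕ i))))
  rowsWeak : ∀ i → chainOK _≤ᵇ_ (lookup T i) ≡ true
  rowsWeak i = subst (λ r → chainOK _≤ᵇ_ r ≡ true) (sym (VP.lookup∘tabulate (rows ∘ toℕ) i)) (weak (toℕ i))
  cols : columnsOK (V.replicate m 0) T ≡ true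
  cols = columnsOK⁺ (V.replicate m 0) T λ i c a b p ea eb → strict i c a b
    (trans (cong₂ (λ o r → cell o r c) (sym (atD-replicate 0 m i)) (sym (atD-tabulate [] rows m (ℕP.<-trans (ℕP.n<1+n i) p)))) ea)
    (trans (cong₂ (λ o r → cell o r c) (sym (atD-replicate 0 m (suc i))) (sym (atD-tabulate [] rows m p))) eb)
  contents : ∀ i → (occ (suc (toℕ (lookup (V.allFin m) i))) T ≡ᵇ lookup α (lookup (V.allFin m) i)) ≡ true
  contents i rewrite VP.lookup-allFin i = ≡ᵇ⁺ (trans (occ-sumTo (suc (toℕ i)) T)
    (trans (sumTo-cong m λ r p → cong (count _) (atD-tabulate [] rows m p))
      (trans (content (toℕ i) (FP.toℕ<n i)) (atD-lookup 0 α i))))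

record Tableau {m} (μ α : Vec ℕ m) : Set where
  field
    T : Vec (List ℕ) m
    len : ∀ i → L.length (row T i) ≡ at μ i
    entries : ∀ i → All (λ x → 1 ≤ x × x ≤ m) (row T i)
    strict : ∀ i c a b → nth (row T i) c ≡ just a → nth (row T (suc i)) c ≡ just b → a < b
    content : ∀ i → i < m → occ (suc i) T ≡ at α i

isTableau : ∀ {m} → Vec ℕ m → Vec ℕ m → Vec (List ℕ) m → Bool
isTableau {m} μ α T = rowsOK _≤ᵇ_ T ∧ columnsOK (V.replicate m 0) T
  ∧ allV (λ (i : Fin m) → occ (suc (toℕ i)) T ≡ᵇ lookup α i) (V.allFin m)

kostka-tableau : ∀ {m} {μ α : Vec ℕ m} → kostka μ α ≢ 0 → Tableau μ α
kostka-tableau {m} {μ} {α} ne with count-∃ (isTableau μ α) (prodL (V.map (λ k → listsOf k (range 1 m)) μ)) ne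
... | T , T∈ , ok = record
  { T = T ; len = λ i → proj₁ (rows i) ; entries = λ i → proj₂ (rows i)
  ; strict = strict′
  ; content = content′ }
  where
  rest = proj₂ (∧⁻ {rowsOK _≤ᵇ_ T} ok)
  rows : ∀ i → L.length (row T i) ≡ at μ i × All (λ x → 1 ≤ x × x ≤ m) (row T i)
  rows i with i <? m
  ... | no i≮ rewrite atD-≥ [] T (ℕP.≮⇒≥ i≮) | atD-≥ 0 μ (ℕP.≮⇒≥ i≮) = refl , []
  ... | yes i< with fin i<
  ...   | j , refl rewrite atD-lookup [] T j | atD-lookup 0 μ j =
          let a , b = ∈-listsOf⁻ (lookup μ j) (range 1 m) (∈-prodL-map⁻ T (λ k → listsOf k (range 1 m)) μ T∈ j)
          in a , All.map (∈-range⁻ 1 m) b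
  strict′ : ∀ i c a b → nth (row T i) c ≡ just a → nth (row T (suc i)) c ≡ just b → a < b
  strict′ i c a b ea eb with suc i <? m
  ... | no i≮ rewrite atD-≥ [] T (ℕP.≮⇒≥ i≮) = case eb of λ ()
  ... | yes i< = columnsOK⁻ (V.replicate m 0) T (proj₁ (∧⁻ rest)) i c a b i<
        (trans (cong (λ o → cell o (row T i) c) (atD-replicate 0 m i)) ea)
        (trans (cong (λ o → cell o (row T (suc i)) c) (atD-replicate 0 m (suc i))) eb)
  content′ : ∀ i → i < m → occ (suc i) T ≡ at α i
  content′ i i< with fin i<
  ... | j , refl = trans (≡ᵇ⁻ (subst (λ k → (occ (suc (toℕ k)) T ≡ᵇ lookup α k) ≡ true) (VP.lookup-allFin j)
          (allV⁻ {p = λ i → occ (suc (toℕ i)) T ≡ᵇ lookup α i} (V.allFin m) (proj₂ (∧⁻ {columnsOK (V.replicate m 0) T} rest)) j))) (sym (atD-lookup 0 α j))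

sum-letters : ∀ {m} xs → All (λ x → 1 ≤ x × x ≤ m) xs →
  sumTo (λ i → count (λ x → x ≡ᵇ suc i) xs) m ≡ L.length xs
sum-letters {m} [] [] = sumTo-0 m λ _ _ → refl
sum-letters {m} (suc y ∷ xs) ((_ , y<m) ∷ h) =
  trans (sumTo-cong m λ i _ → split i)
    (trans (sumTo-+ indicator (λ i → count (λ x → x ≡ᵇ suc i) xs) m) (cong₂ _+_ (one m y<m) (sum-letters xs h)))
  where
  indicator : ℕ → ℕ
  indicator i = if y ≡ᵇ i then 1 else 0
  split : ∀ i → count (λ x → x ≡ᵇ suc i) (suc y ∷ xs) ≡ indicator i + count (λ x → x ≡ᵇ suc i) xs
  split i with y ≡ᵇ i
  ... | true = refl
  ... | false = refl
  off : ∀ i → i ≢ y → indicator i ≡ 0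
  off i ne rewrite ≢⇒≡ᵇ-false (ne ∘ sym) = refl
  one : ∀ n → y < n → sumTo indicator n ≡ 1
  one (suc n) (s≤s y≤n) with ℕP.m≤n⇒m<n∨m≡n y≤n
  ... | inj₁ y<n = cong₂ _+_ (one n y<n) (off n (ℕP.<⇒≢ y<n ∘ sym))
  ... | inj₂ refl rewrite ≡ᵇ⁺ {y} refl = cong (_+ 1) (sumTo-0 y λ i p → off i (ℕP.<⇒≢ p))

sumTo-swap : ∀ (f : ℕ → ℕ → ℕ) m n → sumTo (λ i → sumTo (f i) n) m ≡ sumTo (λ j → sumTo (λ i → f i j) m) n
sumTo-swap f zero n = sym (sumTo-0 n λ _ _ → refl)
sumTo-swap f (suc m) n = trans (cong (_+ sumTo (f m) n) (sumTo-swap f m n)) (sym (sumTo-+ _ (f m) n))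

-- Double counting of the cells, by letters and by rows.
tableau-size : ∀ {m} {μ α : Vec ℕ m} → Tableau μ α → sumTo (at α) m ≡ sumTo (at μ) m
tableau-size {m} {μ} {α} t = trans (sumTo-cong m λ i p → trans (sym (content i p)) (occ-sumTo (suc i) T))
  (trans (sumTo-swap (λ i r → count (λ x → x ≡ᵇ suc i) (row T r)) m m)
    (sumTo-cong m λ r _ → trans (sum-letters (row T r) (entries r)) (len r)))
  where open Tableau t

kostka-size : ∀ {m} (μ α : Vec ℕ m) → kostka μ α ≢ 0 → size μ ≡ size α
kostka-size μ α ne = trans (size-sumTo μ) (trans (sym (tableau-size (kostka-tableau {μ = μ} {α} ne))) (sym (size-sumTo α)))

-- All nonzero terms of the coefficient of x^α carry the sign (-1)^{|α|-|λ|}, so nothing cancels.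
module _ {m} (h : ℕ) (lam α : Vec ℕ m) where

  private
    term : Vec ℕ m → ℤ
    term μ = (-1ℤ ℤ.^ (size μ ∸ size lam)) ℤ.* (+ (bCoeff h lam μ * kostka μ α))

    weighted : Vec ℕ m → ℕ
    weighted μ = bCoeff h lam μ * kostka μ α

    sign : ℤ
    sign = -1ℤ ℤ.^ (size α ∸ size lam)

    term-sign : ∀ μ → term μ ≡ sign ℤ.* + weighted μ
    term-sign μ with kostka μ α in eq
    ... | zero rewrite ℕP.*-zeroʳ (bCoeff h lam μ) = trans (ℤP.*-zeroʳ (-1ℤ ℤ.^ (size μ ∸ size lam))) (sym (ℤP.*-zeroʳ sign))
    ... | suc k = cong (λ s → (-1ℤ ℤ.^ (s ∸ size lam)) ℤ.* + (bCoeff h lam μ * suc k))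
                    (kostka-size μ α λ e → case trans (sym eq) e of λ ())

    sum-signed : ∀ xs → sumℤ (L.map term xs) ≡ sign ℤ.* + sum (L.map weighted xs)
    sum-signed [] = sym (ℤP.*-zeroʳ sign)
    sum-signed (μ ∷ xs) = trans (cong₂ ℤ._+_ (term-sign μ) (sum-signed xs))
      (sym (ℤP.*-distribˡ-+ sign (+ weighted μ) (+ sum (L.map weighted xs))))

    sign≢0 : ∀ n → -1ℤ ℤ.^ n ≢ + 0
    sign≢0 (suc n) eq with ℤP.i*j≡0⇒i≡0∨j≡0 -1ℤ eq
    ... | inj₂ e = sign≢0 n e

    sum-≢0 : ∀ {f : Vec ℕ m → ℕ} {μ} {xs} → μ ∈ xs → f μ ≢ 0 → sum (L.map f xs) ≢ 0
    sum-≢0 {f} {μ} (here refl) ne e = ne (ℕP.m+n≡0⇒m≡0 (f μ) e)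
    sum-≢0 {f} {xs = y ∷ _} (there μ∈) ne e = sum-≢0 μ∈ ne (ℕP.m+n≡0⇒n≡0 (f y) e)

    term-∃ : ∀ xs → sumℤ (L.map term xs) ≢ + 0 → ∃ λ μ → μ ∈ xs × term μ ≢ + 0
    term-∃ [] ne = ⊥-elim (ne refl)
    term-∃ (μ ∷ xs) ne with term μ ℤP.≟ + 0
    ... | no t≢0 = μ , here refl , t≢0
    ... | yes t≡0 with term-∃ xs (λ e → ne (cong₂ ℤ._+_ t≡0 e))
    ...   | ν , ν∈ , t≢0 = ν , there ν∈ , t≢0

  coeff-nonzero : ∀ {μ} → 1 ≤ h → Admissible h lam μ → kostka μ α ≢ 0 → coeffG h lam α ≢ + 0
  coeff-nonzero {μ} 1≤h A k≢0 eq with ℤP.i*j≡0⇒i≡0∨j≡0 sign (trans (sym (sum-signed (Aset h lam))) eq)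
  ... | inj₁ e = sign≢0 (size α ∸ size lam) e
  ... | inj₂ e = sum-≢0 {f = weighted} (∈-Aset⁺ 1≤h A) w≢0 (ℤP.+-injective e)
    where
    w≢0 : weighted μ ≢ 0
    w≢0 z with ℕP.m*n≡0⇒m≡0∨n≡0 (bCoeff h lam μ) z
    ... | inj₁ b≡0 = b-nonzero 1≤h A b≡0
    ... | inj₂ k≡0 = k≢0 k≡0

  coeff-tableau : coeffG h lam α ≢ + 0 → ∃ λ μ → Admissible h lam μ × Tableau μ α
  coeff-tableau ne with term-∃ (Aset h lam) ne
  ... | μ , μ∈ , t≢0 = μ , ∈-Aset⁻ μ∈ , kostka-tableau λ k≡0 →
        t≢0 (trans (cong (λ k → (-1ℤ ℤ.^ (size μ ∸ size lam)) ℤ.* + (bCoeff h lam μ * k)) k≡0)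
          (trans (cong (λ k → (-1ℤ ℤ.^ (size μ ∸ size lam)) ℤ.* + k) (ℕP.*-zeroʳ (bCoeff h lam μ)))
            (ℤP.*-zeroʳ (-1ℤ ℤ.^ (size μ ∸ size lam)))))

-- Inequalities satisfied by the exponents of G.

InG : ∀ {m} → ℕ → Vec ℕ m → Vec ℕ m → Set
InG h lam α = coeffG h lam α ≢ + 0

antitone : ∀ {f : ℕ → ℕ} → (∀ i → f (suc i) ≤ f i) → ∀ {i j} → i ≤ j → f j ≤ f i
antitone dec {j = zero} z≤n = ℕP.≤-refl
antitone dec {i} {suc j} i≤ with ℕP.m≤n⇒m<n∨m≡n i≤
... | inj₁ (s≤s i≤j) = ℕP.≤-trans (dec j) (antitone dec i≤j)
... | inj₂ refl = ℕP.≤-refl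

count-split : ∀ v xs → count (λ x → x ≡ᵇ v) xs + count (λ x → x <ᵇ v) xs ≡ count (λ x → x ≤ᵇ v) xs
count-split v [] = refl
count-split v (x ∷ xs) with ℕP.<-cmp x v
... | tri< x<v x≢v _ rewrite ≢⇒≡ᵇ-false x≢v | <ᵇ⁺ x<v | ≤ᵇ⁺ (ℕP.<⇒≤ x<v) =
  trans (ℕP.+-suc _ _) (cong suc (count-split v xs))
... | tri≈ x≮x refl _ rewrite ≡ᵇ⁺ {x} refl | ≤ᵇ⁺ (ℕP.≤-refl {x}) with x <ᵇ x in eq
...   | true = ⊥-elim (x≮x (<ᵇ⁻ eq))
...   | false = cong suc (count-split v xs)
count-split v (x ∷ xs) | tri> _ x≢v x>v rewrite ≢⇒≡ᵇ-false x≢v with x <ᵇ v in e₁ | x ≤ᵇ v in e₂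
... | true | _ = ⊥-elim (ℕP.<-asym x>v (<ᵇ⁻ e₁))
... | false | true = ⊥-elim (ℕP.<⇒≱ x>v (≤ᵇ⁻ {x} e₂))
... | false | false = count-split v xs

-- Column strictness sends each letter at most v of the lower row to the letter above it, which is
-- smaller than v.
count-≤-above : ∀ v xs ys → L.length ys ≤ L.length xs →
  (∀ c a b → nth xs c ≡ just a → nth ys c ≡ just b → a < b) →
  count (λ x → x ≤ᵇ v) ys ≤ count (λ x → x <ᵇ v) xs
count-≤-above v xs [] _ _ = z≤n
count-≤-above v (x ∷ xs) (y ∷ ys) (s≤s l) h with y ≤ᵇ v in e₁ | x <ᵇ v in e₂ | count-≤-above v xs ys l (λ c → h (suc c))
... | true | true | ih = s≤s ih
... | true | false | ih = ⊥-elim (case trans (sym e₂) (<ᵇ⁺ (ℕP.<-≤-trans (h 0 x y refl refl) (≤ᵇ⁻ {y} e₁))) of λ ())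
... | false | true | ih = ℕP.m≤n⇒m≤1+n ih
... | false | false | ih = ih

count≤length : ∀ {A : Set} (p : A → Bool) xs → count p xs ≤ L.length xs
count≤length p [] = z≤n
count≤length p (x ∷ xs) with p x
... | true = s≤s (count≤length p xs)
... | false = ℕP.m≤n⇒m≤1+n (count≤length p xs)

-- Column by column from the bottom: a letter v in row 1 or below sits under a letter < v of row 0.
occ≤ : ∀ {m} v (T : Vec (List ℕ) m) → (∀ i → L.length (row T (suc i)) ≤ L.length (row T i)) →
  (∀ i c a b → nth (row T i) c ≡ just a → nth (row T (suc i)) c ≡ just b → a < b) →
  occ v T ≤ count (λ x → x ≤ᵇ v) (row T 0)
occ≤ v [] _ _ = z≤n
occ≤ v (xs ∷ T) l h = subst (count (λ x → x ≡ᵇ v) xs + occ v T ≤_) (count-split v xs)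
  (ℕP.+-monoʳ-≤ (count (λ x → x ≡ᵇ v) xs)
    (ℕP.≤-trans (occ≤ v T (l ∘ suc) (h ∘ suc)) (count-≤-above v xs (row T 0) (l 0) (h 0))))

module _ {m} {μ α : Vec ℕ m} (dec : ∀ i → at μ (suc i) ≤ at μ i) (t : Tableau μ α) where
  open Tableau t

  -- A letter occurs at most once in each column, and `at μ 0` is the number of columns.
  content≤ : ∀ i → at α i ≤ at μ 0
  content≤ i with i <? m
  ... | no i≮ rewrite atD-≥ 0 α (ℕP.≮⇒≥ i≮) = z≤n
  ... | yes i< = subst (_≤ at μ 0) (content i i<) (ℕP.≤-trans
        (occ≤ (suc i) T (λ r → subst₂ _≤_ (sym (len (suc r))) (sym (len r)) (dec r)) strict)
        (subst (count _ (row T 0) ≤_) (len 0) (count≤length _ (row T 0))))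

  row-entry : ∀ s → 1 ≤ at μ s → ∃ λ x → nth (row T s) 0 ≡ just x
  row-entry s p = nth-just (row T s) (subst (0 <_) (sym (len s)) p)

  -- The first column increases strictly, starting from a letter at least 1.
  row<entry : ∀ s x → nth (row T s) 0 ≡ just x → s < x
  row<entry zero x eq = proj₁ (All.lookup (entries 0) (nth-∈ (row T 0) eq))
  row<entry (suc s) x eq =
    let y , eq′ = row-entry s (ℕP.≤-trans (subst (0 <_) (len (suc s)) (nth-< (row T (suc s)) eq)) (dec s))
    in ℕP.≤-<-trans (row<entry s y eq′) (strict s 0 y x eq′ eq)

  -- Row s has only letters > s.
  content-tail : ∀ s → 1 ≤ at μ s → ∃ λ i → s ≤ i × i < m × 1 ≤ at α i
  content-tail s p with row-entry s p
  ... | zero , eq = ⊥-elim (ℕP.n≮0 (row<entry s 0 eq))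
  ... | suc i , eq = i , s≤s⁻¹ (row<entry s (suc i) eq) , i<m , subst (1 ≤_) (content i i<m) found
    where
    i<m : i < m
    i<m = proj₂ (All.lookup (entries s) (nth-∈ (row T s) eq))
    s<m : s < m
    s<m with s <? m
    ... | yes s< = s<
    ... | no s≮ with subst (1 ≤_) (atD-≥ 0 μ (ℕP.≮⇒≥ s≮)) p
    ...   | ()
    found : 1 ≤ occ (suc i) T
    found = ℕP.≤-trans (ℕP.n≢0⇒n>0 (count-∈ {p = λ x → x ≡ᵇ suc i} (nth-∈ (row T s) eq) (≡ᵇ⁺ {suc i} refl)))
      (subst (count (λ x → x ≡ᵇ suc i) (row T s) ≤_) (sym (occ-sumTo (suc i) T))
        (term≤sumTo (λ r → count (λ x → x ≡ᵇ suc i) (row T r)) m s<m))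

-- Each field is the source of a valid inequality on Newt(G): `same-size` together with `admissible`
-- bounds Σ x, `bounded` gives x_i ≤ λ_1, and `tail` bounds sums over the last coordinates from
-- below. The bound λ_1 holds because row 0 of an admissible shape can gain only h * 0 boxes.
record Witness {m} (h : ℕ) (lam α : Vec ℕ m) : Set where
  field
    shape : Vec ℕ m
    admissible : Admissible h lam shape
    same-size : sumTo (at α) m ≡ sumTo (at shape) m
    bounded : ∀ i → at α i ≤ at lam 0
    tail : ∀ s → 1 ≤ at shape s → ∃ λ i → s ≤ i × i < m × 1 ≤ at α i

InG-witness : ∀ {m h} {lam α : Vec ℕ m} → InG h lam α → Witness h lam α
InG-witness {m} {h} {lam} {α} ne with coeff-tableau h lam α ne
... | μ , A , t = record
  { shape = μ ; admissible = A ; same-size = tableau-size t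
  ; bounded = λ i → ℕP.≤-trans (content≤ decreasing t i)
      (subst (at μ 0 ≤_) (trans (cong (λ z → at lam 0 + z) (ℕP.*-zeroʳ h)) (ℕP.+-identityʳ (at lam 0))) (upper 0))
  ; tail = content-tail decreasing t }
  where open Admissible A

InG-dominated : ∀ {m h} {lam α μ : Vec ℕ m} → 1 ≤ h → Admissible h lam μ →
  Dom m (at α) 0 (sumTo (at μ)) → sumTo (at α) m ≡ sumTo (at μ) m → InG h lam α
InG-dominated {m} {h} {lam} {α} {μ} 1≤h A d tot = coeff-nonzero h lam α 1≤h A
  (kostka-nonzero {α = α} {μ} (filling m m ℕP.≤-refl (Admissible.decreasing A) (λ r → atD-≥ 0 μ) d tot))

-- Rearrangements of an exponent.

size-map : ∀ {m} (g : ℕ → ℕ) (v : Vec ℕ m) → size (V.map g v) ≡ sumTo (g ∘ at v) m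
size-map g [] = refl
size-map {suc m} g (x ∷ v) = trans (cong (λ z → g x + z) (size-map g v)) (sym (sumTo-shift (g ∘ at (x ∷ v)) m))

size-map-update : ∀ {m} (g : ℕ → ℕ) (v : Vec ℕ m) i x →
  size (V.map g (v V.[ i ]≔ x)) + g (lookup v i) ≡ size (V.map g v) + g x
size-map-update g (y ∷ v) zero x = swap₃ (g x) (size (V.map g v)) (g y)
  where
  swap₃ : ∀ a b c → a + b + c ≡ c + b + a
  swap₃ = solve-∀
size-map-update g (y ∷ v) (suc i) x = trans (ℕP.+-assoc (g y) _ _)
  (trans (cong (λ z → g y + z) (size-map-update g v i x)) (sym (ℕP.+-assoc (g y) _ _)))

-- α is a rearrangement of v, expressed through the sums Σ g(α_i).
record _∼_ {m} (α v : Vec ℕ m) : Set where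
  constructor same
  field sizes : ∀ g → size (V.map g α) ≡ size (V.map g v)
open _∼_

∼-refl : ∀ {m} {v : Vec ℕ m} → v ∼ v
∼-refl = same λ g → refl

swap : ∀ {m} {A : Set} → Vec A m → Fin m → Fin m → Vec A m
swap v i j = (v V.[ i ]≔ lookup v j) V.[ j ]≔ lookup v i

lookup-swapʳ : ∀ {m} {A : Set} (v : Vec A m) i j → lookup (swap v i j) j ≡ lookup v i
lookup-swapʳ v i j = VP.lookup∘updateAt j (v V.[ i ]≔ lookup v j)

lookup-swapˡ : ∀ {m} {A : Set} (v : Vec A m) i j → lookup (swap v i j) i ≡ lookup v j
lookup-swapˡ v i j with i FP.≟ j
... | yes refl = lookup-swapʳ v i i
... | no i≢j = trans (VP.lookup∘updateAt′ i j i≢j (v V.[ i ]≔ lookup v j)) (VP.lookup∘updateAt i v)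

lookup-swap-≢ : ∀ {m} {A : Set} (v : Vec A m) i j {k} → k ≢ i → k ≢ j → lookup (swap v i j) k ≡ lookup v k
lookup-swap-≢ v i j {k} k≢i k≢j = trans (VP.lookup∘updateAt′ k j k≢j (v V.[ i ]≔ lookup v j)) (VP.lookup∘updateAt′ k i k≢i v)

∼-swap : ∀ {m} {α v : Vec ℕ m} i j → α ∼ v → swap α i j ∼ v
∼-swap {α = α} {v} i j h = same λ g →
  trans (ℕP.+-cancelʳ-≡ (g (lookup α j)) _ _ (ℕP.+-cancelʳ-≡ (g (lookup α i)) _ _ (both g))) (sizes h g)
  where
  β = α V.[ i ]≔ lookup α j
  βj : lookup β j ≡ lookup α j
  βj with j FP.≟ i
  ... | yes refl = VP.lookup∘updateAt i α
  ... | no j≢i = VP.lookup∘updateAt′ j i j≢i α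
  swap₃ : ∀ a b c → a + b + c ≡ a + c + b
  swap₃ = solve-∀
  both : ∀ g → size (V.map g (swap α i j)) + g (lookup α j) + g (lookup α i) ≡ size (V.map g α) + g (lookup α j) + g (lookup α i)
  both g = trans (cong (_+ g (lookup α i)) (trans (cong (λ z → size (V.map g (swap α i j)) + g z) (sym βj)) (size-map-update g β j (lookup α i))))
    (trans (swap₃ (size (V.map g β)) _ _) (cong (_+ g (lookup α i)) (size-map-update g α i (lookup α j))))

incr : ∀ {m} → Vec ℕ m → Fin m → Vec ℕ m
incr v i = v V.[ i ]≔ suc (lookup v i)

∼-incr : ∀ {m} {α v : Vec ℕ m} {i j} → α ∼ v → lookup α i ≡ lookup v j → incr α i ∼ incr v j
∼-incr {α = α} {v} {i} {j} h eq = same λ g → ℕP.+-cancelʳ-≡ (g (lookup α i)) _ _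
  (trans (size-map-update g α i (suc (lookup α i)))
    (trans (cong₂ (λ x y → x + g (suc y)) (sizes h g) eq)
      (trans (sym (size-map-update g v j (suc (lookup v j)))) (cong (λ z → size (V.map g (incr v j)) + g z) (sym eq)))))

rearrange : ∀ {m} (v : Vec ℕ m) {j k x y} → j ≢ k → x ≢ y →
  ∃ λ α → α ∼ v × lookup α j ≡ lookup v x × lookup α k ≡ lookup v y
rearrange v {j} {k} {x} {y} j≢k x≢y = go (pos y)
  where
  α₁ = swap v j x
  -- The swap that brings entry x to j may have displaced entry y. `pos` finds it again and records
  -- that it can sit at j only if y = x, so the second swap leaves j alone.
  pos : ∀ y → ∃ λ y′ → lookup α₁ y′ ≡ lookup v y × (y′ ≡ j → y ≡ x)
  pos y with y FP.≟ j
  ... | yes refl = x , lookup-swapʳ v j x , sym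
  ... | no y≢j with y FP.≟ x
  ...   | yes refl = j , lookup-swapˡ v j x , λ _ → refl
  ...   | no y≢x = y , lookup-swap-≢ v j x y≢j y≢x , λ e → ⊥-elim (y≢j e)
  go : (∃ λ y′ → lookup α₁ y′ ≡ lookup v y × (y′ ≡ j → y ≡ x)) →
    ∃ λ α → α ∼ v × lookup α j ≡ lookup v x × lookup α k ≡ lookup v y
  go (y′ , e , only) = swap α₁ k y′ , ∼-swap k y′ (∼-swap j x ∼-refl)
    , trans (lookup-swap-≢ α₁ k y′ j≢k λ e → x≢y (sym (only (sym e)))) (lookup-swapˡ v j x)
    , trans (lookup-swapˡ α₁ k y′) e

-- For decreasing v the threshold c = v_j is sharp: the first j entries add up to j c + Σ_i (v_i ∸
-- c), and the last sum is one of those that `∼` preserves.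
InG-rearranged : ∀ {m h} {lam α v : Vec ℕ m} → 1 ≤ h → Admissible h lam v → α ∼ v → InG h lam α
InG-rearranged {m} {h} {lam} {α} {v} 1≤h A α∼v = InG-dominated {α = α} {v} 1≤h A (Dom-threshold m threshold) (sums id)
  where
  open Admissible A
  sums : ∀ g → sumTo (g ∘ at α) m ≡ sumTo (g ∘ at v) m
  sums g = trans (sym (size-map g α)) (trans (sizes α∼v g) (size-map g v))
  threshold : ∀ j → j ≤ m → ∃ λ c → j * c + sumTo (λ i → at α i ∸ c) m ≤ sumTo (at v) j
  threshold j j≤m = c , ℕP.≤-reflexive (begin
    j * c + sumTo (λ i → at α i ∸ c) m               ≡⟨ cong₂ _+_ (sym (sumTo-const c j)) (sums (_∸ c)) ⟩
    sumTo (λ _ → c) j + sumTo (λ i → at v i ∸ c) m   ≡⟨ cong (λ z → sumTo (λ _ → c) j + z) (sumTo-stable _ m j≤m λ i j≤i → ℕP.m≤n⇒m∸n≡0 (antitone decreasing j≤i)) ⟩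
    sumTo (λ _ → c) j + sumTo (λ i → at v i ∸ c) j   ≡⟨ sym (sumTo-+ (λ _ → c) (λ i → at v i ∸ c) j) ⟩
    sumTo (λ i → c + (at v i ∸ c)) j                 ≡⟨ sumTo-cong j (λ i i<j → ℕP.m+[n∸m]≡n (antitone decreasing (ℕP.<⇒≤ i<j))) ⟩
    sumTo (at v) j                                   ∎)
    where
    open ≡-Reasoning
    c = at v j

-- Convex hulls and facets.

fromℤ : ℤ → ℚ
fromℤ z = z ℚ./ 1

-- The division by 1 normalises by a gcd and does not compute for a variable z. In constructor form,
-- the order and the operations of ℚ reduce to those of ℤ.
fromℤ-mkℚ : ∀ z → fromℤ z ≡ ℚ.mkℚ z 0 (Coprime.sym (Coprime.1-coprimeTo _))
fromℤ-mkℚ z = ℚP.↥p/↧p≡p (ℚ.mkℚ z 0 (Coprime.sym (Coprime.1-coprimeTo _)))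

fromℤ-+ : ∀ x y → fromℤ (x ℤ.+ y) ≡ fromℤ x ℚ.+ fromℤ y
fromℤ-+ x y rewrite fromℤ-mkℚ x | fromℤ-mkℚ y = cong fromℤ (cong₂ ℤ._+_ (sym (ℤP.*-identityʳ x)) (sym (ℤP.*-identityʳ y)))

fromℤ-* : ∀ x y → fromℤ (x ℤ.* y) ≡ fromℤ x ℚ.* fromℤ y
fromℤ-* x y rewrite fromℤ-mkℚ x | fromℤ-mkℚ y = refl

fromℤ-mono-≤ : ∀ {x y} → x ℤ.≤ y → fromℤ x ℚ.≤ fromℤ y
fromℤ-mono-≤ {x} {y} p rewrite fromℤ-mkℚ x | fromℤ-mkℚ y = ℚ.*≤* (ℤP.*-monoʳ-≤-nonNeg (+ 1) p)

fromℤ-cancel-< : ∀ {x y} → fromℤ x ℚ.< fromℤ y → x ℤ.< y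
fromℤ-cancel-< {x} {y} p rewrite fromℤ-mkℚ x | fromℤ-mkℚ y =
  subst₂ ℤ._<_ (ℤP.*-identityʳ x) (ℤP.*-identityʳ y) (ℚP.drop-*<* p)

fromℤ-mono-< : ∀ {x y} → x ℤ.< y → fromℤ x ℚ.< fromℤ y
fromℤ-mono-< {x} {y} p rewrite fromℤ-mkℚ x | fromℤ-mkℚ y = ℚ.*<* (ℤP.*-monoʳ-<-pos (+ 1) p)

fromℤ-injective : ∀ {x y} → fromℤ x ≡ fromℤ y → x ≡ y
fromℤ-injective {x} {y} p rewrite fromℤ-mkℚ x | fromℤ-mkℚ y = cong ℚ.ℚ.numerator p

fromℕ : ℕ → ℚ
fromℕ n = fromℤ (+ n)

*-cancel-0 : ∀ x {y} → y ≢ 0ℚ → x ℚ.* y ≡ 0ℚ → x ≡ 0ℚ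
*-cancel-0 x {y} y≢0 eq = begin
  x                        ≡⟨ sym (ℚP.*-identityʳ x) ⟩
  x ℚ.* 1ℚ                 ≡⟨ cong (x ℚ.*_) (sym (ℚP.*-inverseʳ y)) ⟩
  x ℚ.* (y ℚ.* ℚ.1/ y)     ≡⟨ sym (ℚP.*-assoc x y (ℚ.1/ y)) ⟩
  x ℚ.* y ℚ.* ℚ.1/ y       ≡⟨ cong (ℚ._* ℚ.1/ y) eq ⟩
  0ℚ ℚ.* ℚ.1/ y            ≡⟨ ℚP.*-zeroˡ (ℚ.1/ y) ⟩
  0ℚ                       ∎
  where
  open ≡-Reasoning
  instance
    y-nonZero : ℚ.NonZero y
    y-nonZero = ℚ.≢-nonZero y≢0

x-y≡0 : ∀ {x y} → x ℚ.+ ℚ.- y ≡ 0ℚ → x ≡ y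
x-y≡0 {x} {y} e = trans (solve 2 (λ x y → x := (x :+ (:- y)) :+ y) refl x y) (trans (cong (ℚ._+ y) e) (ℚP.+-identityˡ y))

+-cancel-≤0 : ∀ x {y} → x ℚ.+ y ℚ.≤ x → y ℚ.≤ 0ℚ
+-cancel-≤0 x {y} p = subst₂ ℚ._≤_ (solve 2 (λ x y → (:- x) :+ (x :+ y) := y) refl x y) (ℚP.+-inverseˡ x) (ℚP.+-monoʳ-≤ (ℚ.- x) p)

vec-ext : ∀ {A : Set} {m} {u v : Vec A m} → (∀ i → lookup u i ≡ lookup v i) → u ≡ v
vec-ext {u = u} {v} h = trans (sym (VP.tabulate∘lookup u)) (trans (VP.tabulate-cong h) (VP.tabulate∘lookup v))

dot-+ : ∀ {m} (ℓ u v : Pt m) → dot ℓ (V.zipWith ℚ._+_ u v) ≡ dot ℓ u ℚ.+ dot ℓ v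
dot-+ [] [] [] = refl
dot-+ (a ∷ ℓ) (b ∷ u) (c ∷ v) rewrite dot-+ ℓ u v =
  solve 5 (λ a b c x y → a :* (b :+ c) :+ (x :+ y) := (a :* b :+ x) :+ (a :* c :+ y)) refl a b c (dot ℓ u) (dot ℓ v)

dot-scaleʳ : ∀ {m} (ℓ v : Pt m) w → dot ℓ (V.map (w ℚ.*_) v) ≡ w ℚ.* dot ℓ v
dot-scaleʳ [] [] w = sym (ℚP.*-zeroʳ w)
dot-scaleʳ (a ∷ ℓ) (b ∷ v) w rewrite dot-scaleʳ ℓ v w =
  solve 4 (λ a b w x → a :* (w :* b) :+ w :* x := w :* (a :* b :+ x)) refl a b w (dot ℓ v)

dot-scaleˡ : ∀ {m} (ℓ v : Pt m) t → dot (V.map (t ℚ.*_) ℓ) v ≡ t ℚ.* dot ℓ v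
dot-scaleˡ [] [] t = sym (ℚP.*-zeroʳ t)
dot-scaleˡ (a ∷ ℓ) (b ∷ v) t rewrite dot-scaleˡ ℓ v t =
  solve 4 (λ a b t x → (t :* a) :* b :+ t :* x := t :* (a :* b :+ x)) refl a b t (dot ℓ v)

dot-zeroʳ : ∀ {m} (ℓ : Pt m) → dot ℓ (V.replicate m 0ℚ) ≡ 0ℚ
dot-zeroʳ [] = refl
dot-zeroʳ (a ∷ ℓ) rewrite dot-zeroʳ ℓ = trans (ℚP.+-identityʳ _) (ℚP.*-zeroʳ a)

dot-zeroˡ : ∀ {m} (v : Pt m) → dot (V.replicate m 0ℚ) v ≡ 0ℚ
dot-zeroˡ [] = refl
dot-zeroˡ (a ∷ v) rewrite dot-zeroˡ v = trans (ℚP.+-identityʳ _) (ℚP.*-zeroˡ a)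

dot-update : ∀ {m} (ℓ v : Pt m) i x →
  dot ℓ (v V.[ i ]≔ x) ≡ dot ℓ v ℚ.+ lookup ℓ i ℚ.* (x ℚ.+ ℚ.- lookup v i)
dot-update (a ∷ ℓ) (b ∷ v) zero x =
  solve 4 (λ a b x y → a :* x :+ y := (a :* b :+ y) :+ a :* (x :+ (:- b))) refl a b x (dot ℓ v)
dot-update (a ∷ ℓ) (b ∷ v) (suc i) x rewrite dot-update ℓ v i x = sym (ℚP.+-assoc (a ℚ.* b) (dot ℓ v) _)

combo-dot : ∀ {m} → Pt m → List (ℚ × Pt m) → ℚ
combo-dot ℓ [] = 0ℚ
combo-dot ℓ ((w , v) ∷ ws) = w ℚ.* dot ℓ v ℚ.+ combo-dot ℓ ws

dot-combo : ∀ {m} (ℓ : Pt m) ws → dot ℓ (combo ws) ≡ combo-dot ℓ ws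
dot-combo ℓ [] = dot-zeroʳ ℓ
dot-combo ℓ ((w , v) ∷ ws) = trans (dot-+ ℓ (V.map (w ℚ.*_) v) (combo ws))
  (cong₂ ℚ._+_ (dot-scaleʳ ℓ v w) (dot-combo ℓ ws))

module _ {m} {S : Pt m → Set} where

  hull-single : ∀ {s} → S s → ConvHull S s
  hull-single {s} Ss = (1ℚ , s) ∷ [] , (ℚP.nonNegative⁻¹ 1ℚ , Ss) ∷ [] , refl , vec-ext λ i →
    trans (VP.lookup-zipWith ℚ._+_ i (V.map (1ℚ ℚ.*_) s) (V.replicate m 0ℚ))
      (trans (cong₂ ℚ._+_ (trans (VP.lookup-map i (1ℚ ℚ.*_) s) (ℚP.*-identityˡ (lookup s i))) (VP.lookup-replicate i 0ℚ))
        (ℚP.+-identityʳ (lookup s i)))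

  private
    Weights : List (ℚ × Pt m) → Set
    Weights = All (λ wv → (0ℚ ℚ.≤ proj₁ wv) × S (proj₂ wv))

  combo-≤ : ∀ (ℓ : Pt m) c → (∀ s → S s → dot ℓ s ℚ.≤ c) → ∀ ws → Weights ws → combo-dot ℓ ws ℚ.≤ weight ws ℚ.* c
  combo-≤ ℓ c h [] [] = ℚP.≤-reflexive (sym (ℚP.*-zeroˡ c))
  combo-≤ ℓ c h ((w , s) ∷ ws) ((0≤w , Ss) ∷ hs) =
    subst (w ℚ.* dot ℓ s ℚ.+ combo-dot ℓ ws ℚ.≤_) (sym (ℚP.*-distribʳ-+ c w (weight ws)))
      (ℚP.+-mono-≤ (ℚP.*-monoˡ-≤-nonNeg w {{ℚ.nonNegative 0≤w}} (h s Ss)) (combo-≤ ℓ c h ws hs))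

  hull-≤ : ∀ {ℓ : Pt m} {c} → (∀ s → S s → dot ℓ s ℚ.≤ c) → Valid (ConvHull S) ℓ c
  hull-≤ {ℓ} {c} h q (ws , hs , wt , refl) = subst₂ ℚ._≤_ (sym (dot-combo ℓ ws))
    (trans (cong (ℚ._* c) wt) (ℚP.*-identityˡ c)) (combo-≤ ℓ c h ws hs)

  -- In a convex combination attaining the bound c, the points of positive weight attain it.
  combo-tight : ∀ (ℓ n : Pt m) c d → (∀ s → S s → dot ℓ s ℚ.≤ c) → (∀ s → S s → dot ℓ s ≡ c → dot n s ≡ d) →
    ∀ ws → Weights ws → combo-dot ℓ ws ≡ weight ws ℚ.* c → combo-dot n ws ≡ weight ws ℚ.* d
  combo-tight ℓ n c d h tight [] [] eq = sym (ℚP.*-zeroˡ d)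
  combo-tight ℓ n c d h tight ((w , s) ∷ ws) ((0≤w , Ss) ∷ hs) eq =
    trans (cong₂ ℚ._+_ here-eq (combo-tight ℓ n c d h tight ws hs rest-eq)) (sym (ℚP.*-distribʳ-+ d w (weight ws)))
    where
    ws≤ : w ℚ.* dot ℓ s ℚ.≤ w ℚ.* c
    ws≤ = ℚP.*-monoˡ-≤-nonNeg w {{ℚ.nonNegative 0≤w}} (h s Ss)
    eq′ : w ℚ.* dot ℓ s ℚ.+ combo-dot ℓ ws ≡ w ℚ.* c ℚ.+ weight ws ℚ.* c
    eq′ = trans eq (ℚP.*-distribʳ-+ c w (weight ws))
    rest-eq : combo-dot ℓ ws ≡ weight ws ℚ.* c
    rest-eq with ℚP.<-cmp (combo-dot ℓ ws) (weight ws ℚ.* c)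
    ... | tri< lt _ _ = ⊥-elim (ℚP.<-irrefl eq′ (ℚP.+-mono-≤-< ws≤ lt))
    ... | tri≈ _ e _ = e
    ... | tri> _ _ gt = ⊥-elim (ℚP.<-irrefl refl (ℚP.<-≤-trans gt (combo-≤ ℓ c h ws hs)))
    wd : w ℚ.* dot ℓ s ≡ w ℚ.* c
    wd = ℚ+-cancelʳ (weight ws ℚ.* c) _ _ (trans (cong (w ℚ.* dot ℓ s ℚ.+_) (sym rest-eq)) eq′)
    here-eq : w ℚ.* dot n s ≡ w ℚ.* d
    here-eq with dot ℓ s ℚP.≟ c
    ... | yes e = cong (w ℚ.*_) (tight s Ss e)
    ... | no ne = trans (cong (ℚ._* dot n s) w≡0) (trans (ℚP.*-zeroˡ (dot n s)) (sym (trans (cong (ℚ._* d) w≡0) (ℚP.*-zeroˡ d))))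
      where
      w≡0 : w ≡ 0ℚ
      w≡0 = *-cancel-0 w {dot ℓ s ℚ.+ ℚ.- c} (λ z → ne (x-y≡0 z))
        (trans (solve 3 (λ w x c → w :* (x :+ (:- c)) := w :* x :+ (:- (w :* c))) refl w (dot ℓ s) c)
          (trans (cong (ℚ._+ ℚ.- (w ℚ.* c)) wd) (ℚP.+-inverseʳ (w ℚ.* c))))

  hull-tight : ∀ {ℓ n : Pt m} {c d} → (∀ s → S s → dot ℓ s ℚ.≤ c) → (∀ s → S s → dot ℓ s ≡ c → dot n s ≡ d) →
    ∀ q → ConvHull S q → dot ℓ q ≡ c → dot n q ≡ d
  hull-tight {ℓ} {n} {c} {d} h tight q (ws , hs , wt , refl) eq = trans (dot-combo n ws)
    (trans (combo-tight ℓ n c d h tight ws hs (trans (sym (dot-combo ℓ ws)) (trans eq (sym (trans (cong (ℚ._* c) wt) (ℚP.*-identityˡ c))))))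
      (trans (cong (ℚ._* d) wt) (ℚP.*-identityˡ d)))

-- Values of functionals at lattice points.

ofℕ-ofℤ : ∀ {m} (α : Vec ℕ m) → ofℕ α ≡ ofℤ (V.map +_ α)
ofℕ-ofℤ α = VP.map-∘ fromℤ +_ α

val : ∀ {m} → Pt m → Vec ℕ m → ℚ
val ℓ α = dot ℓ (ofℕ α)

lookup-ofℕ : ∀ {m} (α : Vec ℕ m) i → lookup (ofℕ α) i ≡ fromℕ (lookup α i)
lookup-ofℕ α i = VP.lookup-map i fromℕ α

val-update : ∀ {m} (ℓ : Pt m) α i x →
  val ℓ (α V.[ i ]≔ x) ≡ val ℓ α ℚ.+ lookup ℓ i ℚ.* (fromℕ x ℚ.+ ℚ.- fromℕ (lookup α i))
val-update ℓ α i x = trans (cong (dot ℓ) (VP.map-[]≔ fromℕ α i))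
  (trans (dot-update ℓ (ofℕ α) i (fromℕ x)) (cong (λ y → val ℓ α ℚ.+ lookup ℓ i ℚ.* (fromℕ x ℚ.+ ℚ.- y)) (lookup-ofℕ α i)))

fromℕ-suc : ∀ n → fromℕ (suc n) ≡ 1ℚ ℚ.+ fromℕ n
fromℕ-suc n = fromℤ-+ (+ 1) (+ n)

val-up : ∀ {m} (ℓ : Pt m) α i {x} → x ≡ suc (lookup α i) → val ℓ (α V.[ i ]≔ x) ≡ val ℓ α ℚ.+ lookup ℓ i
val-up ℓ α i refl = trans (val-update ℓ α i (suc (lookup α i)))
  (cong (val ℓ α ℚ.+_) (trans (cong (λ y → lookup ℓ i ℚ.* (y ℚ.+ ℚ.- fromℕ (lookup α i))) (fromℕ-suc (lookup α i)))
    (solve 2 (λ l x → l :* ((con 1ℚ :+ x) :+ (:- x)) := l) refl (lookup ℓ i) (fromℕ (lookup α i)))))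

val-down : ∀ {m} (ℓ : Pt m) α i {x} → suc x ≡ lookup α i → val ℓ (α V.[ i ]≔ x) ≡ val ℓ α ℚ.+ ℚ.- lookup ℓ i
val-down ℓ α i {x} eq = trans (val-update ℓ α i x)
  (cong (val ℓ α ℚ.+_) (trans (cong (λ y → lookup ℓ i ℚ.* (fromℕ x ℚ.+ ℚ.- y)) (trans (cong fromℕ (sym eq)) (fromℕ-suc x)))
    (solve 2 (λ l x → l :* (x :+ (:- (con 1ℚ :+ x))) := :- l) refl (lookup ℓ i) (fromℕ x))))

val-swap : ∀ {m} (ℓ : Pt m) α {i j} → i ≢ j → val ℓ (swap α i j) ≡
  val ℓ α ℚ.+ (lookup ℓ j ℚ.+ ℚ.- lookup ℓ i) ℚ.* (fromℕ (lookup α i) ℚ.+ ℚ.- fromℕ (lookup α j))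
val-swap ℓ α {i} {j} i≢j = trans (val-update ℓ β j (lookup α i))
  (trans (cong₂ (λ x y → x ℚ.+ lookup ℓ j ℚ.* (fromℕ (lookup α i) ℚ.+ ℚ.- fromℕ y)) (val-update ℓ α i (lookup α j))
      (VP.lookup∘updateAt′ j i (i≢j ∘ sym) α))
    (solve 5 (λ v x y a b → (v :+ x :* (b :+ (:- a))) :+ y :* (a :+ (:- b)) := v :+ (y :+ (:- x)) :* (a :+ (:- b))) refl
      (val ℓ α) (lookup ℓ i) (lookup ℓ j) (fromℕ (lookup α i)) (fromℕ (lookup α j))))
  where β = α V.[ i ]≔ lookup α j

normal : ∀ {m} → ℤ → (Fin m → Bool) → Pt m
normal σ b = V.tabulate λ i → if b i then fromℤ σ else 0ℚ

isum : ∀ {m} → (Fin m → Bool) → Vec ℤ m → ℤ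
isum b [] = + 0
isum b (z ∷ v) = (if b zero then z else + 0) ℤ.+ isum (b ∘ suc) v

nsum : ∀ {m} → (Fin m → Bool) → Vec ℕ m → ℕ
nsum b [] = 0
nsum b (z ∷ v) = (if b zero then z else 0) + nsum (b ∘ suc) v

isum-ℕ : ∀ {m} b (α : Vec ℕ m) → isum b (V.map +_ α) ≡ + nsum b α
isum-ℕ b [] = refl
isum-ℕ b (x ∷ α) with b zero
... | true = cong (λ z → + x ℤ.+ z) (isum-ℕ (b ∘ suc) α)
... | false = cong (λ z → + 0 ℤ.+ z) (isum-ℕ (b ∘ suc) α)

lookup-normal : ∀ {m} σ (b : Fin m → Bool) i → lookup (normal σ b) i ≡ (if b i then fromℤ σ else 0ℚ)
lookup-normal σ b i = VP.lookup∘tabulate _ i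

normal-true : ∀ {m} σ (b : Fin m → Bool) i → b i ≡ true → lookup (normal σ b) i ≡ fromℤ σ
normal-true σ b i e = trans (lookup-normal σ b i) (cong (λ t → if t then fromℤ σ else 0ℚ) e)

normal-false : ∀ {m} σ (b : Fin m → Bool) i → b i ≡ false → lookup (normal σ b) i ≡ 0ℚ
normal-false σ b i e = trans (lookup-normal σ b i) (cong (λ t → if t then fromℤ σ else 0ℚ) e)

dot-normal : ∀ {m} σ (b : Fin m → Bool) z → dot (normal σ b) (ofℤ z) ≡ fromℤ (σ ℤ.* isum b z)
dot-normal σ b [] = cong fromℤ (sym (ℤP.*-zeroʳ σ))
dot-normal σ b (z ∷ v) = trans (cong₂ ℚ._+_ (head (b zero)) (dot-normal σ (b ∘ suc) v))
  (trans (sym (fromℤ-+ (σ ℤ.* (if b zero then z else + 0)) (σ ℤ.* isum (b ∘ suc) v)))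
    (cong fromℤ (sym (ℤP.*-distribˡ-+ σ (if b zero then z else + 0) (isum (b ∘ suc) v)))))
  where
  head : ∀ t → (if t then fromℤ σ else 0ℚ) ℚ.* fromℤ z ≡ fromℤ (σ ℤ.* (if t then z else + 0))
  head true = sym (fromℤ-* σ z)
  head false = trans (ℚP.*-zeroˡ (fromℤ z)) (cong fromℤ (sym (ℤP.*-zeroʳ σ)))

val-normal : ∀ {m} σ (b : Fin m → Bool) α → val (normal σ b) α ≡ fromℤ (σ ℤ.* + nsum b α)
val-normal σ b α = trans (cong (dot (normal σ b)) (ofℕ-ofℤ α))
  (trans (dot-normal σ b (V.map +_ α)) (cong (λ z → fromℤ (σ ℤ.* z)) (isum-ℕ b α)))

-- The lattice points of the face {normal σ b = c} determine its supporting functional up to scaling.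
record Spans {m} (A : Vec ℕ m → Set) (σ : ℤ) (b : Fin m → Bool) (c : ℚ) : Set where
  field
    unit : σ ℤ.* σ ≡ + 1
    pivot : Fin m
    pivot∈ : b pivot ≡ true
    on : ∃ λ α → A α × val (normal σ b) α ≡ c
    free : ∀ j → b j ≡ false → ∃ λ α → A α × A (incr α j) × val (normal σ b) α ≡ c
    tied : ∀ j → b j ≡ true → j ≢ pivot →
      ∃ λ α → A α × A (swap α j pivot) × val (normal σ b) α ≡ c × lookup α j ≢ lookup α pivot

Points : ∀ {m} → (Vec ℕ m → Set) → Pt m → Set
Points A q = ∃ λ α → A α × ofℕ α ≡ q

Hull : ∀ {m} → (Vec ℕ m → Set) → Pt m → Set
Hull A = ConvHull (Points A)

bool-cases : ∀ (x : Bool) → x ≡ true ⊎ x ≡ false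
bool-cases true = inj₁ refl
bool-cases false = inj₂ refl

module _ {m} {A : Vec ℕ m → Set} where

  point : ∀ {α} → A α → Hull A (ofℕ α)
  point {α} a = hull-single (α , a , refl)

  valid : ∀ {ℓ c} → (∀ α → A α → val ℓ α ℚ.≤ c) → Valid (Hull A) ℓ c
  valid {ℓ} h = hull-≤ {ℓ = ℓ} λ { s (α , a , refl) → h α a }

  tight : ∀ {ℓ n c d} → (∀ α → A α → val ℓ α ℚ.≤ c) → (∀ α → A α → val ℓ α ≡ c → val n α ≡ d) →
    ∀ q → Hull A q → dot ℓ q ≡ c → dot n q ≡ d
  tight {ℓ} {n} h t = hull-tight {ℓ = ℓ} {n} (λ { s (α , a , refl) → h α a }) (λ { s (α , a , refl) → t α a })

  -- If j is outside the indicator, adding e_j stays on the face, so ℓ_j = 0. If j is inside,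
  -- swapping two unequal entries at j and at the pivot stays on the face, so ℓ_j = ℓ_pivot. The
  -- factor is σ ℓ_pivot because σ² = 1.
  spans-unique : ∀ {σ b c} → Spans A σ b c → ∀ {ℓ c′} →
    (∀ α → A α → val (normal σ b) α ≡ c → val ℓ α ≡ c′) →
    ∃ λ t → (∀ q → dot ℓ q ≡ t ℚ.* dot (normal σ b) q) × c′ ≡ t ℚ.* c
  spans-unique {σ} {b} {c} sp {ℓ} {c′} h = t , scaled , c-scaled
    where
    open Spans sp
    N = normal σ b
    t = fromℤ σ ℚ.* lookup ℓ pivot
    free-coord : ∀ {j} → b j ≡ false → (∃ λ α → A α × A (incr α j) × val N α ≡ c) → lookup ℓ j ≡ 0ℚ
    free-coord {j} bj (α , a , a′ , e) = ℚ+-cancelʳ (val ℓ α) _ _ (trans (ℚP.+-comm (lookup ℓ j) (val ℓ α))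
        (trans (sym (val-up ℓ α j refl)) (trans (h (incr α j) a′ e′) (trans (sym (h α a e)) (sym (ℚP.+-identityˡ (val ℓ α)))))))
      where
      e′ : val N (incr α j) ≡ c
      e′ = trans (val-up N α j refl) (trans (cong₂ ℚ._+_ e (normal-false σ b j bj)) (ℚP.+-identityʳ c))
    tied-coord : ∀ {j} → b j ≡ true → j ≢ pivot →
      (∃ λ α → A α × A (swap α j pivot) × val N α ≡ c × lookup α j ≢ lookup α pivot) → lookup ℓ j ≡ lookup ℓ pivot
    tied-coord {j} bj j≢ (α , a , a′ , e , ne) =
        sym (x-y≡0 (*-cancel-0 (lookup ℓ pivot ℚ.+ ℚ.- lookup ℓ j) {y} (λ z → ne (ℤP.+-injective (fromℤ-injective (x-y≡0 z))))
          (ℚ+-cancelʳ (val ℓ α) _ _ (trans (ℚP.+-comm _ (val ℓ α)) (trans (sym (val-swap ℓ α j≢))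
            (trans (h (swap α j pivot) a′ e′) (trans (sym (h α a e)) (sym (ℚP.+-identityˡ (val ℓ α))))))))))
      where
      y = fromℕ (lookup α j) ℚ.+ ℚ.- fromℕ (lookup α pivot)
      e′ : val N (swap α j pivot) ≡ c
      e′ = trans (val-swap N α j≢) (trans (cong₂ (λ u v → u ℚ.+ v ℚ.* y) e
             (trans (cong₂ (λ u v → u ℚ.+ ℚ.- v) (normal-true σ b pivot pivot∈) (normal-true σ b j bj)) (ℚP.+-inverseʳ (fromℤ σ))))
             (trans (cong (c ℚ.+_) (ℚP.*-zeroˡ y)) (ℚP.+-identityʳ c)))
    pivot-coord : ∀ {j} → b j ≡ true → Dec (j ≡ pivot) → lookup ℓ j ≡ lookup ℓ pivot
    pivot-coord bj (yes refl) = refl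
    pivot-coord {j} bj (no j≢) = tied-coord bj j≢ (tied j bj j≢)
    coord : ∀ j → b j ≡ true ⊎ b j ≡ false → lookup ℓ j ≡ t ℚ.* lookup N j
    coord j (inj₂ bj) = trans (free-coord bj (free j bj)) (sym (trans (cong (t ℚ.*_) (normal-false σ b j bj)) (ℚP.*-zeroʳ t)))
    coord j (inj₁ bj) = trans (pivot-coord bj (j FP.≟ pivot)) (sym (trans (cong (t ℚ.*_) (normal-true σ b j bj))
      (trans (solve 2 (λ s l → (s :* l) :* s := (s :* s) :* l) refl (fromℤ σ) (lookup ℓ pivot))
        (trans (cong (ℚ._* lookup ℓ pivot) (trans (sym (fromℤ-* σ σ)) (cong fromℤ unit))) (ℚP.*-identityˡ (lookup ℓ pivot))))))
    ℓ≡ : ℓ ≡ V.map (t ℚ.*_) N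
    ℓ≡ = vec-ext λ j → trans (coord j (bool-cases (b j))) (sym (VP.lookup-map j (t ℚ.*_) N))
    scaled : ∀ q → dot ℓ q ≡ t ℚ.* dot N q
    scaled q = trans (cong (λ z → dot z q) ℓ≡) (dot-scaleˡ N q t)
    c-scaled : c′ ≡ t ℚ.* c
    c-scaled = let α , a , e = on in trans (sym (h α a e)) (trans (scaled (ofℕ α)) (cong (t ℚ.*_) e))

  -- A proper face that contains this one has a functional t N by `spans-unique`. For t = 0 it would
  -- be constant, against properness; hence both faces are cut out by the same hyperplane.
  spans-facet : ∀ {σ b c} → Spans A σ b c → (∀ α → A α → val (normal σ b) α ℚ.≤ c) →
    (∃ λ α → A α × val (normal σ b) α ℚ.< c) → Facet (Hull A) (normal σ b) c
  spans-facet {σ} {b} {c} sp v (α₁ , a₁ , lt) = (valid {normal σ b} v , ofℕ α₁ , point a₁ , lt) , maximal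
    where
    N = normal σ b
    maximal : ∀ ℓ c′ → ProperFace (Hull A) ℓ c′ → (∀ q → Face (Hull A) N c q → Face (Hull A) ℓ c′ q) →
      ∀ q → Face (Hull A) ℓ c′ q → Face (Hull A) N c q
    maximal ℓ c′ (v′ , q₀ , q₀∈ , lt₀) sub q (q∈ , e) = q∈ , x-y≡0 (*-cancel-0 (dot N q ℚ.+ ℚ.- c) {t} t≢0 diff)
      where
      scaling : ∃ λ t → (∀ q → dot ℓ q ≡ t ℚ.* dot N q) × c′ ≡ t ℚ.* c
      scaling = spans-unique sp {ℓ} {c′} (λ α a eα → proj₂ (sub (ofℕ α) (point a , eα)))
      t = proj₁ scaling
      scaled = proj₁ (proj₂ scaling)
      c-scaled = proj₂ (proj₂ scaling)
      t≢0 : t ≢ 0ℚ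
      t≢0 t≡0 = ℚP.<-irrefl (trans (scaled q₀) (trans (cong (ℚ._* dot N q₀) t≡0) (trans (ℚP.*-zeroˡ (dot N q₀))
        (sym (trans c-scaled (trans (cong (ℚ._* c) t≡0) (ℚP.*-zeroˡ c))))))) lt₀
      diff : (dot N q ℚ.+ ℚ.- c) ℚ.* t ≡ 0ℚ
      diff = trans (solve 3 (λ x c t → (x :+ (:- c)) :* t := (t :* x) :+ (:- (t :* c))) refl (dot N q) c t)
        (trans (cong₂ (λ x y → x ℚ.+ ℚ.- y) (trans (sym (scaled q)) e) (sym c-scaled)) (ℚP.+-inverseʳ c′))

-- Lattice distance one and a criterion for reflexivity.

data Dir : ℤ → Set where
  plus : Dir (+ 1)
  minus : Dir -1ℤ

-- The relations σ x ≤ σ y and σ x < σ y read in ℕ: for `minus` the right-hand side is a lower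
-- bound.
_≤[_]_ _<[_]_ : ∀ {σ} → ℕ → Dir σ → ℕ → Set
x ≤[ plus ] y = x ≤ y
x ≤[ minus ] y = y ≤ x
x <[ plus ] y = x < y
x <[ minus ] y = y < x

dir-unit : ∀ {σ} → Dir σ → σ ℤ.* σ ≡ + 1
dir-unit plus = refl
dir-unit minus = refl

dir-≤ : ∀ {σ x y} (d : Dir σ) → x ≤[ d ] y → σ ℤ.* + x ℤ.≤ σ ℤ.* + y
dir-≤ {x = x} {y} plus p rewrite ℤP.*-identityˡ (+ x) | ℤP.*-identityˡ (+ y) = ℤ.+≤+ p
dir-≤ {x = x} {y} minus p rewrite ℤP.-1*i≡-i (+ x) | ℤP.-1*i≡-i (+ y) = ℤP.neg-mono-≤ (ℤ.+≤+ p)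

dir-< : ∀ {σ x y} (d : Dir σ) → x <[ d ] y → σ ℤ.* + x ℤ.< σ ℤ.* + y
dir-< {x = x} {y} plus p rewrite ℤP.*-identityˡ (+ x) | ℤP.*-identityˡ (+ y) = ℤ.+<+ p
dir-< {x = x} {y} minus p rewrite ℤP.-1*i≡-i (+ x) | ℤP.-1*i≡-i (+ y) = ℤP.neg-mono-< (ℤ.+<+ p)

-- The equation σ x + 1 = σ y read in ℕ: the value y on a facet is one step outward from the value x
-- at the interior point.
Next : ∀ {σ} → Dir σ → ℕ → ℕ → Set
Next plus x y = suc x ≡ y
Next minus x y = x ≡ suc y

dir-next : ∀ {σ x y} (d : Dir σ) → σ ℤ.* + x ℤ.+ + 1 ≡ σ ℤ.* + y → Next d x y
dir-next {x = x} {y} plus e rewrite ℤP.*-identityˡ (+ x) | ℤP.*-identityˡ (+ y) = trans (ℕP.+-comm 1 x) (ℤP.+-injective e)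
dir-next {x = x} {y} minus e rewrite ℤP.-1*i≡-i (+ x) | ℤP.-1*i≡-i (+ y) =
  ℤP.+-injective (begin
    + x                              ≡⟨ move (+ x) (+ 1) ⟩
    + 1 ℤ.+ ℤ.- (ℤ.- + x ℤ.+ + 1)    ≡⟨ cong (λ z → + 1 ℤ.+ ℤ.- z) e ⟩
    + 1 ℤ.+ ℤ.- (ℤ.- + y)            ≡⟨ cong (λ z → + 1 ℤ.+ z) (ℤP.neg-involutive (+ y)) ⟩
    + suc y                          ∎)
  where
  open ≡-Reasoning
  move : ∀ x y → x ≡ y ℤ.+ ℤ.- (ℤ.- x ℤ.+ y)
  move = ℤsolve-∀

next-dir : ∀ {σ x y} (d : Dir σ) → Next d x y → σ ℤ.* + x ℤ.+ + 1 ≡ σ ℤ.* + y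
next-dir {x = x} plus refl rewrite ℤP.*-identityˡ (+ x) | ℤP.*-identityˡ (+ suc x) = cong +_ (ℕP.+-comm x 1)
next-dir {y = y} minus refl =
  trans (cong (ℤ._+ + 1) (ℤP.-1*i≡-i (+ suc y))) (trans (cancel (+ 1) (+ y)) (sym (ℤP.-1*i≡-i (+ y))))
  where
  cancel : ∀ a y → ℤ.- (a ℤ.+ y) ℤ.+ a ≡ ℤ.- y
  cancel = ℤsolve-∀

lookup-ofℤ : ∀ {m} (z : Vec ℤ m) i → lookup (ofℤ z) i ≡ fromℤ (lookup z i)
lookup-ofℤ z i = VP.lookup-map i fromℤ z

shift : ∀ {m} → Vec ℤ m → Fin m → ℤ → Vec ℤ m
shift p i s = p V.[ i ]≔ (lookup p i ℤ.+ s)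

dot-shift : ∀ {m} σ (b : Fin m → Bool) p i → b i ≡ true → σ ℤ.* σ ≡ + 1 →
  dot (normal σ b) (ofℤ (shift p i σ)) ≡ fromℤ (σ ℤ.* isum b p ℤ.+ + 1)
dot-shift σ b p i bi unit = begin
  dot N (ofℤ (shift p i σ))
    ≡⟨ cong (dot N) (VP.map-[]≔ fromℤ p i) ⟩
  dot N (ofℤ p V.[ i ]≔ fromℤ (pᵢ ℤ.+ σ))
    ≡⟨ dot-update N (ofℤ p) i (fromℤ (pᵢ ℤ.+ σ)) ⟩
  dot N (ofℤ p) ℚ.+ lookup N i ℚ.* (fromℤ (pᵢ ℤ.+ σ) ℚ.+ ℚ.- lookup (ofℤ p) i)
    ≡⟨ cong₂ ℚ._+_ (dot-normal σ b p) (cong₂ ℚ._*_ (normal-true σ b i bi) (cong₂ (λ x y → x ℚ.+ ℚ.- y) (fromℤ-+ pᵢ σ) (lookup-ofℤ p i))) ⟩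
  fromℤ (σ ℤ.* isum b p) ℚ.+ fromℤ σ ℚ.* ((fromℤ pᵢ ℚ.+ fromℤ σ) ℚ.+ ℚ.- fromℤ pᵢ)
    ≡⟨ cong (fromℤ (σ ℤ.* isum b p) ℚ.+_) (solve 2 (λ s x → s :* ((x :+ s) :+ (:- x)) := s :* s) refl (fromℤ σ) (fromℤ pᵢ)) ⟩
  fromℤ (σ ℤ.* isum b p) ℚ.+ fromℤ σ ℚ.* fromℤ σ
    ≡⟨ cong (fromℤ (σ ℤ.* isum b p) ℚ.+_) (trans (sym (fromℤ-* σ σ)) (cong fromℤ unit)) ⟩
  fromℤ (σ ℤ.* isum b p) ℚ.+ fromℤ (+ 1)
    ≡⟨ sym (fromℤ-+ (σ ℤ.* isum b p) (+ 1)) ⟩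
  fromℤ (σ ℤ.* isum b p ℤ.+ + 1) ∎
  where
  open ≡-Reasoning
  N = normal σ b
  pᵢ = lookup p i

i<i+1 : ∀ i → i ℤ.< i ℤ.+ + 1
i<i+1 i = ℤP.suc[i]≤j⇒i<j (ℤP.≤-reflexive (ℤP.+-comm (+ 1) i))

ℤ-sandwich : ∀ {x y} → x ℤ.< y → y ℤ.< x ℤ.+ + 1 → ⊥
ℤ-sandwich {x} {y} p q = ℤP.<⇒≱ q (subst (ℤ._≤ y) (ℤP.+-comm (+ 1) x) (ℤP.i<j⇒suc[i]≤j p))

-- p + σ e_i = p + σ (α + e_i) - σ α.
shift-terms : ∀ {m} → Vec ℤ m → Vec ℕ m → Fin m → ℤ → List (ℚ × Pt m)
shift-terms p α i σ = (1ℚ , ofℤ p) ∷ (fromℤ σ , ofℕ (incr α i)) ∷ (ℚ.- fromℤ σ , ofℕ α) ∷ []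

lookup-combo₃ : ∀ {m} a b c (u v w : Pt m) k → lookup (combo ((a , u) ∷ (b , v) ∷ (c , w) ∷ [])) k ≡
  a ℚ.* lookup u k ℚ.+ (b ℚ.* lookup v k ℚ.+ (c ℚ.* lookup w k ℚ.+ 0ℚ))
lookup-combo₃ a b c (x ∷ u) (y ∷ v) (z ∷ w) zero = refl
lookup-combo₃ a b c (x ∷ u) (y ∷ v) (z ∷ w) (suc k) = lookup-combo₃ a b c u v w k

shift-coordinate : ∀ {m} p (α : Vec ℕ m) i σ k → lookup (combo (shift-terms p α i σ)) k ≡ lookup (ofℤ (shift p i σ)) k
shift-coordinate p α i σ k = trans (lookup-combo₃ 1ℚ s (ℚ.- s) (ofℤ p) (ofℕ (incr α i)) (ofℕ α) k)
    (trans (combined-cong (lookup-ofℤ p k) (lookup-ofℕ (incr α i) k) (lookup-ofℕ α k))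
      (trans (coordinate (k FP.≟ i)) (sym (lookup-ofℤ (shift p i σ) k))))
  where
  s = fromℤ σ
  combined : ℚ → ℚ → ℚ → ℚ
  combined x y z = 1ℚ ℚ.* x ℚ.+ (s ℚ.* y ℚ.+ (ℚ.- s ℚ.* z ℚ.+ 0ℚ))
  combined-cong : ∀ {x x′ y y′ z z′} → x ≡ x′ → y ≡ y′ → z ≡ z′ → combined x y z ≡ combined x′ y′ z′
  combined-cong refl refl refl = refl
  coordinate : Dec (k ≡ i) → combined (fromℤ (lookup p k)) (fromℕ (lookup (incr α i) k)) (fromℕ (lookup α k)) ≡ fromℤ (lookup (shift p i σ) k)
  coordinate (yes refl) = trans (combined-cong {fromℤ (lookup p k)} refl (trans (cong fromℕ (VP.lookup∘updateAt k α)) (fromℕ-suc (lookup α k))) refl)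
    (trans (solve 3 (λ s x a → con 1ℚ :* x :+ (s :* (con 1ℚ :+ a) :+ ((:- s) :* a :+ con 0ℚ)) := x :+ s) refl s (fromℤ (lookup p k)) (fromℕ (lookup α k)))
      (trans (sym (fromℤ-+ (lookup p k) σ)) (cong fromℤ (sym (VP.lookup∘updateAt k p)))))
  coordinate (no k≢i) = trans (combined-cong {fromℤ (lookup p k)} refl (cong fromℕ (VP.lookup∘updateAt′ k i k≢i α)) refl)
    (trans (solve 3 (λ s x a → con 1ℚ :* x :+ (s :* a :+ ((:- s) :* a :+ con 0ℚ)) := x) refl s (fromℤ (lookup p k)) (fromℕ (lookup α k)))
      (cong fromℤ (sym (VP.lookup∘updateAt′ k i k≢i p))))

module _ {m} {A : Vec ℕ m → Set} where

  shift-affine : ∀ {p α i} σ → Hull A (ofℤ p) → A α → A (incr α i) → AffHull (Hull A) (ofℤ (shift p i σ))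
  shift-affine {p} {α} {i} σ p∈ a a′ = shift-terms p α i σ , p∈ ∷ point a′ ∷ point a ∷ []
    , solve 1 (λ s → con 1ℚ :+ (s :+ ((:- s) :+ con 0ℚ)) := con 1ℚ) refl (fromℤ σ)
    , vec-ext (shift-coordinate p α i σ)

  -- A hyperplane more than one step away would leave p + σ e_i, a lattice point of the affine hull,
  -- strictly in between. A hyperplane less than one step away is excluded because both values are
  -- integers.
  distance-one : ∀ {p α σ b d} i → b i ≡ true → σ ℤ.* σ ≡ + 1 → Hull A (ofℤ p) → A α → A (incr α i) →
    LatticeDist1 (Hull A) p (normal σ b) (fromℤ d) → σ ℤ.* isum b p ℤ.+ + 1 ≡ d
  distance-one {p} {α} {σ} {b} {d} i bi unit p∈ a a′ (_ , lt , none) = compare (ℤP.<-cmp (σ ℤ.* isum b p ℤ.+ + 1) d)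
    where
    compare : Tri (σ ℤ.* isum b p ℤ.+ + 1 ℤ.< d) (σ ℤ.* isum b p ℤ.+ + 1 ≡ d) (d ℤ.< σ ℤ.* isum b p ℤ.+ + 1) →
      σ ℤ.* isum b p ℤ.+ + 1 ≡ d
    compare (tri≈ _ e _) = e
    compare (tri> _ _ gt) = ⊥-elim (ℤ-sandwich {σ ℤ.* isum b p} {d} (fromℤ-cancel-< (subst (ℚ._< fromℤ d) (dot-normal σ b p) lt)) gt)
    compare (tri< lt′ _ _) = ⊥-elim (none (shift p i σ) (shift-affine {p = p} {α} {i} σ p∈ a a′)
      (subst₂ ℚ._<_ (sym (dot-normal σ b p)) (sym (dot-shift σ b p i bi unit)) (fromℤ-mono-< (i<i+1 (σ ℤ.* isum b p))))
      (subst (ℚ._< fromℤ d) (sym (dot-shift σ b p i bi unit)) (fromℤ-mono-< lt′)))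

  -- Every face is contained in a face {normal σ b = normal σ b · p + 1}.
  record Cover (p : Vec ℕ m) : Set where
    field
      centre : A p
      up : ∀ i → A (p V.[ i ]≔ suc (lookup p i))
      down : ∀ i → ∃ λ x → suc x ≡ lookup p i × A (p V.[ i ]≔ x)
      spans : ∀ {σ} (d : Dir σ) b i → b i ≡ true → Spans A σ b (val (normal σ b) p ℚ.+ 1ℚ)
      cover : ∀ ℓ c → (∀ α → A α → val ℓ α ℚ.≤ c) → ∃ (λ q → Hull A q × dot ℓ q ℚ.< c) →
        ∃ λ σ → Dir σ × ∃ λ b → ∃ λ i → b i ≡ true ×
          (∀ α → A α → val (normal σ b) α ℚ.≤ val (normal σ b) p ℚ.+ 1ℚ) ×
          (∀ α → A α → val ℓ α ≡ c → val (normal σ b) α ≡ val (normal σ b) p ℚ.+ 1ℚ)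

  -- The points p + e_i and p - e_i force a functional that is maximal at p to vanish, so p is
  -- interior. A facet lies in a covering face and equals it by maximality; `spans-unique` then
  -- makes its functional a positive multiple of the integral covering normal.
  cover-reflexive : ∀ {p} → Cover p → IsReflexive (Hull A)
  cover-reflexive {p} C = V.map +_ p , (subst (Hull A) (ofℕ-ofℤ p) (point centre) , interior) , facets
    where
    open Cover C
    x<x+1 : ∀ x → x ℚ.< x ℚ.+ 1ℚ
    x<x+1 x = subst (ℚ._< x ℚ.+ 1ℚ) (ℚP.+-identityʳ x) (ℚP.+-monoʳ-< x (ℚP.positive⁻¹ 1ℚ))
    interior : ∀ ℓ c → Valid (Hull A) ℓ c → dot ℓ (ofℤ (V.map +_ p)) ≡ c → ∀ q → Hull A q → dot ℓ q ≡ c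
    interior ℓ c v e q q∈ = trans (trans (cong (λ z → dot z q) ℓ≡0) (dot-zeroˡ q))
      (sym (trans (sym e) (trans (cong (λ z → dot z (ofℤ (V.map +_ p))) ℓ≡0) (dot-zeroˡ (ofℤ (V.map +_ p))))))
      where
      c≡ : val ℓ p ≡ c
      c≡ = trans (cong (dot ℓ) (ofℕ-ofℤ p)) e
      ℓ≤0 : ∀ i → lookup ℓ i ℚ.≤ 0ℚ
      ℓ≤0 i = +-cancel-≤0 (val ℓ p) (subst₂ ℚ._≤_ (val-up ℓ p i refl) (sym c≡) (v _ (point (up i))))
      ℓ≥0 : ∀ i → 0ℚ ℚ.≤ lookup ℓ i
      ℓ≥0 i = let x , x≡ , a = down i in subst (0ℚ ℚ.≤_) (ℚ-involutive (lookup ℓ i))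
        (ℚP.neg-antimono-≤ (+-cancel-≤0 (val ℓ p) {ℚ.- lookup ℓ i} (subst₂ ℚ._≤_ (val-down ℓ p i x≡) (sym c≡) (v _ (point a)))))
      ℓ≡0 : ℓ ≡ V.replicate m 0ℚ
      ℓ≡0 = vec-ext λ i → trans (ℚP.≤-antisym (ℓ≤0 i) (ℓ≥0 i)) (sym (VP.lookup-replicate i 0ℚ))
    facets : ∀ ℓ c → Facet (Hull A) ℓ c → LatticeDist1 (Hull A) (V.map +_ p) ℓ c
    facets ℓ c ((v , q₀ , q₀∈ , lt₀) , maximal) = (ofℕ β , point aβ , onℓ aβ eβ) , lt , none
      where
      covering = cover ℓ c (λ α a → v (ofℕ α) (point a)) (q₀ , q₀∈ , lt₀)
      σ : ℤ
      σ = proj₁ covering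
      dir : Dir σ
      dir = proj₁ (proj₂ covering)
      b : Fin m → Bool
      b = proj₁ (proj₂ (proj₂ covering))
      i : Fin m
      i = proj₁ (proj₂ (proj₂ (proj₂ covering)))
      rest = proj₂ (proj₂ (proj₂ (proj₂ covering)))
      vN : ∀ α → A α → val (normal σ b) α ℚ.≤ val (normal σ b) p ℚ.+ 1ℚ
      vN = proj₁ (proj₂ rest)
      tN : ∀ α → A α → val ℓ α ≡ c → val (normal σ b) α ≡ val (normal σ b) p ℚ.+ 1ℚ
      tN = proj₂ (proj₂ rest)
      N = normal σ b
      cN = val N p ℚ.+ 1ℚ
      sp : Spans A σ b cN
      sp = spans dir b i (proj₁ rest)
      β = proj₁ (Spans.on sp)
      aβ = proj₁ (proj₂ (Spans.on sp))
      eβ = proj₂ (proj₂ (Spans.on sp))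
      -- The covering face is proper because p lies strictly below its bound, so the maximality of
      -- the facet applies to it.
      onℓ : ∀ {α} → A α → val N α ≡ cN → val ℓ α ≡ c
      onℓ {α} a e = proj₂ (maximal N cN (valid {ℓ = N} vN , ofℕ p , point centre , x<x+1 (val N p))
        (λ q (q∈ , eq) → q∈ , tight {ℓ = ℓ} {N} (λ α a → v (ofℕ α) (point a)) tN q q∈ eq) (ofℕ α) (point a , e))
      scaling = spans-unique sp {ℓ} {c} (λ α → onℓ)
      t = proj₁ scaling
      scaled = proj₁ (proj₂ scaling)
      c≡ : c ≡ t ℚ.* cN
      c≡ = proj₂ (proj₂ scaling)
      t≢0 : t ≢ 0ℚ
      t≢0 t≡0 = ℚP.<-irrefl (trans (scaled q₀) (trans (cong (ℚ._* dot N q₀) t≡0) (trans (ℚP.*-zeroˡ (dot N q₀))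
        (sym (trans c≡ (trans (cong (ℚ._* cN) t≡0) (ℚP.*-zeroˡ cN))))))) lt₀
      t≥0 : 0ℚ ℚ.≤ t
      t≥0 = subst (0ℚ ℚ.≤_) (ℚ-involutive t) (ℚP.neg-antimono-≤ (+-cancel-≤0 c
        (subst (ℚ._≤ c) (trans (scaled (ofℕ p)) (trans (solve 2 (λ t x → t :* x := t :* (x :+ con 1ℚ) :+ (:- t)) refl t (val N p))
          (cong (ℚ._+ ℚ.- t) (sym c≡)))) (v (ofℕ p) (point centre)))))
      instance
        t-pos : ℚ.Positive t
        t-pos = ℚP.nonNeg∧nonZero⇒pos t {{ℚ.nonNegative t≥0}} {{ℚ.≢-nonZero t≢0}}
        t-nonNeg : ℚ.NonNegative t
        t-nonNeg = ℚ.nonNegative t≥0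
      lt : dot ℓ (ofℤ (V.map +_ p)) ℚ.< c
      lt = subst₂ ℚ._<_ (sym (trans (cong (dot ℓ) (sym (ofℕ-ofℤ p))) (scaled (ofℕ p)))) (sym c≡) (ℚP.*-monoʳ-<-pos t (x<x+1 (val N p)))
      -- After division by t the values at p, at z and on the facet are N, an integer, and N + 1,
      -- where N is the integral value at p.
      none : ∀ z → AffHull (Hull A) (ofℤ z) → dot ℓ (ofℤ (V.map +_ p)) ℚ.< dot ℓ (ofℤ z) → dot ℓ (ofℤ z) ℚ.< c → ⊥
      none z _ l₁ l₂ = ℤ-sandwich {σ ℤ.* + nsum b p} {σ ℤ.* isum b z}
        (fromℤ-cancel-< (subst₂ ℚ._<_ (val-normal σ b p) (dot-normal σ b z)
          (ℚP.*-cancelˡ-<-nonNeg t (subst₂ ℚ._<_ (trans (cong (dot ℓ) (sym (ofℕ-ofℤ p))) (scaled (ofℕ p))) (scaled (ofℤ z)) l₁))))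
        (fromℤ-cancel-< (subst₂ ℚ._<_ (dot-normal σ b z) (trans (cong (ℚ._+ 1ℚ) (val-normal σ b p)) (sym (fromℤ-+ (σ ℤ.* + nsum b p) (+ 1))))
          (ℚP.*-cancelˡ-<-nonNeg t (subst₂ ℚ._<_ (scaled (ofℤ z)) c≡ l₂))))

-- Facets cut out by indicator vectors.

at-update : ∀ {m} (v : Vec ℕ m) i x → at (v V.[ i ]≔ x) (toℕ i) ≡ x
at-update v i x = trans (atD-lookup 0 (v V.[ i ]≔ x) i) (VP.lookup∘updateAt i v)

at-update-≢ : ∀ {m} (v : Vec ℕ m) i x {k} → k ≢ toℕ i → at (v V.[ i ]≔ x) k ≡ at v k
at-update-≢ (y ∷ v) zero x {zero} ne = ⊥-elim (ne refl)
at-update-≢ (y ∷ v) zero x {suc k} ne = refl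
at-update-≢ (y ∷ v) (suc i) x {zero} ne = refl
at-update-≢ (y ∷ v) (suc i) x {suc k} ne = at-update-≢ v i x (ne ∘ cong suc)

is : ∀ {m} → Fin m → Fin m → Bool
is zero zero = true
is zero (suc j) = false
is (suc i) zero = false
is (suc i) (suc j) = is i j

is-refl : ∀ {m} (i : Fin m) → is i i ≡ true
is-refl zero = refl
is-refl (suc i) = is-refl i

is⁻ : ∀ {m} (i j : Fin m) → is i j ≡ true → i ≡ j
is⁻ zero zero e = refl
is⁻ (suc i) (suc j) e = cong suc (is⁻ i j e)

isum-none : ∀ {m} (z : Vec ℤ m) → isum (λ _ → false) z ≡ + 0
isum-none [] = refl
isum-none (x ∷ z) = cong (λ y → + 0 ℤ.+ y) (isum-none z)

isum-is : ∀ {m} i (z : Vec ℤ m) → isum (is i) z ≡ lookup z i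
isum-is zero (x ∷ z) = trans (cong (λ y → x ℤ.+ y) (isum-none z)) (ℤP.+-identityʳ x)
isum-is (suc i) (x ∷ z) = trans (ℤP.+-identityˡ _) (isum-is i z)

nsum-is : ∀ {m} i (α : Vec ℕ m) → nsum (is i) α ≡ lookup α i
nsum-is i α = ℤP.+-injective (trans (sym (isum-ℕ (is i) α)) (trans (isum-is i (V.map +_ α)) (VP.lookup-map i +_ α)))

all : ∀ {m} → Fin m → Bool
all _ = true

nsum-sumTo : ∀ {m} (g : ℕ → Bool) (α : Vec ℕ m) → nsum (g ∘ toℕ) α ≡ sumTo (λ i → if g i then at α i else 0) m
nsum-sumTo g [] = refl
nsum-sumTo {suc m} g (x ∷ α) = trans (cong (λ z → (if g 0 then x else 0) + z) (nsum-sumTo (g ∘ suc) α))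
  (sym (sumTo-shift (λ i → if g i then at (x ∷ α) i else 0) m))

nsum-all : ∀ {m} (α : Vec ℕ m) → nsum all α ≡ sumTo (at α) m
nsum-all = nsum-sumTo (λ _ → true)

at-replicate : ∀ m x {i} → i < m → at (V.replicate m x) i ≡ x
at-replicate (suc m) x {zero} _ = refl
at-replicate (suc m) x {suc i} (s≤s p) = at-replicate m x p

nsum-all-replicate : ∀ m x → nsum all (V.replicate m x) ≡ m * x
nsum-all-replicate m x = trans (nsum-all (V.replicate m x)) (trans (sumTo-cong m λ i p → at-replicate m x p) (sumTo-const x m))

-- The input of `spans-facet` and `distance-one` in natural numbers. The pair in `raise` makes
-- e_pivot a direction of the affine hull, which is what turns the distance condition into an
-- equation.
record FacetData {m} (A : Vec ℕ m → Set) {σ} (d : Dir σ) (b : Fin m → Bool) (Y : ℕ) : Set where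
  field
    bound : ∀ α → A α → nsum b α ≤[ d ] Y
    off : ∃ λ α → A α × nsum b α <[ d ] Y
    pivot : Fin m
    pivot∈ : b pivot ≡ true
    raise : ∃ λ α → A α × A (incr α pivot)
    on : ∃ λ α → A α × nsum b α ≡ Y
    free : ∀ j → b j ≡ false → ∃ λ α → A α × A (incr α j) × nsum b α ≡ Y
    tied : ∀ j → b j ≡ true → j ≢ pivot →
      ∃ λ α → A α × A (swap α j pivot) × nsum b α ≡ Y × lookup α j ≢ lookup α pivot

facet-equation : ∀ {m} {A : Vec ℕ m → Set} {p σ b Y} {d : Dir σ} → Hull A (ofℤ p) →
  (∀ ℓ c → Facet (Hull A) ℓ c → LatticeDist1 (Hull A) p ℓ c) → FacetData A d b Y →
  σ ℤ.* isum b p ℤ.+ + 1 ≡ σ ℤ.* + Y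
facet-equation {m} {A} {p} {σ} {b} {Y} {d} p∈ R F = let α , a , a′ = raise in
  distance-one {p = p} {α} {σ} {b} pivot pivot∈ (dir-unit d) p∈ a a′
  (R (normal σ b) c (spans-facet sp (λ α a → subst (ℚ._≤ c) (sym (val-normal σ b α)) (fromℤ-mono-≤ (dir-≤ d (bound α a))))
    (let α , a , lt = off in α , a , subst (ℚ._< c) (sym (val-normal σ b α)) (fromℤ-mono-< (dir-< d lt)))))
  where
  open FacetData F
  c = fromℤ (σ ℤ.* + Y)
  value : ∀ {α} → nsum b α ≡ Y → val (normal σ b) α ≡ c
  value {α} e = trans (val-normal σ b α) (cong (λ y → fromℤ (σ ℤ.* + y)) e)
  sp : Spans A σ b c
  sp = record { unit = dir-unit d ; pivot = pivot ; pivot∈ = pivot∈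
    ; on = let α , a , e = on in α , a , value e
    ; free = λ j bj → let α , a , a′ , e = free j bj in α , a , a′ , value e
    ; tied = λ j bj ne → let α , a , a′ , e , q = tied j bj ne in α , a , a′ , value e , q }

-- Applied to λ, this finds a row r + 1 that can take a further box. Such a row is never row 0,
-- whose length is fixed.
drop-exists : ∀ (f : ℕ → ℕ) k → f k < f 0 → ∃ λ r → r < k × f (suc r) < f r
drop-exists f zero lt = ⊥-elim (ℕP.<-irrefl refl lt)
drop-exists f (suc k) lt with f k <? f 0
... | yes p = let r , r< , d = drop-exists f k p in r , ℕP.m<n⇒m<1+n r< , d
... | no ¬p = k , ℕP.n<1+n k , ℕP.<-≤-trans lt (ℕP.≮⇒≥ ¬p)

-- Necessity.

if-true : ∀ {b : Bool} {x y : ℕ} → b ≡ true → (if b then x else y) ≡ x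
if-true refl = refl

if-false : ∀ {b : Bool} {x y : ℕ} → b ≡ false → (if b then x else y) ≡ y
if-false refl = refl

≤ᵇ-false : ∀ {m n} → n < m → (m ≤ᵇ n) ≡ false
≤ᵇ-false {m} {n} p with m ≤ᵇ n in e
... | true = ⊥-elim (ℕP.<⇒≱ p (≤ᵇ⁻ {m} e))
... | false = refl

≤ᵇ-false⁻ : ∀ {m n} → (m ≤ᵇ n) ≡ false → n < m
≤ᵇ-false⁻ {m} {n} e with n <? m
... | yes p = p
... | no ¬p = case trans (sym e) (≤ᵇ⁺ (ℕP.≮⇒≥ ¬p)) of λ ()

nsum-≥ : ∀ {m} b (α : Vec ℕ m) i → b i ≡ true → lookup α i ≤ nsum b α
nsum-≥ b (x ∷ α) zero e = subst (x ≤_) (cong (_+ nsum (b ∘ suc) α) (sym (if-true e))) (ℕP.m≤m+n x _)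
nsum-≥ b (x ∷ α) (suc i) e = ℕP.≤-trans (nsum-≥ (b ∘ suc) α i e) (ℕP.m≤n+m _ _)

sumTo-≥ : ∀ s n → sumTo (λ i → if s ≤ᵇ i then 1 else 0) n ≡ n ∸ s
sumTo-≥ s zero = sym (ℕP.0∸n≡0 s)
sumTo-≥ s (suc n) with s ≤? n
... | yes p = trans (cong₂ _+_ (sumTo-≥ s n) (if-true (≤ᵇ⁺ p))) (trans (ℕP.+-comm (n ∸ s) 1) (sym (ℕP.+-∸-assoc 1 p)))
... | no ¬p = trans (cong₂ _+_ (sumTo-≥ s n) (if-false (≤ᵇ-false (ℕP.≰⇒> ¬p))))
    (trans (ℕP.+-identityʳ (n ∸ s)) (trans (ℕP.m≤n⇒m∸n≡0 (ℕP.<⇒≤ (ℕP.≰⇒> ¬p))) (sym (ℕP.m≤n⇒m∸n≡0 (ℕP.≰⇒> ¬p)))))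

admissible-self : ∀ {m h} {lam : Vec ℕ m} → (∀ i → at lam (suc i) ≤ at lam i) → Admissible h lam lam
admissible-self dec = record { decreasing = dec ; lower = λ _ → ℕP.≤-refl ; upper = λ _ → ℕP.m≤m+n _ _ }

-- Row k + 1 may gain h (k + 1) ≥ 1 boxes, and the descent from row k keeps the shape a partition.
admissible-incr : ∀ {m h} {lam : Vec ℕ m} → 1 ≤ h → (∀ i → at lam (suc i) ≤ at lam i) →
  ∀ r {k} → toℕ r ≡ suc k → at lam (suc k) < at lam k → Admissible h lam (incr lam r)
admissible-incr {m} {h} {lam} 1≤h dec r {k} r≡ lt = record { decreasing = dec′ ; lower = lower′ ; upper = upper′ }
  where
  v = incr lam r
  at-r : at v (suc k) ≡ suc (at lam (suc k))
  at-r = subst (λ i → at v i ≡ suc (at lam i)) r≡ (trans (at-update lam r _) (cong suc (sym (atD-lookup 0 lam r))))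
  at-≢ : ∀ {i} → i ≢ suc k → at v i ≡ at lam i
  at-≢ ne = at-update-≢ lam r _ (λ e → ne (trans e r≡))
  lower′ : ∀ i → at lam i ≤ at v i
  lower′ i with i ℕP.≟ suc k
  ... | yes refl = subst (at lam i ≤_) (sym at-r) (ℕP.n≤1+n _)
  ... | no ne = ℕP.≤-reflexive (sym (at-≢ ne))
  dec′ : ∀ i → at v (suc i) ≤ at v i
  dec′ i with suc i ℕP.≟ suc k
  ... | yes refl = subst₂ _≤_ (sym at-r) (sym (at-≢ (ℕP.<⇒≢ (ℕP.n<1+n k)))) lt
  ... | no ne = subst (_≤ at v i) (sym (at-≢ ne)) (ℕP.≤-trans (dec i) (lower′ i))
  upper′ : ∀ i → at v i ≤ at lam i + h * i
  upper′ i with i ℕP.≟ suc k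
  ... | yes refl = subst₂ _≤_ (sym at-r) refl (subst (_≤ at lam i + h * i) (ℕP.+-comm (at lam i) 1)
        (ℕP.+-monoʳ-≤ (at lam i) (ℕP.*-mono-≤ 1≤h (s≤s (z≤n {k})))))
  ... | no ne = subst (_≤ at lam i + h * i) (sym (at-≢ ne)) (ℕP.m≤m+n _ _)

-- `A` stands for the set of exponents of G. It enters only through an inner description `inA` and
-- an outer one `witness`, so the geometry never opens `coeffG`.
module Faces {n h} {lam : Vec ℕ (suc (suc n))} (1≤h : 1 ≤ h) (dec : ∀ i → at lam (suc i) ≤ at lam i)
  (last : at lam (suc n) ≡ 0) (pos : 1 ≤ at lam 0)
  (A : Vec ℕ (suc (suc n)) → Set) (inA : ∀ {α v} → Admissible h lam v → α ∼ v → A α)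
  (witness : ∀ α → A α → Witness h lam α) where

  private
    m : ℕ
    m = suc (suc n)
    end : Fin m
    end = F.fromℕ (suc n)

    toℕ-end : toℕ end ≡ suc n
    toℕ-end = FP.toℕ-fromℕ (suc n)

    at-end : ∀ (v : Vec ℕ m) → lookup v end ≡ at v (suc n)
    at-end v = trans (sym (atD-lookup 0 v end)) (cong (at v) toℕ-end)

    λ-end : lookup lam end ≡ 0
    λ-end = trans (at-end lam) last

    λ-zero : lookup lam zero ≡ at lam 0
    λ-zero = sym (atD-lookup 0 lam zero)

    self : Admissible h lam lam
    self = admissible-self dec

    ∃drop : ∃ λ k → k < suc n × at lam (suc k) < at lam k
    ∃drop = drop-exists (at lam) (suc n) (subst (_< at lam 0) (sym last) pos)

    raise-any : ∀ i → ∃ λ α → A α × A (incr α i)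
    raise-any i with ∃drop
    ... | k , k< , d with fin (s≤s k<)
    ...   | r , r≡ = swap lam i r , inA self (∼-swap i r ∼-refl)
            , inA (admissible-incr 1≤h dec r r≡ d) (∼-incr (∼-swap i r ∼-refl) (lookup-swapˡ lam i r))

    -- The facet x_i = λ_x, for a row x other than the row k+1 to which a box can be added.
    coordinate-facet : ∀ {σ} (d : Dir σ) i x {k} → k < suc n → at lam (suc k) < at lam k → toℕ x ≢ suc k →
      (∀ α → A α → lookup α i ≤[ d ] lookup lam x) → (∃ λ y → lookup lam y <[ d ] lookup lam x) →
      FacetData A d (is i) (lookup lam x)
    coordinate-facet d i x {k} k< dk x≢ bd (y , lt) with fin (s≤s k<)
    ... | r , r≡ = record
      { bound = λ α a → subst (_≤[ d ] lookup lam x) (sym (nsum-is i α)) (bd α a)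
      ; off = swap lam i y , inA self (∼-swap i y ∼-refl)
          , subst (_<[ d ] lookup lam x) (sym (trans (nsum-is i (swap lam i y)) (lookup-swapˡ lam i y))) lt
      ; pivot = i ; pivot∈ = is-refl i ; raise = raise-any i
      ; on = swap lam i x , inA self (∼-swap i x ∼-refl) , trans (nsum-is i (swap lam i x)) (lookup-swapˡ lam i x)
      ; free = free
      ; tied = λ j bj ne → ⊥-elim (ne (sym (is⁻ i j bj))) }
      where
      -- The entry λ_x is placed at i and the row that can grow at j; `x≢` makes these two different
      -- rows of λ, so the added box leaves coordinate i alone.
      free : ∀ j → is i j ≡ false → ∃ λ α → A α × A (incr α j) × nsum (is i) α ≡ lookup lam x
      free j bj with rearrange lam {j} {i} {r} {x} (λ { refl → case trans (sym bj) (is-refl j) of λ () })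
                       (λ { refl → x≢ r≡ })
      ... | α , α∼ , αj , αi = α , inA self α∼ , inA (admissible-incr 1≤h dec r r≡ dk) (∼-incr α∼ αj) , trans (nsum-is i α) αi

    α≤ : ∀ i α → A α → lookup α i ≤ lookup lam zero
    α≤ i α a = subst₂ _≤_ (atD-lookup 0 α i) (atD-lookup 0 lam zero) (Witness.bounded (witness α a) (toℕ i))

  upper-facet : ∀ i → FacetData A plus (is i) (at lam 0)
  upper-facet i with ∃drop
  ... | k , k< , d = subst (FacetData A plus (is i)) λ-zero
        (coordinate-facet plus i zero k< d (λ ()) (α≤ i) (end , subst₂ _<_ (sym λ-end) (sym λ-zero) pos))

  private
    -- The normal involves every coordinate, so only ties have to be shown: some rearrangement of v
    -- has the two unequal entries at j and at 0.
    total-facet : ∀ {σ} (d : Dir σ) v {x y} → Admissible h lam v → lookup v x ≢ lookup v y →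
      (∀ α → A α → sumTo (at α) m ≤[ d ] sumTo (at v) m) → (∃ λ α → A α × sumTo (at α) m <[ d ] sumTo (at v) m) →
      FacetData A d all (sumTo (at v) m)
    total-facet d v {x} {y} adm ne bd (α₁ , a₁ , lt) = record
      { bound = λ α a → subst (_≤[ d ] sumTo (at v) m) (sym (nsum-all α)) (bd α a)
      ; off = α₁ , a₁ , subst (_<[ d ] sumTo (at v) m) (sym (nsum-all α₁)) lt
      ; pivot = zero ; pivot∈ = refl ; raise = raise-any zero
      ; on = v , inA adm ∼-refl , nsum-all v
      ; free = λ j ()
      ; tied = λ j _ j≢ → let α , α∼ , αj , α0 = rearrange v {j} {zero} {x} {y} j≢ (ne ∘ cong (lookup v)) in
          α , inA adm α∼ , inA adm (∼-swap j zero α∼) , trans (nsum-all α) (total α∼) , λ e → ne (trans (sym αj) (trans e α0)) }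
      where
      total : ∀ {α} → α ∼ v → sumTo (at α) m ≡ sumTo (at v) m
      total {α} α∼ = trans (sym (size-map id α)) (trans (_∼_.sizes α∼ id) (size-map id v))

    size≥ : ∀ α → A α → sumTo (at lam) m ≤ sumTo (at α) m
    size≥ α a = let w = witness α a in
      subst (sumTo (at lam) m ≤_) (sym (Witness.same-size w)) (sumTo-mono m λ i _ → Admissible.lower (Witness.admissible w) i)

    larger : ∃ λ α → A α × sumTo (at lam) m < sumTo (at α) m
    larger with ∃drop
    ... | k , k< , d with fin (s≤s k<)
    ...   | r , r≡ = incr lam r , inA (admissible-incr 1≤h dec r r≡ d) ∼-refl
            , ℕP.≤-reflexive (sym (trans (sym (size-map id (incr lam r)))
                (ℕP.+-cancelʳ-≡ (lookup lam r) _ _ (trans (size-map-update id lam r (suc (lookup lam r)))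
                  (trans (ℕP.+-suc _ (lookup lam r)) (cong (λ z → suc (z + lookup lam r)) (size-map id lam)))))))

  size-facet : FacetData A minus all (sumTo (at lam) m)
  size-facet = total-facet minus lam {zero} {end} self (λ e → ℕP.<⇒≢ pos (sym (trans (sym λ-zero) (trans e λ-end)))) size≥ larger

  -- The hypothesis supplies a row other than the last one that can grow. Hence one coordinate can
  -- stay at the last entry 0 while any other one is raised.
  zero-facet : at lam n < at lam 0 → FacetData A minus (is zero) 0
  zero-facet lt with drop-exists (at lam) n lt
  ... | k , k<n , d = subst (FacetData A minus (is zero)) λ-end
        (coordinate-facet minus zero end (ℕP.m<n⇒m<1+n k<n) d (λ e → ℕP.<⇒≢ (s<s k<n) (sym (trans (sym toℕ-end) e)))
          (λ α a → subst (_≤ lookup α zero) (sym λ-end) z≤n)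
          (zero , subst₂ _<_ (sym λ-end) (sym λ-zero) pos))

  -- For λ = (a,…,a,0) and h(m-1) < a the largest shape is (a,…,a,h(m-1)).
  upper-size-facet : at lam n ≡ at lam 0 → h * suc n < at lam 0 → FacetData A plus all (sumTo (at lam) m + h * suc n)
  upper-size-facet flat lt = subst (FacetData A plus all) v-size
    (total-facet plus v {zero} {end} adm v-ne bound (lam , inA self ∼-refl , subst (sumTo (at lam) m <_) (sym v-size) (ℕP.m<m+n _ hn)))
    where
    v : Vec ℕ m
    v = lam V.[ end ]≔ (h * suc n)
    hn : 0 < h * suc n
    hn = ℕP.*-mono-≤ 1≤h (s≤s (z≤n {n}))
    const : ∀ {i} → i ≤ n → at lam i ≡ at lam 0
    const i≤n = ℕP.≤-antisym (antitone dec z≤n) (subst (_≤ at lam _) flat (antitone dec i≤n))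
    v-last : at v (suc n) ≡ h * suc n
    v-last = subst (λ i → at v i ≡ h * suc n) toℕ-end (at-update lam end (h * suc n))
    v-other : ∀ {i} → i ≢ suc n → at v i ≡ at lam i
    v-other ne = at-update-≢ lam end (h * suc n) (λ e → ne (trans e toℕ-end))
    v-size : sumTo (at v) m ≡ sumTo (at lam) m + h * suc n
    v-size = trans (cong₂ _+_ (sumTo-cong (suc n) λ i p → v-other (ℕP.<⇒≢ p)) v-last)
      (cong (_+ h * suc n) (sym (trans (cong (λ z → sumTo (at lam) (suc n) + z) last) (ℕP.+-identityʳ _))))
    v-ne : lookup v zero ≢ lookup v end
    v-ne e = ℕP.<⇒≢ lt (sym (trans (sym (v-other {0} (λ ()))) (trans (atD-lookup 0 v zero) (trans e (trans (at-end v) v-last)))))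
    dec-v : ∀ i → at v (suc i) ≤ at v i
    dec-v i with i ℕP.≟ suc n
    ... | yes refl = subst (_≤ at v (suc n)) (sym (atD-≥ 0 v ℕP.≤-refl)) z≤n
    ... | no ne with suc i ℕP.≟ suc n
    ...   | yes refl = subst₂ _≤_ (sym v-last) (sym (trans (v-other ne) flat)) (ℕP.<⇒≤ lt)
    ...   | no ne′ = subst₂ _≤_ (sym (v-other ne′)) (sym (v-other ne)) (dec i)
    lower-v : ∀ i → at lam i ≤ at v i
    lower-v i with i ℕP.≟ suc n
    ... | yes refl = subst (_≤ at v (suc n)) (sym last) z≤n
    ... | no ne = ℕP.≤-reflexive (sym (v-other ne))
    upper-v : ∀ i → at v i ≤ at lam i + h * i
    upper-v i with i ℕP.≟ suc n
    ... | yes refl = subst (_≤ at lam (suc n) + h * suc n) (sym v-last) (ℕP.m≤n+m _ _)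
    ... | no ne = subst (_≤ at lam i + h * i) (sym (v-other ne)) (ℕP.m≤m+n _ _)
    adm : Admissible h lam v
    adm = record { decreasing = dec-v ; lower = lower-v ; upper = upper-v }
    bound : ∀ α → A α → sumTo (at α) m ≤ sumTo (at v) m
    bound α a = subst (_≤ sumTo (at v) m) (sym same-size) (sumTo-mono m below)
      where
      open Witness (witness α a)
      open Admissible admissible
      below : ∀ i → i < m → at shape i ≤ at v i
      below i (s≤s i≤) with i ℕP.≟ suc n
      ... | yes refl = subst (at shape i ≤_) (trans (cong (_+ h * suc n) last) (sym v-last)) (upper i)
      ... | no ne = subst (at shape i ≤_) (sym (trans (v-other ne) (const (s≤s⁻¹ (ℕP.≤∧≢⇒< i≤ ne)))))
            (ℕP.≤-trans (antitone decreasing (z≤n {i})) (subst (at shape 0 ≤_) (trans (cong (λ z → at lam 0 + z) (ℕP.*-zeroʳ h)) (ℕP.+-identityʳ _)) (upper 0)))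

  -- For λ = (2,…,2,1,…,1,0,…,0) with at least two 1s, the last one in row s + 1.
  tail-facet : at lam 0 ≡ 2 → ∀ {s} → suc s < m → at lam s ≡ 1 → at lam (suc s) ≡ 1 → at lam (suc (suc s)) ≡ 0 →
    FacetData A minus (λ i → suc s ≤ᵇ toℕ i) 1
  tail-facet top {s₀} s<m λs₀ λs λs+ = record
      { bound = bound ; off = off ; pivot = S ; pivot∈ = ≤ᵇ⁺ (ℕP.≤-reflexive (sym S≡)) ; raise = raise-any S
      ; on = lam , inA self ∼-refl , tail-sum lam (λ _ _ → refl) ; free = free ; tied = tied }
    where
    s : ℕ
    s = suc s₀
    b : Fin m → Bool
    b i = s ≤ᵇ toℕ i
    after : ∀ {i} → s < i → at lam i ≡ 0
    after p = ℕP.n≤0⇒n≡0 (subst (at lam _ ≤_) λs+ (antitone dec p))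
    tail-sum : ∀ (α : Vec ℕ m) → (∀ i → s ≤ i → at α i ≡ at lam i) → nsum b α ≡ 1
    tail-sum α agree = trans (nsum-sumTo (s ≤ᵇ_) α) (trans (sumTo-stable _ m s<m λ i p → trans (if-true (≤ᵇ⁺ (ℕP.<⇒≤ p))) (trans (agree i (ℕP.<⇒≤ p)) (after p)))
      (cong₂ _+_ (sumTo-0 s λ i p → if-false (≤ᵇ-false p)) (trans (if-true (≤ᵇ⁺ (ℕP.≤-refl {s}))) (trans (agree s ℕP.≤-refl) λs))))
    bound : ∀ α → A α → 1 ≤ nsum b α
    bound α a with Witness.tail (witness α a) s (ℕP.≤-trans (ℕP.≤-reflexive (sym λs)) (Admissible.lower (Witness.admissible (witness α a)) s))
    ... | i , s≤i , i<m , 1≤ with fin i<m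
    ...   | j , refl = ℕP.≤-trans (subst (1 ≤_) (atD-lookup 0 α j) 1≤) (nsum-≥ b α j (≤ᵇ⁺ s≤i))
    S : Fin m
    S = proj₁ (fin s<m)
    S≡ : toℕ S ≡ s
    S≡ = proj₂ (fin s<m)
    at-S : lookup lam S ≡ 1
    at-S = trans (sym (atD-lookup 0 lam S)) (trans (cong (at lam) S≡) λs)
    -- The rows 0 to s₀ descend from 2 to 1, so some row before s can grow; adding the box there
    -- does not change the sum over the tail.
    drop₂ : ∃ λ k → k < s₀ × at lam (suc k) < at lam k
    drop₂ = drop-exists (at lam) s₀ (subst₂ _<_ (sym λs₀) (sym top) (s≤s (s≤s z≤n)))
    off : ∃ λ α → A α × 1 < nsum b α
    off = swap lam zero S , inA self (∼-swap zero S ∼-refl) , ℕP.≤-trans (subst (2 ≤_) (sym (trans (lookup-swapʳ lam zero S) (trans λ-zero top))) ℕP.≤-refl)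
      (nsum-≥ b (swap lam zero S) S (≤ᵇ⁺ (ℕP.≤-reflexive (sym S≡))))
    free : ∀ j → b j ≡ false → ∃ λ α → A α × A (incr α j) × nsum b α ≡ 1
    free j bj with drop₂
    ... | k , k< , d with fin (ℕP.<-trans (s<s k<) s<m)
    ...   | r , r≡ = swap lam j r , inA self (∼-swap j r ∼-refl)
            , inA (admissible-incr 1≤h dec r r≡ d) (∼-incr (∼-swap j r ∼-refl) (lookup-swapˡ lam j r))
            , tail-sum (swap lam j r) λ i s≤i → trans
                (at-update-≢ (lam V.[ j ]≔ lookup lam r) r (lookup lam j) (λ e → ℕP.<⇒≱ (s<s k<) (subst (s ≤_) (trans e r≡) s≤i)))
                (at-update-≢ lam j (lookup lam r) (λ e → ℕP.<⇒≱ (≤ᵇ-false⁻ {s} bj) (subst (s ≤_) e s≤i)))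
    tied : ∀ j → b j ≡ true → j ≢ S → ∃ λ α → A α × A (swap α j S) × nsum b α ≡ 1 × lookup α j ≢ lookup α S
    tied j bj ne = lam , inA self ∼-refl , inA self (∼-swap j S ∼-refl) , tail-sum lam (λ _ _ → refl)
      , λ e → case trans (sym λj) (trans e at-S) of λ ()
      where
      λj : lookup lam j ≡ 0
      λj = trans (sym (atD-lookup 0 lam j)) (after (ℕP.≤∧≢⇒< (≤ᵇ⁻ {s} bj) λ e → ne (FP.toℕ-injective (trans (sym e) (sym S≡)))))

module Necessity {n h} {lam : Vec ℕ (suc (suc n))} (1≤h : 1 ≤ h) (dec : ∀ i → at lam (suc i) ≤ at lam i)
  (last : at lam (suc n) ≡ 0) (pos : 1 ≤ at lam 0)
  (A : Vec ℕ (suc (suc n)) → Set) (inA : ∀ {α v} → Admissible h lam v → α ∼ v → A α)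
  (witness : ∀ α → A α → Witness h lam α) (R : IsReflexive (Hull A)) where

  private
    module Fs = Faces 1≤h dec last pos A inA witness
    m : ℕ
    m = suc (suc n)
    p : Vec ℤ m
    p = proj₁ R

    equation : ∀ {σ b Y} {d : Dir σ} → FacetData A d b Y → σ ℤ.* isum b p ℤ.+ + 1 ≡ σ ℤ.* + Y
    equation = facet-equation {A = A} {p} (proj₁ (proj₁ (proj₂ R))) (proj₂ (proj₂ R))

    upper-equation : ∀ i → lookup p i ℤ.+ + 1 ≡ + at lam 0
    upper-equation i = subst₂ (λ x y → x ℤ.+ + 1 ≡ y) (trans (ℤP.*-identityˡ _) (isum-is i p)) (ℤP.*-identityˡ _)
      (equation (Fs.upper-facet i))

  centre : ℕ
  centre = pred (at lam 0)

  top : at lam 0 ≡ suc centre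
  top = sym (ℕP.suc-pred (at lam 0) {{ℕ.>-nonZero pos}})

  private
    p≡ : p ≡ V.map +_ (V.replicate m centre)
    p≡ = vec-ext λ i → trans (coord i) (sym (trans (VP.lookup-map i +_ (V.replicate m centre)) (cong +_ (VP.lookup-replicate i centre))))
      where
      cancel : ∀ x y → x ≡ (x ℤ.+ y) ℤ.+ ℤ.- y
      cancel = ℤsolve-∀
      coord : ∀ i → lookup p i ≡ + centre
      coord i = trans (cancel (lookup p i) (+ 1)) (trans (cong (ℤ._+ ℤ.- + 1) (upper-equation i)) (cong (λ z → + z ℤ.+ ℤ.- + 1) top))

    natural : ∀ {σ b Y} {d : Dir σ} → FacetData A d b Y → Next d (nsum b (V.replicate m centre)) Y
    natural {σ} {b} {Y} {d} F = dir-next d (subst (λ z → σ ℤ.* z ℤ.+ + 1 ≡ σ ℤ.* + Y)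
      (trans (cong (isum b) p≡) (isum-ℕ b (V.replicate m centre))) (equation F))

  size-equation : m * centre ≡ suc (sumTo (at lam) m)
  size-equation = trans (sym (nsum-all-replicate m centre)) (natural Fs.size-facet)

  centre≡1 : at lam n < at lam 0 → centre ≡ 1
  centre≡1 lt = trans (sym (trans (nsum-is zero (V.replicate m centre)) (VP.lookup-replicate {n = m} zero centre)))
    (natural (Fs.zero-facet lt))

  upper-size-equation : at lam n ≡ at lam 0 → h * suc n < at lam 0 → suc (m * centre) ≡ sumTo (at lam) m + h * suc n
  upper-size-equation flat lt = trans (cong suc (sym (nsum-all-replicate m centre))) (natural (Fs.upper-size-facet flat lt))

  -- The tail consists of m - (s + 1) coordinates, all equal to 1 at the interior point, while the
  -- sum on the facet is 1.
  tail-equation : centre ≡ 1 → ∀ {s} → suc s < m → at lam s ≡ 1 → at lam (suc s) ≡ 1 → at lam (suc (suc s)) ≡ 0 → m ∸ suc s ≡ 2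
  tail-equation c≡1 {s} s<m λs₀ λs λs+ = trans (sym (sumTo-≥ (suc s) m)) (trans (sumTo-cong m ones)
      (trans (sym (nsum-sumTo (suc s ≤ᵇ_) (V.replicate m centre))) (natural (Fs.tail-facet (trans top (cong suc c≡1)) s<m λs₀ λs λs+))))
    where
    ones : ∀ i → i < m → (if suc s ≤ᵇ i then 1 else 0) ≡ (if suc s ≤ᵇ i then at (V.replicate m centre) i else 0)
    ones i p = cong (λ x → if suc s ≤ᵇ i then x else 0) (sym (trans (at-replicate m centre p) c≡1))

decreasing-at : ∀ {m} {lam : Vec ℕ m} → IsPartition lam → ∀ i → at lam (suc i) ≤ at lam i
decreasing-at {m} {lam} part i with suc i <? m
... | no i≮ = subst (_≤ at lam i) (sym (atD-≥ 0 lam (ℕP.≮⇒≥ i≮))) z≤n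
... | yes i< = subst₂ _≤_
        (trans (sym (atD-lookup 0 lam (F.fromℕ< i<))) (cong (at lam) (FP.toℕ-fromℕ< i<)))
        (trans (sym (atD-lookup 0 lam (F.fromℕ< i<′))) (cong (at lam) (FP.toℕ-fromℕ< i<′)))
        (part (F.fromℕ< i<′) (F.fromℕ< i<) (subst₂ _≤_ (sym (FP.toℕ-fromℕ< i<′)) (sym (FP.toℕ-fromℕ< i<)) (ℕP.n≤1+n i)))
  where
  i<′ : i < m
  i<′ = ℕP.<-trans (ℕP.n<1+n i) i<

-- For a point, the empty face is a facet.
origin-not-reflexive : ∀ {m} {A : Vec ℕ m → Set} → (∀ α → A α → ∀ i → lookup α i ≡ 0) → ¬ IsReflexive (Hull A)
origin-not-reflexive {m} {A} zero-only (p , (p∈ , _) , facets) =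
  case facets zeros 1ℚ empty-facet of λ { ((q , _ , e) , _) → case trans (sym (dot-zeroˡ q)) e of λ () }
  where
  zeros : Pt m
  zeros = V.replicate m 0ℚ
  vanish : ∀ ℓ q → Hull A q → dot ℓ q ≡ 0ℚ
  vanish ℓ q q∈ = tight {ℓ = zeros} {ℓ} {0ℚ} {0ℚ} (λ α _ → ℚP.≤-reflexive (dot-zeroˡ (ofℕ α)))
    (λ α a _ → trans (cong (dot ℓ) (vec-ext λ i → trans (lookup-ofℕ α i) (trans (cong fromℕ (zero-only α a i)) (sym (VP.lookup-replicate i 0ℚ))))) (dot-zeroʳ ℓ))
    q q∈ (dot-zeroˡ q)
  empty-facet : Facet (Hull A) zeros 1ℚ
  empty-facet = ((λ q _ → subst (ℚ._≤ 1ℚ) (sym (dot-zeroˡ q)) (ℚP.nonNegative⁻¹ 1ℚ))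
      , ofℤ p , p∈ , subst (ℚ._< 1ℚ) (sym (dot-zeroˡ (ofℤ p))) (ℚP.positive⁻¹ 1ℚ))
    , λ { ℓ c (_ , q₀ , q₀∈ , lt) _ q (q∈ , e) →
            ⊥-elim (ℚP.<-irrefl (trans (vanish ℓ q₀ q₀∈) (sym (trans (sym e) (vanish ℓ q q∈)))) lt) }

-- From the facet equations to the four families.

level : ∀ (f : ℕ → ℕ) (v N : ℕ) → (∀ i → f (suc i) ≤ f i) → f N < v →
  ∃ λ a → a ≤ N × (∀ i → i < a → v ≤ f i) × (∀ i → a ≤ i → f i < v)
level f v N dec lt with f 0 <? v
... | yes p = 0 , z≤n , (λ i ()) , λ i _ → ℕP.≤-<-trans (antitone dec z≤n) p
level f v zero dec lt | no ¬p = ⊥-elim (¬p lt)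
level f v (suc N) dec lt | no ¬p with level (f ∘ suc) v N (dec ∘ suc) lt
... | a , a≤ , above , below = suc a , s≤s a≤
      , (λ { zero _ → ℕP.≮⇒≥ ¬p ; (suc i) (s≤s p) → above i p })
      , λ { (suc i) (s≤s p) → below i p }

<ᵇ-false : ∀ {m n} → n ≤ m → (m <ᵇ n) ≡ false
<ᵇ-false {m} {n} p with m <ᵇ n in e
... | true = ⊥-elim (ℕP.<⇒≱ (<ᵇ⁻ e) p)
... | false = refl

sumTo-< : ∀ {a n} → a ≤ n → sumTo (λ i → if i <ᵇ a then 1 else 0) n ≡ a
sumTo-< {a} {n} a≤n = trans (sumTo-stable _ n a≤n λ i p → if-false (<ᵇ-false {i} p))
  (trans (sumTo-cong a λ i p → if-true (<ᵇ⁺ p)) (trans (sumTo-const 1 a) (ℕP.*-identityʳ a)))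

-- centre is the common coordinate of the interior lattice point.
record Conditions {n} (h : ℕ) (lam : Vec ℕ (suc (suc n))) : Set where
  field
    centre : ℕ
    top : at lam 0 ≡ suc centre
    size-equation : suc (suc n) * centre ≡ suc (sumTo (at lam) (suc (suc n)))
    centre≡1 : at lam n < at lam 0 → centre ≡ 1
    upper-size-equation : at lam n ≡ at lam 0 → h * suc n < at lam 0 →
      suc (suc (suc n) * centre) ≡ sumTo (at lam) (suc (suc n)) + h * suc n
    tail-equation : centre ≡ 1 → ∀ {s} → s < suc n → at lam s ≡ 1 → at lam (suc s) ≡ 1 → at lam (suc (suc s)) ≡ 0 →
      suc n ∸ s ≡ 2

module _ {n h} {lam : Vec ℕ (suc (suc n))} (1≤h : 1 ≤ h) (dec : ∀ i → at lam (suc i) ≤ at lam i)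
  (last : at lam (suc n) ≡ 0) (N : Conditions h lam) where

  private
    module N = Conditions N
    m : ℕ
    m = suc (suc n)

    steps : at lam n < at lam 0 → ReflexiveCase m h lam
    steps lt with level (at lam) 2 (suc n) dec (subst (_< 2) (sym last) z<s) | level (at lam) 1 (suc n) dec (subst (_< 1) (sym last) z<s)
    -- `a` and `e` are the lengths of the second and the first column of λ. So |λ| = a + e, and e -
    -- a entries are equal to 1.
    ... | a , a≤ , ≥2 , <2 | e , e≤ , ≥1 , <1 = conclude (ℕP.<-cmp e (suc a))
      where
      c≡1 : N.centre ≡ 1
      c≡1 = N.centre≡1 lt
      top : at lam 0 ≡ 2
      top = trans N.top (cong suc c≡1)
      ≤2 : ∀ i → at lam i ≤ 2
      ≤2 i = subst (at lam i ≤_) top (antitone dec z≤n)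
      is2 : ∀ {i} → i < a → at lam i ≡ 2
      is2 p = ℕP.≤-antisym (≤2 _) (≥2 _ p)
      is1 : ∀ {i} → a ≤ i → i < e → at lam i ≡ 1
      is1 p q = ℕP.≤-antisym (s≤s⁻¹ (<2 _ p)) (≥1 _ q)
      is0 : ∀ {i} → e ≤ i → at lam i ≡ 0
      is0 p = ℕP.n<1⇒n≡0 (<1 _ p)
      a≤e : a ≤ e
      a≤e with a ≤? e
      ... | yes p = p
      ... | no ¬p = case trans (sym (is0 ℕP.≤-refl)) (is2 (ℕP.≰⇒> ¬p)) of λ ()
      1≤a : 1 ≤ a
      1≤a with a ≤? 0
      ... | yes p = ⊥-elim (ℕP.<⇒≢ (<2 0 p) top)
      ... | no ¬p = ℕP.≰⇒> ¬p
      indicators : ∀ i → at lam i ≡ (if i <ᵇ a then 1 else 0) + (if i <ᵇ e then 1 else 0)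
      indicators i with i <? a | i <? e
      ... | yes p | _ = trans (is2 p) (sym (cong₂ _+_ (if-true (<ᵇ⁺ p)) (if-true (<ᵇ⁺ (ℕP.<-≤-trans p a≤e)))))
      ... | no ¬p | yes q = trans (is1 (ℕP.≮⇒≥ ¬p) q) (sym (cong₂ _+_ (if-false (<ᵇ-false {i} (ℕP.≮⇒≥ ¬p))) (if-true (<ᵇ⁺ q))))
      ... | no ¬p | no ¬q = trans (is0 (ℕP.≮⇒≥ ¬q)) (sym (cong₂ _+_ (if-false (<ᵇ-false {i} (ℕP.≮⇒≥ ¬p))) (if-false (<ᵇ-false {i} (ℕP.≮⇒≥ ¬q)))))
      size≡ : suc n ≡ a + e
      size≡ = trans (ℕP.suc-injective (trans (sym (ℕP.*-identityʳ m)) (trans (cong (m *_) (sym c≡1)) N.size-equation)))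
        (trans (sumTo-cong m λ i _ → indicators i) (trans (sumTo-+ (λ i → if i <ᵇ a then 1 else 0) (λ i → if i <ᵇ e then 1 else 0) m)
          (cong₂ _+_ (sumTo-< (ℕP.m≤n⇒m≤1+n a≤)) (sumTo-< (ℕP.m≤n⇒m≤1+n e≤)))))
      double : ∀ a → suc (a + a) ≡ 2 * a + 1
      double = solve-∀
      double′ : ∀ a → suc (a + suc a) ≡ 2 * a + 2
      double′ = solve-∀
      entry : ∀ (i : Fin m) {x} → at lam (toℕ i) ≡ x → lookup lam i ≡ x
      entry i q = trans (sym (atD-lookup 0 lam i)) q
      conclude : _ → ReflexiveCase m h lam
      conclude (tri< e< _ _) = inj₁ (a , 1≤a , trans (cong suc (trans size≡ (cong (λ z → a + z) e≡a))) (double a)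
        , λ i → (λ p → entry i (is2 p)) , λ p → entry i (is0 (subst (_≤ toℕ i) (sym e≡a) p)))
        where
        e≡a : e ≡ a
        e≡a = ℕP.≤-antisym (s≤s⁻¹ e<) a≤e
      conclude (tri≈ _ refl _) = inj₂ (inj₁ (a , 1≤a , trans (cong suc size≡) (double′ a)
        , λ i → (λ p → entry i (is2 p)) , (λ p → entry i (is1 (ℕP.≤-reflexive (sym p)) (s≤s (ℕP.≤-reflexive p)))) , λ p → entry i (is0 p)))
      conclude (tri> _ _ e>) = ⊥-elim (absurd e refl e>)
        where
        absurd : ∀ e′ → e′ ≡ e → suc a < e′ → ⊥
        -- With e = s + 2 the tail equation gives e = m - 1. But a + e = m - 1 as well, so a would
        -- be 0.
        absurd (suc (suc s)) refl (s≤s (s≤s a≤s)) = ℕP.<⇒≢ 1≤a (sym (ℕP.+-cancelʳ-≡ e a 0 (trans (sym size≡) n≡e)))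
          where
          tail : suc n ∸ s ≡ 2
          tail = N.tail-equation c≡1 {s} (ℕP.≤-trans (ℕP.n≤1+n (suc s)) e≤) (is1 a≤s (ℕP.m<n⇒m<1+n (ℕP.n<1+n s)))
            (is1 (ℕP.m≤n⇒m≤1+n a≤s) ℕP.≤-refl) (is0 ℕP.≤-refl)
          n≡e : suc n ≡ suc (suc s)
          n≡e = trans (sym (ℕP.m∸n+n≡m (ℕP.≤-trans (ℕP.n≤1+n s) (ℕP.≤-trans (ℕP.n≤1+n (suc s)) e≤)))) (cong (_+ s) tail)

    flat : at lam n ≡ at lam 0 → ReflexiveCase m h lam
    flat eq = conclude (h * suc n <? at lam 0)
      where
      const : ∀ {i} → i ≤ n → at lam i ≡ at lam 0
      const i≤n = ℕP.≤-antisym (antitone dec z≤n) (subst (_≤ at lam _) eq (antitone dec i≤n))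
      c = N.centre
      size≡ : sumTo (at lam) m ≡ suc n * suc c
      size≡ = trans (cong₂ _+_ (trans (sumTo-cong (suc n) λ i p → trans (const (s≤s⁻¹ p)) N.top) (sumTo-const (suc c) (suc n))) last) (ℕP.+-identityʳ _)
      c≡m : c ≡ m
      c≡m = ℕP.+-cancelʳ-≡ (suc n * c) c m (trans N.size-equation (trans (cong suc size≡) (expand n c)))
        where
        expand : ∀ n c → suc (suc n * suc c) ≡ suc (suc n) + suc n * c
        expand = solve-∀
      top : at lam 0 ≡ m + 1
      top = trans N.top (trans (cong suc c≡m) (ℕP.+-comm 1 m))
      entry : ∀ (i : Fin m) {x} → at lam (toℕ i) ≡ x → lookup lam i ≡ x
      entry i q = trans (sym (atD-lookup 0 lam i)) q
      large : 2 ≤ h → ReflexiveCase m h lam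
      large 2≤h = inj₂ (inj₂ (inj₁ (2≤h , λ i → (λ p → entry i (trans (const (s≤s⁻¹ (s≤s⁻¹ p))) top)) , λ p → entry i (trans (cong (at lam) (ℕP.suc-injective p)) last))))
      small : ∀ h n′ → n′ ≡ n → 1 ≤ h → h * suc n ≡ 2 → 2 ≤ h ⊎ (h ≡ 1 × n ≡ 1)
      small (suc zero) n′ _ _ e = inj₂ (refl , ℕP.suc-injective (trans (sym (ℕP.+-identityʳ (suc n))) e))
      small (suc (suc h)) n′ _ _ e = inj₁ (s≤s (s≤s z≤n))
      conclude : Dec (h * suc n < at lam 0) → ReflexiveCase m h lam
      conclude (yes lt) with small h n refl 1≤h (ℕP.+-cancelˡ-≡ (sumTo (at lam) m) (h * suc n) 2
                              (trans (sym (N.upper-size-equation eq lt)) (trans (cong suc N.size-equation) (ℕP.+-comm 2 _))))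
      ... | inj₁ 2≤h = large 2≤h
      ... | inj₂ (refl , n≡1) = inj₂ (inj₂ (inj₂ (refl , cong {B = ℕ} (λ z → suc (suc z)) n≡1 , λ i →
              (λ p → entry i (trans (const (subst (toℕ i ≤_) (sym n≡1) (s≤s⁻¹ p))) (trans top (cong (λ z → suc (suc z) + 1) n≡1))))
              , λ p → entry i (trans (cong (at lam) (trans p (cong suc (sym n≡1)))) last))))
      -- For h ≤ 1 the inequality h (m - 1) ≥ λ_1 = m + 1 would fail.
      conclude (no ≮) with h ≤? 1
      ... | no h≰1 = large (ℕP.≰⇒> h≰1)
      ... | yes h≤1 = ⊥-elim (ℕP.<-irrefl refl (ℕP.<-≤-trans (ℕP.≤-<-trans (ℕP.≤-trans (ℕP.*-monoˡ-≤ (suc n) h≤1) (ℕP.≤-reflexive (ℕP.*-identityˡ (suc n)))) (subst (suc n <_) (sym top) (ℕP.m≤n⇒m≤n+o 1 (ℕP.n<1+n (suc n))))) (ℕP.≮⇒≥ ≮)))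

  conditions-case : ReflexiveCase m h lam
  conditions-case with ℕP.m≤n⇒m<n∨m≡n (antitone dec (z≤n {n}))
  ... | inj₁ lt = steps lt
  ... | inj₂ eq = flat eq

reflexive-conditions : ∀ {n h} {lam : Vec ℕ (suc (suc n))} → 1 ≤ h → (∀ i → at lam (suc i) ≤ at lam i) →
  at lam (suc n) ≡ 0 → 1 ≤ at lam 0 →
  (A : Vec ℕ (suc (suc n)) → Set) → (∀ {α v} → Admissible h lam v → α ∼ v → A α) →
  (∀ α → A α → Witness h lam α) → IsReflexive (Hull A) → Conditions h lam
reflexive-conditions {n} 1≤h dec last pos A inA witness R = record
  { centre = centre ; top = top ; size-equation = size-equation ; centre≡1 = centre≡1
  ; upper-size-equation = upper-size-equation
  ; tail-equation = λ c≡1 {s} s< → tail-equation c≡1 (s≤s s<) }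
  where open Necessity 1≤h dec last pos A inA witness R

-- Sufficiency.

size-update : ∀ {m} (v : Vec ℕ m) i x → size (v V.[ i ]≔ x) + lookup v i ≡ size v + x
size-update v i x = subst₂ (λ s t → s + lookup v i ≡ t + x) (cong size (VP.map-id (v V.[ i ]≔ x))) (cong size (VP.map-id v)) (size-map-update id v i x)

size-mono : ∀ {m} (v w : Vec ℕ m) → (∀ i → lookup v i ≤ lookup w i) → size v ≤ size w
size-mono [] [] h = z≤n
size-mono (x ∷ v) (y ∷ w) h = ℕP.+-mono-≤ (h zero) (size-mono v w (h ∘ suc))

size-mono-< : ∀ {m} (v w : Vec ℕ m) → (∀ i → lookup v i ≤ lookup w i) → ∀ i → lookup v i < lookup w i → size v < size w
size-mono-< (x ∷ v) (y ∷ w) h zero lt = ℕP.+-mono-<-≤ lt (size-mono v w (h ∘ suc))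
size-mono-< (x ∷ v) (y ∷ w) h (suc i) lt = ℕP.+-mono-≤-< (h zero) (size-mono-< v w (h ∘ suc) i lt)

size-replicate : ∀ m x → size (V.replicate m x) ≡ m * x
size-replicate zero x = refl
size-replicate (suc m) x = cong (λ z → x + z) (size-replicate m x)

argmax : ∀ {n} (ℓ : Pt (suc n)) → ∃ λ i → ∀ j → lookup ℓ j ℚ.≤ lookup ℓ i
argmax {zero} (x ∷ []) = zero , λ { zero → ℚP.≤-refl }
argmax {suc n} (x ∷ ℓ) with argmax ℓ
... | i , max with x ℚP.≤? lookup ℓ i
...   | yes x≤ = suc i , λ { zero → x≤ ; (suc j) → max j }
...   | no x≰ = zero , λ { zero → ℚP.≤-refl ; (suc j) → ℚP.≤-trans (max j) (ℚP.<⇒≤ (ℚP.≰⇒> x≰)) }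

argmin : ∀ {n} (ℓ : Pt (suc n)) → ∃ λ i → ∀ j → lookup ℓ i ℚ.≤ lookup ℓ j
argmin {zero} (x ∷ []) = zero , λ { zero → ℚP.≤-refl }
argmin {suc n} (x ∷ ℓ) with argmin ℓ
... | i , min with lookup ℓ i ℚP.≤? x
...   | yes ≤x = suc i , λ { zero → ≤x ; (suc j) → min j }
...   | no ≰x = zero , λ { zero → ℚP.≤-refl ; (suc j) → ℚP.≤-trans (ℚP.<⇒≤ (ℚP.≰⇒> ≰x)) (min j) }

swap-single : ∀ {m} (c x : ℕ) (i j : Fin m) → i ≢ j → swap (V.replicate m c V.[ i ]≔ x) j i ≡ V.replicate m c V.[ j ]≔ x
swap-single {m} c x i j i≢j = vec-ext coords
  where
  p = V.replicate m c
  β = p V.[ i ]≔ x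
  flat : ∀ {k} → lookup p k ≡ c
  flat {k} = VP.lookup-replicate k c
  coords : ∀ k → lookup (swap β j i) k ≡ lookup (p V.[ j ]≔ x) k
  coords k with k FP.≟ j
  ... | yes refl = trans (lookup-swapˡ β k i) (trans (VP.lookup∘updateAt i p) (sym (VP.lookup∘updateAt k p)))
  ... | no k≢j with k FP.≟ i
  ...   | yes refl = trans (lookup-swapʳ β j k) (trans (VP.lookup∘updateAt′ j k (i≢j ∘ sym) p)
            (trans flat (sym (trans (VP.lookup∘updateAt′ k j i≢j p) flat))))
  ...   | no k≢i = trans (lookup-swap-≢ β j i k≢j k≢i) (trans (VP.lookup∘updateAt′ k i k≢i p) (sym (VP.lookup∘updateAt′ k j k≢j p)))

-- The centre is (c + 1,…,c + 1).
record Roots {m} (A : Vec ℕ m → Set) (c : ℕ) : Set where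
  private
    p : Vec ℕ m
    p = V.replicate m (suc c)
  field
    centre : A p
    up : ∀ i → A (p V.[ i ]≔ suc (suc c))
    down : ∀ i → A (p V.[ i ]≔ c)
    move : ∀ i j → i ≢ j → A ((p V.[ i ]≔ suc (suc c)) V.[ j ]≔ c)

module _ {m} {A : Vec ℕ m → Set} {c : ℕ} (roots : Roots A c) where
  open Roots roots

  private
    p : Vec ℕ m
    p = V.replicate m (suc c)
    flat : ∀ k → lookup p k ≡ suc c
    flat k = VP.lookup-replicate k (suc c)
    distinct : ∀ {b : Fin m → Bool} {i j} → b i ≡ true → b j ≡ false → i ≢ j
    distinct bi bj refl = case trans (sym bi) bj of λ ()

  -- For tied coordinates, p + σ e_i is swapped to p + σ e_j. For a free coordinate j, the pair
  -- differing by e_j is p + e_i - e_j, p + e_i if σ = 1 and p - e_i, p - e_i + e_j if σ = -1.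
  root-spans : ∀ {σ} (d : Dir σ) b i → b i ≡ true → Spans A σ b (val (normal σ b) p ℚ.+ 1ℚ)
  root-spans plus b i bi = record { unit = refl ; pivot = i ; pivot∈ = bi ; on = β , up i , on-face
    ; free = free
    ; tied = λ j bj j≢ → β , up i , subst A (sym (swap-single (suc c) (suc (suc c)) i j (j≢ ∘ sym))) (up j) , on-face
        , λ e → ℕP.m≢1+m+n (suc c) (trans (sym (flat j)) (trans (sym (VP.lookup∘updateAt′ j i j≢ p)) (trans e (trans (VP.lookup∘updateAt i p) (cong {B = ℕ} (λ z → suc (suc z)) (sym (ℕP.+-identityʳ c))))))) }
    where
    N = normal (+ 1) b
    β = p V.[ i ]≔ suc (suc c)
    on-face : val N β ≡ val N p ℚ.+ 1ℚ
    on-face = trans (val-up N p i (cong suc (sym (flat i)))) (cong (val N p ℚ.+_) (normal-true (+ 1) b i bi))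
    free : ∀ j → b j ≡ false → ∃ λ α → A α × A (incr α j) × val N α ≡ val N p ℚ.+ 1ℚ
    free j bj = β V.[ j ]≔ c , move i j i≢j , subst A (sym restored) (up i)
      , trans (val-down N β j (sym βj)) (trans (cong₂ (λ x y → x ℚ.+ ℚ.- y) on-face (normal-false (+ 1) b j bj)) (ℚP.+-identityʳ _))
      where
      i≢j = distinct {b} bi bj
      βj : lookup β j ≡ suc c
      βj = trans (VP.lookup∘updateAt′ j i (i≢j ∘ sym) p) (flat j)
      restored : incr (β V.[ j ]≔ c) j ≡ β
      restored = trans (cong (λ x → (β V.[ j ]≔ c) V.[ j ]≔ suc x) (VP.lookup∘updateAt j β))
        (trans (VP.[]≔-idempotent β j) (trans (cong (β V.[ j ]≔_) (sym βj)) (VP.[]≔-lookup β j)))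
  root-spans minus b i bi = record { unit = refl ; pivot = i ; pivot∈ = bi ; on = β , down i , on-face
    ; free = free
    ; tied = λ j bj j≢ → β , down i , subst A (sym (swap-single (suc c) c i j (j≢ ∘ sym))) (down j) , on-face
        , λ e → ℕP.m≢1+m+n c (trans (sym (VP.lookup∘updateAt i p)) (trans (sym e) (trans (VP.lookup∘updateAt′ j i j≢ p) (trans (flat j) (cong suc (sym (ℕP.+-identityʳ c))))))) }
    where
    N = normal -1ℤ b
    β = p V.[ i ]≔ c
    on-face : val N β ≡ val N p ℚ.+ 1ℚ
    on-face = trans (val-down N p i (sym (flat i))) (cong (λ x → val N p ℚ.+ ℚ.- x) (normal-true -1ℤ b i bi))
    free : ∀ j → b j ≡ false → ∃ λ α → A α × A (incr α j) × val N α ≡ val N p ℚ.+ 1ℚ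
    free j bj = β , down i , subst A moved (move j i (i≢j ∘ sym)) , on-face
      where
      i≢j = distinct {b} bi bj
      moved : (p V.[ j ]≔ suc (suc c)) V.[ i ]≔ c ≡ incr β j
      moved = trans (VP.[]≔-commutes p j i (i≢j ∘ sym)) (cong (λ x → β V.[ j ]≔ suc x) (sym (trans (VP.lookup∘updateAt′ j i (i≢j ∘ sym) p) (flat j))))

  Covered : Pt m → ℚ → Set
  Covered ℓ v = ∃ λ σ → Dir σ × ∃ λ b → ∃ λ i → b i ≡ true ×
          (∀ α → A α → val (normal σ b) α ℚ.≤ val (normal σ b) p ℚ.+ 1ℚ) ×
          (∀ α → A α → val ℓ α ≡ v → val (normal σ b) α ≡ val (normal σ b) p ℚ.+ 1ℚ)

  covered : ∀ {ℓ v σ} (d : Dir σ) b i Y → b i ≡ true → Next d (nsum b p) Y → (∀ α → A α → nsum b α ≤[ d ] Y) →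
    (∀ α → A α → val ℓ α ≡ v → nsum b α ≡ Y) → Covered ℓ v
  covered {σ = σ} d b i Y bi next bound tight = σ , d , b , i , bi
    , (λ α a → subst₂ ℚ._≤_ (sym (val-normal σ b α)) (sym level-Y) (fromℤ-mono-≤ (dir-≤ d (bound α a))))
    , λ α a e → trans (val-normal σ b α) (trans (cong (λ y → fromℤ (σ ℤ.* + y)) (tight α a e)) (sym level-Y))
    where
    level-Y : val (normal σ b) p ℚ.+ 1ℚ ≡ fromℤ (σ ℤ.* + Y)
    level-Y = trans (cong (ℚ._+ 1ℚ) (val-normal σ b p)) (trans (sym (fromℤ-+ (σ ℤ.* + nsum b p) (+ 1))) (cong fromℤ (next-dir d next)))

  covered-reflexive : (∀ ℓ v → (∀ α → A α → val ℓ α ℚ.≤ v) → ∃ (λ q → Hull A q × dot ℓ q ℚ.< v) → Covered ℓ v) →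
    IsReflexive (Hull A)
  covered-reflexive h = cover-reflexive {p = p} (record
    { centre = centre ; up = λ i → subst (λ x → A (p V.[ i ]≔ suc x)) (sym (flat i)) (up i)
    ; down = λ i → c , sym (flat i) , down i
    ; spans = root-spans ; cover = h })

update-bounded : ∀ {m} {u x} (α : Vec ℕ m) i → (∀ k → lookup α k ≤ u) → x ≤ u → ∀ k → lookup (α V.[ i ]≔ x) k ≤ u
update-bounded {u = u} α i h x≤ k with k FP.≟ i
... | yes refl = subst (_≤ u) (sym (VP.lookup∘updateAt k α)) x≤
... | no k≢i = subst (_≤ u) (sym (VP.lookup∘updateAt′ k i k≢i α)) (h k)

ℚ-contradiction : ∀ {x y} → 0ℚ ℚ.< y → ¬ (x ℚ.+ y ℚ.≤ x)
ℚ-contradiction {x} 0<y le = ℚP.<-irrefl refl (ℚP.<-≤-trans 0<y (+-cancel-≤0 x le))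

-- Exchange arguments: a unit step or a unit transfer that increases ℓ must lead from a maximising
-- exponent out of `A`.
module Optimal {m} {A : Vec ℕ m → Set} {ℓ : Pt m} {v : ℚ} (max : ∀ α → A α → val ℓ α ℚ.≤ v) where

  no-up : ∀ α i → val ℓ α ≡ v → 0ℚ ℚ.< lookup ℓ i → ¬ A (incr α i)
  no-up α i e pos a = ℚ-contradiction pos (subst₂ ℚ._≤_ (val-up ℓ α i refl) (sym e) (max (incr α i) a))

  no-down : ∀ α i {x} → lookup α i ≡ suc x → val ℓ α ≡ v → lookup ℓ i ℚ.< 0ℚ → ¬ A (α V.[ i ]≔ x)
  no-down α i {x} eq e neg a = ℚ-contradiction {val ℓ α} (ℚP.neg-antimono-< neg)
    (subst₂ ℚ._≤_ (val-down ℓ α i (sym eq)) (sym e) (max (α V.[ i ]≔ x) a))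

  no-move : ∀ α i k {x} → lookup α k ≡ suc x → val ℓ α ≡ v → lookup ℓ k ℚ.< lookup ℓ i → ¬ A (incr α i V.[ k ]≔ x)
  no-move α i k {x} eq e k<i a = ℚ-contradiction {val ℓ α}
      (subst (ℚ._< lookup ℓ i ℚ.+ ℚ.- lookup ℓ k) (ℚP.+-inverseʳ (lookup ℓ k)) (ℚP.+-monoˡ-< (ℚ.- lookup ℓ k) k<i))
      (subst₂ ℚ._≤_ (trans (val-down ℓ (incr α i) k (sym at-k)) (trans (cong (ℚ._+ ℚ.- lookup ℓ k) (val-up ℓ α i refl)) (ℚP.+-assoc (val ℓ α) _ _)))
        (sym e) (max _ a))
    where
    at-k : lookup (incr α i) k ≡ suc x
    at-k = trans (VP.lookup∘updateAt′ k i (λ { refl → ℚP.<-irrefl refl k<i }) α) eq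

-- The polytopes {x : 0 ≤ x_i ≤ c + 2, L ≤ Σ x_i ≤ U} with centre (c + 1, …, c + 1).
module Box {n} (A : Vec ℕ (suc n) → Set) (c L U : ℕ)
  (into : ∀ α → (∀ i → lookup α i ≤ suc (suc c)) → L ≤ size α → size α ≤ U → A α)
  (out : ∀ α → A α → (∀ i → lookup α i ≤ suc (suc c)) × L ≤ size α × size α ≤ U)
  -- `centre-size` puts Σ x = L at distance one from the centre, and `top` does the same for Σ x = U
  -- unless U is the trivial bound of the box. In `kind`, either x_i = 0 is at distance one because
  -- c = 0, or L = n (c + 2) makes x_i ≥ 0 a consequence of the other inequalities.
  (centre-size : suc n * suc c ≡ suc L)
  (top : U ≡ suc n * suc (suc c) ⊎ U ≡ suc (suc n * suc c))
  (kind : (c ≡ 0 × U ≡ suc n * suc (suc c)) ⊎ L ≡ n * suc (suc c)) where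

  private
    m u : ℕ
    m = suc n
    u = suc (suc c)
    p : Vec ℕ m
    p = V.replicate m (suc c)

    p-size : size p ≡ suc L
    p-size = trans (size-replicate m (suc c)) centre-size

    flat : ∀ i → lookup p i ≡ suc c
    flat i = VP.lookup-replicate i (suc c)

    p≤u : ∀ i → lookup p i ≤ u
    p≤u i = subst (_≤ u) (sym (flat i)) (ℕP.n≤1+n (suc c))

    L+2≤U : suc (suc L) ≤ U
    L+2≤U = subst (_≤ U) (cong suc centre-size) (bound top)
      where
      bound : U ≡ m * u ⊎ U ≡ suc (m * suc c) → suc (m * suc c) ≤ U
      bound (inj₁ U≡) = subst (suc (m * suc c) ≤_) (sym (trans U≡ (ℕP.*-suc m (suc c)))) (s≤s (ℕP.m≤n+m (m * suc c) n))
      bound (inj₂ U≡) = ℕP.≤-reflexive (sym U≡)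

    up-size : ∀ i → size (p V.[ i ]≔ u) ≡ suc (suc L)
    up-size i = ℕP.+-cancelʳ-≡ (suc c) _ _ (trans (cong (λ z → size (p V.[ i ]≔ u) + z) (sym (flat i)))
      (trans (size-update p i u) (trans (cong (_+ u) p-size) (ℕP.+-suc (suc L) (suc c)))))

    roots : Roots A c
    roots = record
      { centre = into p p≤u (subst (L ≤_) (sym p-size) (ℕP.n≤1+n L)) (subst (_≤ U) (sym p-size) (ℕP.≤-trans (ℕP.n≤1+n (suc L)) L+2≤U))
      ; up = λ i → into _ (update-bounded p i p≤u ℕP.≤-refl) (subst (L ≤_) (sym (up-size i)) (ℕP.≤-trans (ℕP.n≤1+n L) (ℕP.n≤1+n (suc L))))
          (subst (_≤ U) (sym (up-size i)) L+2≤U)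
      ; down = λ i → into _ (update-bounded p i p≤u c≤u) (ℕP.≤-reflexive (sym (down-size i)))
          (subst (_≤ U) (sym (down-size i)) (ℕP.≤-trans (ℕP.≤-trans (ℕP.n≤1+n L) (ℕP.n≤1+n (suc L))) L+2≤U))
      ; move = λ i j i≢j → into _ (update-bounded (p V.[ i ]≔ u) j (update-bounded p i p≤u ℕP.≤-refl) c≤u)
          (subst (L ≤_) (sym (move-size i j i≢j)) (ℕP.n≤1+n L))
          (subst (_≤ U) (sym (move-size i j i≢j)) (ℕP.≤-trans (ℕP.n≤1+n (suc L)) L+2≤U)) }
      where
      c≤u : c ≤ u
      c≤u = ℕP.≤-trans (ℕP.n≤1+n c) (ℕP.n≤1+n (suc c))
      down-size : ∀ i → size (p V.[ i ]≔ c) ≡ L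
      down-size i = ℕP.+-cancelʳ-≡ (suc c) _ _ (trans (cong (λ z → size (p V.[ i ]≔ c) + z) (sym (flat i)))
        (trans (size-update p i c) (trans (cong (_+ c) p-size) (sym (ℕP.+-suc L c)))))
      move-size : ∀ i j → i ≢ j → size ((p V.[ i ]≔ u) V.[ j ]≔ c) ≡ suc L
      move-size i j i≢j = ℕP.+-cancelʳ-≡ (suc c) _ _
        (trans (cong (λ z → size ((p V.[ i ]≔ u) V.[ j ]≔ c) + z) (sym (trans (VP.lookup∘updateAt′ j i (i≢j ∘ sym) p) (flat j))))
          (trans (size-update (p V.[ i ]≔ u) j c) (trans (cong (_+ c) (up-size i)) (sym (ℕP.+-suc (suc L) c)))))

    full : ∀ α → (∀ i → lookup α i ≤ u) → ∀ i → lookup α i < u → size α < m * u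
    full α h i lt = subst (size α <_) (size-replicate m u) (size-mono-< α (V.replicate m u)
      (λ j → subst (lookup α j ≤_) (sym (VP.lookup-replicate j u)) (h j)) i (subst (lookup α i <_) (sym (VP.lookup-replicate i u)) lt))

    find-small : ∀ α → size α < m * u → ∃ λ i → lookup α i < u
    find-small α lt with FP.any? (λ i → lookup α i <? u)
    ... | yes found = found
    ... | no none = ⊥-elim (ℕP.<⇒≱ lt (subst (_≤ size α) (size-replicate m u) (size-mono (V.replicate m u) α
            λ i → subst (_≤ lookup α i) (sym (VP.lookup-replicate i u)) (ℕP.≮⇒≥ λ q → none (i , q)))))

    find-positive : ∀ (α : Vec ℕ m) → 0 < size α → ∃ λ i → 0 < lookup α i
    find-positive α lt with FP.any? (λ i → 0 <? lookup α i)
    ... | yes found = found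
    ... | no none = ⊥-elim (ℕP.<⇒≱ lt (subst (size α ≤_) (trans (size-replicate m 0) (ℕP.*-zeroʳ m)) (size-mono α (V.replicate m 0)
            λ i → subst (lookup α i ≤_) (sym (VP.lookup-replicate i 0)) (ℕP.≮⇒≥ λ q → none (i , q)))))

    -- Compares α with the vertex of the box that is 0 at k and maximal elsewhere.
    gap : ∀ α → (∀ i → lookup α i ≤ u) → ∀ {i k} → i ≢ k → lookup α i < u → lookup α k ≡ 0 → size α < n * u
    gap α h {i} {k} i≢k αi αk = subst (size α <_) w-size (size-mono-< α w α≤w i (subst (lookup α i <_) (sym (w-other i≢k)) αi))
      where
      w : Vec ℕ m
      w = V.replicate m u V.[ k ]≔ 0
      w-other : ∀ {j} → j ≢ k → lookup w j ≡ u
      w-other {j} j≢k = trans (VP.lookup∘updateAt′ j k j≢k (V.replicate m u)) (VP.lookup-replicate j u)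
      w-size : size w ≡ n * u
      w-size = ℕP.+-cancelʳ-≡ u _ _ (trans (cong (λ z → size w + z) (sym (VP.lookup-replicate k u)))
        (trans (size-update (V.replicate m u) k 0) (trans (ℕP.+-identityʳ _) (trans (size-replicate m u) (ℕP.+-comm u (n * u))))))
      α≤w : ∀ j → lookup α j ≤ lookup w j
      α≤w j with j FP.≟ k
      ... | yes refl = subst (_≤ lookup w j) (sym αk) z≤n
      ... | no j≢k = subst (lookup α j ≤_) (sym (w-other j≢k)) (h j)

    module Functional (ℓ : Pt m) (v : ℚ) (max : ∀ α → A α → val ℓ α ℚ.≤ v) where

      open Optimal {A = A} {ℓ} {v} max

      optimal-up : ∀ {α i} → A α → val ℓ α ≡ v → 0ℚ ℚ.< lookup ℓ i → lookup α i < u → U ≤ size α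
      optimal-up {α} {i} a e pos lt with U ℕP.≤? size α
      ... | yes p = p
      ... | no ¬p with out α a
      ...   | h , L≤ , _ = ⊥-elim (no-up α i e pos
                (into _ (update-bounded α i h lt) (subst (L ≤_) (sym s) (ℕP.m≤n⇒m≤1+n L≤)) (subst (_≤ U) (sym s) (ℕP.≰⇒> ¬p))))
        where
        s : size (incr α i) ≡ suc (size α)
        s = ℕP.+-cancelʳ-≡ (lookup α i) _ _ (trans (size-update α i _) (ℕP.+-suc (size α) (lookup α i)))

      optimal-down : ∀ {α i} → A α → val ℓ α ≡ v → lookup ℓ i ℚ.< 0ℚ → 0 < lookup α i → size α ≤ L
      optimal-down {α} {i} a e neg pos with size α ℕP.≤? L
      ... | yes p = p
      ... | no ¬p with out α a | lookup α i in eq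
      ...   | h , _ , ≤U | suc x = ⊥-elim (no-down α i eq e neg
                (into _ (update-bounded α i h (ℕP.≤-trans (ℕP.n≤1+n x) (subst (_≤ u) eq (h i))))
                  (s≤s⁻¹ (subst (suc L ≤_) s (ℕP.≰⇒> ¬p))) (ℕP.≤-trans (ℕP.n≤1+n _) (subst (_≤ U) s ≤U))))
        where
        s : size α ≡ suc (size (α V.[ i ]≔ x))
        s = ℕP.+-cancelʳ-≡ x _ _ (sym (trans (sym (ℕP.+-suc (size (α V.[ i ]≔ x)) x)) (trans (cong (λ z → size (α V.[ i ]≔ x) + z) (sym eq)) (size-update α i x))))

      optimal-move : ∀ {α i k} → A α → val ℓ α ≡ v → lookup ℓ k ℚ.< lookup ℓ i → lookup α i < u → lookup α k ≡ 0
      optimal-move {α} {i} {k} a e k<i lt with out α a | lookup α k in eq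
      ... | _ | zero = refl
      ... | h , L≤ , ≤U | suc x = ⊥-elim (no-move α i k eq e k<i
                (into γ (update-bounded β k (update-bounded α i h lt) (ℕP.≤-trans (ℕP.n≤1+n x) (subst (_≤ u) eq (h k))))
                  (subst (L ≤_) (sym s) L≤) (subst (_≤ U) (sym s) ≤U)))
        where
        β = incr α i
        γ = β V.[ k ]≔ x
        k≢i : k ≢ i
        k≢i refl = ℚP.<-irrefl refl k<i
        βk : lookup β k ≡ suc x
        βk = trans (VP.lookup∘updateAt′ k i k≢i α) eq
        s : size γ ≡ size α
        s = ℕP.+-cancelʳ-≡ (suc x) _ _ (trans (cong (λ z → size γ + z) (sym βk)) (trans (size-update β k x)
          (trans (cong (_+ x) (ℕP.+-cancelʳ-≡ (lookup α i) _ _ (trans (size-update α i _) (ℕP.+-suc (size α) (lookup α i))))) (sym (ℕP.+-suc (size α) x)))))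

      Cov : Set
      Cov = Covered {A = A} roots ℓ v

      by-top : ∀ i → (∀ α → A α → val ℓ α ≡ v → ¬ lookup α i < u) → Cov
      by-top i h = covered roots {ℓ} {v} plus (is i) i u (is-refl i) (cong suc (trans (nsum-is i p) (flat i)))
        (λ α a → subst (_≤ u) (sym (nsum-is i α)) (proj₁ (out α a) i))
        λ α a e → trans (nsum-is i α) (ℕP.≤-antisym (proj₁ (out α a) i) (ℕP.≮⇒≥ (h α a e)))

      by-bottom : c ≡ 0 → ∀ i → (∀ α → A α → val ℓ α ≡ v → ¬ 0 < lookup α i) → Cov
      by-bottom c≡0 i h = covered roots {ℓ} {v} minus (is i) i 0 (is-refl i) (trans (nsum-is i p) (trans (flat i) (cong suc c≡0)))
        (λ α a → z≤n) λ α a e → trans (nsum-is i α) (ℕP.n≤0⇒n≡0 (ℕP.≮⇒≥ (h α a e)))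

      size-nsum : ∀ (α : Vec ℕ m) → nsum all α ≡ size α
      size-nsum α = trans (nsum-all α) (sym (size-sumTo α))

      by-low : (∀ α → A α → val ℓ α ≡ v → ¬ L < size α) → Cov
      by-low h = covered roots {ℓ} {v} minus all zero L refl (trans (size-nsum p) p-size)
        (λ α a → subst (L ≤_) (sym (size-nsum α)) (proj₁ (proj₂ (out α a))))
        λ α a e → trans (size-nsum α) (ℕP.≤-antisym (ℕP.≮⇒≥ (h α a e)) (proj₁ (proj₂ (out α a))))

      by-high : U ≡ suc (m * suc c) → (∀ α → A α → val ℓ α ≡ v → ¬ size α < U) → Cov
      by-high U≡ h = covered roots {ℓ} {v} plus all zero U refl (trans (cong suc (trans (size-nsum p) (size-replicate m (suc c)))) (sym U≡))
        (λ α a → subst (_≤ U) (sym (size-nsum α)) (proj₂ (proj₂ (out α a))))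
        λ α a e → trans (size-nsum α) (ℕP.≤-antisym (proj₂ (proj₂ (out α a))) (ℕP.≮⇒≥ (h α a e)))

      U≤ : U ≤ m * u
      U≤ = bound top
        where
        bound : U ≡ m * u ⊎ U ≡ suc (m * suc c) → U ≤ m * u
        bound (inj₁ U≡) = ℕP.≤-reflexive U≡
        bound (inj₂ U≡) = subst₂ _≤_ (sym U≡) (sym (ℕP.*-suc m (suc c))) (s≤s (ℕP.m≤n+m (m * suc c) n))

      constant-cover : ∀ t → (∀ j → lookup ℓ j ≡ t) → ∃ (λ q → Hull A q × dot ℓ q ℚ.< v) → Cov
      constant-cover t ℓ≡t (q , q∈ , lt) with ℚP.<-cmp t 0ℚ
      -- For ℓ = 0 properness leaves no maximising exponent at all, so any of the possible covering
      -- faces serves.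
      ... | tri≈ _ t≡0 _ = by-low λ α a e _ → ℚP.<-irrefl (trans (vanish q) (sym (trans (sym e) (vanish (ofℕ α))))) lt
        where
        vanish : ∀ q → dot ℓ q ≡ 0ℚ
        vanish q = trans (cong (λ z → dot z q) (vec-ext {u = ℓ} {V.replicate m 0ℚ} λ j → trans (ℓ≡t j) (trans t≡0 (sym (VP.lookup-replicate j 0ℚ))))) (dot-zeroˡ q)
      ... | tri< t<0 _ _ = by-low λ α a e L< → let i , pos = find-positive α (ℕP.≤-<-trans z≤n L<) in
              ℕP.<⇒≱ L< (optimal-down {α} {i} a e (subst (ℚ._< 0ℚ) (sym (ℓ≡t i)) t<0) pos)
      ... | tri> _ _ t>0 = by-kind top
        where
        by-kind : U ≡ m * u ⊎ U ≡ suc (m * suc c) → Cov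
        by-kind (inj₁ U≡) = by-top zero λ α a e lt′ → ℕP.<⇒≱ (full α (proj₁ (out α a)) zero lt′)
          (subst (_≤ size α) U≡ (optimal-up {α} {zero} a e (subst (0ℚ ℚ.<_) (sym (ℓ≡t zero)) t>0) lt′))
        by-kind (inj₂ U≡) = by-high U≡ λ α a e lt′ → let i , small = find-small α (ℕP.<-≤-trans lt′ U≤) in
          ℕP.<⇒≱ lt′ (optimal-up {α} {i} a e (subst (0ℚ ℚ.<_) (sym (ℓ≡t i)) t>0) small)

      -- w is the largest lattice point of the box supported off the minimum of ℓ.
      spread-cover : ∀ i k → (∀ j → lookup ℓ k ℚ.≤ lookup ℓ j) → lookup ℓ k ℚ.< lookup ℓ i → Cov
      spread-cover i k min k<i = by-kind kind (0ℚ ℚP.<? lookup ℓ i)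
        where
        weight-at : Fin m → ℕ
        weight-at j with lookup ℓ k ℚP.<? lookup ℓ j
        ... | yes _ = u
        ... | no _ = 0
        w : Vec ℕ m
        w = V.tabulate weight-at
        w≡ : ∀ j → lookup w j ≡ weight-at j
        w≡ = VP.lookup∘tabulate weight-at
        -- If |w| < L, an optimal point with x_i < 2 would be 0 wherever ℓ is minimal, hence lie
        -- below w and have too small a sum. If |w| ≥ L, an optimal point with x_k > 0 would be 2
        -- wherever ℓ is not minimal, hence have sum greater than L although x_k can be lowered.
        by-weight : c ≡ 0 → lookup ℓ k ℚ.< 0ℚ → Dec (size w < L) → Cov
        by-weight c≡0 neg (yes w<L) = by-top i λ α a e lt → ℕP.<⇒≱ w<L (ℕP.≤-trans (proj₁ (proj₂ (out α a))) (size-mono α w λ j → subst (lookup α j ≤_) (sym (w≡ j)) (below α a e lt j)))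
          where
          below : ∀ α → A α → val ℓ α ≡ v → lookup α i < u → ∀ j → lookup α j ≤ weight-at j
          below α a e lt j with lookup ℓ k ℚP.<? lookup ℓ j
          ... | yes _ = proj₁ (out α a) j
          ... | no k≮j = ℕP.≤-reflexive (optimal-move {α} {i} {j} a e (ℚP.≤-<-trans (ℚP.≮⇒≥ k≮j) k<i) lt)
        by-weight c≡0 neg (no w≮L) = by-bottom c≡0 k λ α a e pos → w≮L (ℕP.<-≤-trans
            (size-mono-< w α (λ j → subst (_≤ lookup α j) (sym (w≡ j)) (above α a e pos j)) k (subst (_< lookup α k) (sym (trans (w≡ k) at-k)) pos))
            (optimal-down {α} {k} a e neg pos))
          where
          at-k : weight-at k ≡ 0
          at-k with lookup ℓ k ℚP.<? lookup ℓ k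
          ... | yes k<k = ⊥-elim (ℚP.<-irrefl refl k<k)
          ... | no _ = refl
          above : ∀ α → A α → val ℓ α ≡ v → 0 < lookup α k → ∀ j → weight-at j ≤ lookup α j
          above α a e pos j with lookup ℓ k ℚP.<? lookup ℓ j
          ... | no _ = z≤n
          ... | yes k<j with lookup α j <? u
          ...   | yes lt = ⊥-elim (ℕP.<⇒≢ pos (sym (optimal-move {α} {j} {k} a e k<j lt)))
          ...   | no ≮u = ℕP.≮⇒≥ ≮u

        by-kind : (c ≡ 0 × U ≡ m * u) ⊎ L ≡ n * u → Dec (0ℚ ℚ.< lookup ℓ i) → Cov
        -- If x_i < c + 2 at an optimal point, the exchange forces x_k = 0, and these two
        -- coordinates bring the sum below L = n (c + 2).
        by-kind (inj₂ L≡) _ = by-top i λ α a e lt → ℕP.<⇒≱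
          (gap α (proj₁ (out α a)) (λ { refl → ℚP.<-irrefl refl k<i }) lt (optimal-move {α} a e k<i lt))
          (subst (_≤ size α) L≡ (proj₁ (proj₂ (out α a))))
        by-kind (inj₁ (c≡0 , U≡)) (yes pos) = by-top i λ α a e lt →
          ℕP.<⇒≱ (full α (proj₁ (out α a)) i lt) (subst (_≤ size α) U≡ (optimal-up {α} {i} a e pos lt))
        by-kind (inj₁ (c≡0 , U≡)) (no npos) = by-weight c≡0 (ℚP.<-≤-trans k<i (ℚP.≮⇒≥ npos)) (size w ℕP.<? L)

      cov : ∃ (λ q → Hull A q × dot ℓ q ℚ.< v) → Cov
      cov proper with argmax ℓ | argmin ℓ
      ... | i , max-i | k , min-k with lookup ℓ k ℚP.<? lookup ℓ i
      ...   | yes k<i = spread-cover i k min-k k<i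
      ...   | no k≮i = constant-cover (lookup ℓ k) (λ j → ℚP.≤-antisym (ℚP.≤-trans (max-i j) (ℚP.≮⇒≥ k≮i)) (min-k j)) proper

  box-reflexive : IsReflexive (Hull A)
  box-reflexive = covered-reflexive roots λ ℓ v max proper → Functional.cov ℓ v max proper

-- Boxes with size bounds as Newton polytopes of G.

greedy-sum : ∀ u N k → sumTo (λ j → u ⊓ (N ∸ j * u)) k ≡ (k * u) ⊓ N
greedy-sum u N zero = refl
greedy-sum u N (suc k) = trans (cong (_+ (u ⊓ (N ∸ k * u))) (greedy-sum u N k)) (step (ℕP.≤-total (k * u) N))
  where
  step : k * u ≤ N ⊎ N ≤ k * u → (k * u) ⊓ N + (u ⊓ (N ∸ k * u)) ≡ (u + k * u) ⊓ N
  step (inj₁ p) = trans (cong (_+ (u ⊓ (N ∸ k * u))) (ℕP.m≤n⇒m⊓n≡m p))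
    (trans (ℕP.+-distribˡ-⊓ (k * u) u (N ∸ k * u)) (cong₂ _⊓_ (ℕP.+-comm (k * u) u) (ℕP.m+[n∸m]≡n p)))
  step (inj₂ p) = trans (cong₂ (λ x y → x + (u ⊓ y)) (ℕP.m≥n⇒m⊓n≡n p) (ℕP.m≤n⇒m∸n≡0 p))
    (trans (cong (λ z → N + z) (ℕP.⊓-zeroʳ u)) (trans (ℕP.+-identityʳ N) (sym (ℕP.m≥n⇒m⊓n≡n (ℕP.≤-trans p (ℕP.m≤n+m (k * u) u))))))

-- u ⊓ (N ∸ j * u) boxes in row j: N boxes fill the rows one after the other, u boxes per row.
greedy-dominates : ∀ {m u N} (α : Vec ℕ m) → (∀ i → at α i ≤ u) → sumTo (at α) m ≡ N →
  (μ : Vec ℕ m) → (∀ j → j < m → at μ j ≡ u ⊓ (N ∸ j * u)) →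
  Dom m (at α) 0 (sumTo (at μ)) × sumTo (at α) m ≡ sumTo (at μ) m
greedy-dominates {m} {u} {N} α α≤u α-size μ μ≡ = Dom-threshold m threshold
    , trans α-size (sym (trans (partial m ℕP.≤-refl) (ℕP.m≥n⇒m⊓n≡n (subst₂ _≤_ α-size (sumTo-const u m) (sumTo-mono m λ i _ → α≤u i)))))
  where
  partial : ∀ k → k ≤ m → sumTo (at μ) k ≡ (k * u) ⊓ N
  partial k k≤m = trans (sumTo-cong k λ j j<k → μ≡ j (ℕP.<-≤-trans j<k k≤m)) (greedy-sum u N k)
  threshold : ∀ j → j ≤ m → ∃ λ c → j * c + sumTo (λ i → at α i ∸ c) m ≤ sumTo (at μ) j
  -- Either the j rows considered are full, which is the threshold u, or they already contain all N
  -- boxes, which is the threshold 0.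
  threshold j j≤m with ℕP.≤-total (j * u) N
  ... | inj₁ p = u , ℕP.≤-reflexive (trans (cong (λ z → j * u + z) (sumTo-0 m λ i _ → ℕP.m≤n⇒m∸n≡0 (α≤u i)))
          (trans (ℕP.+-identityʳ _) (sym (trans (partial j j≤m) (ℕP.m≤n⇒m⊓n≡m p)))))
  ... | inj₂ p = 0 , ℕP.≤-reflexive (trans (cong (_+ sumTo (at α) m) (ℕP.*-zeroʳ j)) (trans α-size (sym (trans (partial j j≤m) (ℕP.m≥n⇒m⊓n≡n p)))))

at-bounded : ∀ {m u} (α : Vec ℕ m) → (∀ i → lookup α i ≤ u) → ∀ i → at α i ≤ u
at-bounded [] h i = z≤n
at-bounded (x ∷ α) h zero = h zero
at-bounded (x ∷ α) h (suc i) = at-bounded α (h ∘ suc) i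

-- λ itself is the greedy shape of size L, and `fits` makes the greedy shapes of all sizes up to U
-- admissible. Every lattice point of the box is dominated by the greedy shape of its own size, so
-- one shape per size suffices.
module BoxShape {n h} {lam : Vec ℕ (suc n)} (c L U : ℕ)
  (lam≡ : ∀ j → j < suc n → at lam j ≡ suc (suc c) ⊓ (L ∸ j * suc (suc c)))
  (L≤ : L ≤ suc n * suc (suc c))
  (fits : ∀ N → N ≤ U → ∀ j → j < suc n → suc (suc c) ⊓ (N ∸ j * suc (suc c)) ≤ at lam j + h * j)
  (size-bound : ∀ μ → Admissible h lam μ → (∀ j → at μ j ≤ suc (suc c)) → sumTo (at μ) (suc n) ≤ U) where

  private
    m u : ℕ
    m = suc n
    u = suc (suc c)

  greedy-admissible : ∀ N → L ≤ N → N ≤ U → ∃ λ (μ : Vec ℕ m) → Admissible h lam μ × (∀ j → j < m → at μ j ≡ u ⊓ (N ∸ j * u))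
  greedy-admissible N L≤N N≤U = μ , record { decreasing = dec ; lower = low ; upper = upp } , μ≡
    where
    g : ℕ → ℕ
    g j = u ⊓ (N ∸ j * u)
    μ : Vec ℕ m
    μ = V.tabulate (g ∘ toℕ)
    μ≡ : ∀ j → j < m → at μ j ≡ g j
    μ≡ j = atD-tabulate 0 g m
    dec : ∀ i → at μ (suc i) ≤ at μ i
    dec i with suc i <? m
    ... | no i≮ = subst (_≤ at μ i) (sym (atD-≥ 0 μ (ℕP.≮⇒≥ i≮))) z≤n
    ... | yes i< = subst₂ _≤_ (sym (μ≡ (suc i) i<)) (sym (μ≡ i (ℕP.<-trans (ℕP.n<1+n i) i<)))
            (ℕP.⊓-monoʳ-≤ u (ℕP.∸-monoʳ-≤ N (ℕP.m≤n+m (i * u) u)))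
    low : ∀ i → at lam i ≤ at μ i
    low i with i <? m
    ... | no i≮ = subst (_≤ at μ i) (sym (atD-≥ 0 lam (ℕP.≮⇒≥ i≮))) z≤n
    ... | yes i< = subst₂ _≤_ (sym (lam≡ i i<)) (sym (μ≡ i i<)) (ℕP.⊓-monoʳ-≤ u (ℕP.∸-monoˡ-≤ (i * u) L≤N))
    upp : ∀ i → at μ i ≤ at lam i + h * i
    upp i with i <? m
    ... | no i≮ = subst (_≤ at lam i + h * i) (sym (atD-≥ 0 μ (ℕP.≮⇒≥ i≮))) z≤n
    ... | yes i< = subst (_≤ at lam i + h * i) (sym (μ≡ i i<)) (fits N N≤U i i<)

  box-into : 1 ≤ h → ∀ α → (∀ i → lookup α i ≤ u) → L ≤ size α → size α ≤ U → InG h lam α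
  box-into 1≤h α α≤u L≤α α≤U with greedy-admissible (size α) L≤α α≤U
  ... | μ , adm , μ≡ with greedy-dominates {N = size α} α (at-bounded α α≤u) (sym (size-sumTo α)) μ μ≡
  ...   | dom , tot = InG-dominated {h = h} {lam} {α} {μ} 1≤h adm dom tot

  lam-size : sumTo (at lam) m ≡ L
  lam-size = trans (sumTo-cong m lam≡) (trans (greedy-sum u L m) (ℕP.m≥n⇒m⊓n≡n L≤))

  box-out : ∀ α → InG h lam α → (∀ i → lookup α i ≤ u) × L ≤ size α × size α ≤ U
  box-out α a = (λ i → subst (_≤ u) (atD-lookup 0 α i) (ℕP.≤-trans (bounded (toℕ i)) λ0≤u))
    , subst₂ _≤_ lam-size (sym (trans (size-sumTo α) same-size)) (sumTo-mono m λ i _ → lower i)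
    , subst (_≤ U) (sym (trans (size-sumTo α) same-size)) (size-bound shape admissible λ j → ℕP.≤-trans (antitone decreasing z≤n)
        (ℕP.≤-trans (upper 0) (subst (_≤ u) (sym (trans (cong (λ z → at lam 0 + z) (ℕP.*-zeroʳ h)) (ℕP.+-identityʳ _))) λ0≤u)))
    where
    w : Witness h lam α
    w = InG-witness {h = h} {lam} {α} a
    open Witness w
    open Admissible admissible
    λ0≤u : at lam 0 ≤ u
    λ0≤u = subst (_≤ u) (sym (lam≡ 0 z<s)) (ℕP.m⊓n≤m u _)

-- λ = (2,…,2,0,…,0) or (2,…,2,1,0,…,0): the cube [0,2]^m cut by Σ x ≥ m - 1.
cube-reflexive : ∀ {n h} {lam : Vec ℕ (suc n)} → 1 ≤ h →
  (∀ j → j < suc n → at lam j ≡ 2 ⊓ (n ∸ j * 2)) → (∀ j → j < suc n → 2 ≤ at lam j + h * j) →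
  IsReflexive (NewtG h lam)
cube-reflexive {n} {h} {lam} 1≤h lam≡ fits = Box.box-reflexive (InG h lam) 0 n (suc n * 2) (S.box-into 1≤h) S.box-out
    (ℕP.*-identityʳ (suc n)) (inj₁ refl) (inj₁ (refl , refl))
  where
  module S = BoxShape {n} {h} {lam} 0 n (suc n * 2) lam≡
    (ℕP.≤-trans (ℕP.n≤1+n n) (ℕP.m≤m*n (suc n) 2))
    (λ N _ j j< → ℕP.≤-trans (ℕP.m⊓n≤m 2 _) (fits j j<))
    (λ μ _ μ≤ → subst (sumTo (at μ) (suc n) ≤_) (sumTo-const 2 (suc n)) (sumTo-mono (suc n) λ j _ → μ≤ j))

-- λ = (m+1,…,m+1,0): in the coordinates m + 1 - x_i, a simplex or a simplex cut by Σ ≥ m - 1.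
simplex-reflexive : ∀ {n h} {lam : Vec ℕ (suc n)} → 1 ≤ h →
  (∀ j → j < n → at lam j ≡ suc (suc n)) → at lam n ≡ 0 → suc (suc n) ≤ h * n ⊎ h * n ≡ 2 →
  IsReflexive (NewtG h lam)
simplex-reflexive {n} {h} {lam} 1≤h lam-u lam-0 room = Box.box-reflexive (InG h lam) n L U (S.box-into 1≤h) S.box-out
    (square n) (top room) (inj₂ refl)
  where
  u L U : ℕ
  u = suc (suc n)
  L = n * u
  -- The rows before the last one are full already in λ; the last takes at most h n boxes, and at
  -- most u in a partition. For h n ≥ u this is the trivial bound of the box; for h n = 2 it is n (n
  -- + 2) + 2 = (n + 1)² + 1, one more than the sum at the centre.
  U = L + (u ⊓ (h * n))
  square : ∀ n → suc n * suc n ≡ suc (n * suc (suc n))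
  square = solve-∀
  top : u ≤ h * n ⊎ h * n ≡ 2 → U ≡ suc n * u ⊎ U ≡ suc (suc n * suc n)
  top (inj₁ p) = inj₁ (trans (cong (λ z → L + z) (ℕP.m≤n⇒m⊓n≡m p)) (ℕP.+-comm L u))
  top (inj₂ e) = inj₂ (trans (cong (λ z → L + (u ⊓ z)) e) (trans (cong (λ z → L + suc (suc z)) (ℕP.⊓-zeroʳ n)) (trans (ℕP.+-comm L 2) (cong suc (sym (square n))))))
  lam≡ : ∀ j → j < suc n → at lam j ≡ u ⊓ (L ∸ j * u)
  lam≡ j j< with j <? n
  ... | yes p = trans (lam-u j p) (sym (ℕP.m≤n⇒m⊓n≡m (ℕP.m+n≤o⇒m≤o∸n u (ℕP.*-monoˡ-≤ u p))))
  ... | no ¬p with ℕP.≤-antisym (s≤s⁻¹ j<) (ℕP.≮⇒≥ ¬p)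
  ...   | refl = trans lam-0 (sym (trans (cong (u ⊓_) (ℕP.n∸n≡0 (n * u))) (ℕP.⊓-zeroʳ u)))
  fits : ∀ N → N ≤ U → ∀ j → j < suc n → u ⊓ (N ∸ j * u) ≤ at lam j + h * j
  fits N N≤U j j< with j <? n
  ... | yes p = ℕP.≤-trans (ℕP.m⊓n≤m u _) (subst (λ z → u ≤ z + h * j) (sym (lam-u j p)) (ℕP.m≤m+n u _))
  ... | no ¬p with ℕP.≤-antisym (s≤s⁻¹ j<) (ℕP.≮⇒≥ ¬p)
  ...   | refl = ℕP.≤-trans (ℕP.m⊓n≤n u _) (ℕP.≤-trans (ℕP.∸-monoˡ-≤ L N≤U) (ℕP.≤-trans (ℕP.≤-reflexive (ℕP.m+n∸m≡n L _))
            (ℕP.≤-trans (ℕP.m⊓n≤n u (h * n)) (ℕP.m≤n+m _ _))))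
  size-bound : ∀ μ → Admissible h lam μ → (∀ j → at μ j ≤ u) → sumTo (at μ) (suc n) ≤ U
  size-bound μ adm μ≤ = ℕP.+-mono-≤ (subst (sumTo (at μ) n ≤_) (sumTo-const u n) (sumTo-mono n λ j _ → μ≤ j))
    (ℕP.⊓-glb (μ≤ n) (subst (λ z → at μ n ≤ z + h * n) lam-0 (Admissible.upper adm n)))
  module S = BoxShape {n} {h} {lam} n L U lam≡ (ℕP.m≤n+m L u) fits size-bound

-- The case h = 1, λ = (2,0,0), where moreover x_i + x_j ≤ 3: a finite check.
module Exceptional where

  private
    lam₀ : Vec ℕ 3
    lam₀ = 2 ∷ 0 ∷ 0 ∷ []

    others : Fin 3 → Fin 3 → Bool
    others k j = not (is k j)

    -- The admissible shapes are (2), (2,1) and (2,1,1), as the second row can gain only one box.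
    -- The largest of them gives Σ x ≤ 4 and x_i + x_j ≤ 3.
    inside : Vec ℕ 3 → Bool
    inside α = allV (_≤ᵇ 2) α ∧ (2 ≤ᵇ size α) ∧ (size α ≤ᵇ 4) ∧ allV (λ k → nsum (others k) α ≤ᵇ 3) (V.allFin 3)

    cube : List (Vec ℕ 3)
    cube = prodL (V.replicate 3 (range 0 2))

    fins : List (Fin 3)
    fins = zero ∷ suc zero ∷ suc (suc zero) ∷ []

    fins-all : ∀ (i : Fin 3) → i ∈ fins
    fins-all zero = here refl
    fins-all (suc zero) = there (here refl)
    fins-all (suc (suc zero)) = there (there (here refl))

    ∈-cube : ∀ α → (∀ i → lookup α i ≤ 2) → α ∈ cube
    ∈-cube α h = ∈-prodL⁺ α (V.replicate 3 (range 0 2)) λ i → subst (lookup α i ∈_) (sym (VP.lookup-replicate i (range 0 2))) (∈-range⁺ z≤n (h i))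

    inside-≤2 : ∀ α → inside α ≡ true → ∀ i → lookup α i ≤ 2
    inside-≤2 α e i = ≤ᵇ⁻ (allV⁻ {p = _≤ᵇ 2} α (proj₁ (∧⁻ {allV (_≤ᵇ 2) α} e)) i)

    check₁ : (Fin 3 → Bool) → Bool
    check₁ f = allL f fins

    check₁⁻ : ∀ f → check₁ f ≡ true → ∀ i → f i ≡ true
    check₁⁻ f e i = allL⁻ {p = f} fins e (fins-all i)

    check₂ : (Fin 3 → Fin 3 → Bool) → Bool
    check₂ f = check₁ λ i → check₁ (f i)

    check₂⁻ : ∀ f → check₂ f ≡ true → ∀ i j → f i j ≡ true
    check₂⁻ f e i = check₁⁻ (f i) (check₁⁻ (λ i → check₁ (f i)) e i)

    p : Vec ℕ 3
    p = V.replicate 3 1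

  module Polytope (A : Vec ℕ 3 → Set) (A-inside : ∀ α → A α → inside α ≡ true) (inside-A : ∀ α → inside α ≡ true → A α) where

    A-cube : ∀ α → A α → α ∈ cube
    A-cube α a = ∈-cube α (inside-≤2 α (A-inside α a))

    roots : Roots A 0
    roots = record
      { centre = inside-A p refl
      ; up = λ i → inside-A _ (check₁⁻ (λ i → inside (p V.[ i ]≔ 2)) refl i)
      ; down = λ i → inside-A _ (check₁⁻ (λ i → inside (p V.[ i ]≔ 0)) refl i)
      ; move = λ i j i≢j → inside-A _ (unless (check₂⁻ (λ i j → is i j ∨ inside ((p V.[ i ]≔ 2) V.[ j ]≔ 0)) refl i j) i≢j) }
      where
      unless : ∀ {i j b} → is i j ∨ b ≡ true → i ≢ j → b ≡ true
      unless {i} {j} e i≢j with is i j in eq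
      ... | true = ⊥-elim (i≢j (is⁻ i j eq))
      ... | false = e

    canUp : Vec ℕ 3 → Fin 3 → Bool
    canUp α i = inside (incr α i)

    canDown : Vec ℕ 3 → Fin 3 → Bool
    canDown α i = (0 <ᵇ lookup α i) ∧ inside (α V.[ i ]≔ pred (lookup α i))

    canMove : Vec ℕ 3 → Fin 3 → Fin 3 → Bool
    canMove α i k = (0 <ᵇ lookup α k) ∧ inside (incr α i V.[ k ]≔ pred (lookup α k))

    ∨⁻ : ∀ a {b} → a ∨ b ≡ true → a ≡ true ⊎ b ≡ true
    ∨⁻ true _ = inj₁ refl
    ∨⁻ false e = inj₂ e

    Bound : (Vec ℕ 3 → Bool) → Set
    Bound f = allL (λ α → not (inside α) ∨ f α) cube ≡ true

    use-bound : ∀ f → Bound f → ∀ α → A α → f α ≡ true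
    use-bound f t α a with inside α | A-inside α a | allL⁻ {p = λ α → not (inside α) ∨ f α} cube t (A-cube α a)
    ... | true | _ | e = e

    -- Each table lists, for every lattice point, either membership in the covering face or an improving move.
    Table : (Vec ℕ 3 → Fin 3 → Fin 3 → Fin 3 → Bool) → Set
    Table f = Bound λ α → check₁ λ i → check₂ λ j k → is i j ∨ is i k ∨ is j k ∨ f α i j k

    use : ∀ f → Table f → ∀ α → A α → ∀ {i j k} → i ≢ j → i ≢ k → j ≢ k → f α i j k ≡ true
    use f t α a {i} {j} {k} i≢j i≢k j≢k = skip j≢k (skip i≢k (skip i≢j
        (check₂⁻ (λ j k → is i j ∨ is i k ∨ is j k ∨ f α i j k) (check₁⁻ (λ i → check₂ λ j k → is i j ∨ is i k ∨ is j k ∨ f α i j k)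
          (use-bound (λ α → check₁ λ i → check₂ λ j k → is i j ∨ is i k ∨ is j k ∨ f α i j k) t α a) i) j k)))
      where
      skip : ∀ {i j b} → i ≢ j → is i j ∨ b ≡ true → b ≡ true
      skip {i} {j} ne e with is i j in eq
      ... | true = ⊥-elim (ne (is⁻ i j eq))
      ... | false = e

    single pair total sum-low zero-low : Vec ℕ 3 → Fin 3 → Fin 3 → Fin 3 → Bool
    single α i j k = (lookup α i ≡ᵇ 2) ∨ canUp α i ∨ canMove α i j ∨ canMove α i k
    pair α i j k = (nsum (others k) α ≡ᵇ 3) ∨ canUp α i ∨ canUp α j ∨ canMove α i k ∨ canMove α j k
    total α i j k = (nsum all α ≡ᵇ 4) ∨ canUp α i ∨ canUp α j ∨ canUp α k
    sum-low α i j k = (nsum all α ≡ᵇ 2) ∨ canDown α i ∨ canDown α j ∨ canDown α k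
    zero-low α i j k = (lookup α k ≡ᵇ 0) ∨ canDown α k ∨ canMove α i k

    single-table : Table single
    single-table = refl
    pair-table : Table pair
    pair-table = refl
    total-table : Table total
    total-table = refl
    sum-low-table : Table sum-low
    sum-low-table = refl
    zero-low-table : Table zero-low
    zero-low-table = refl

    third : ∀ (i k : Fin 3) → i ≢ k → ∃ λ j → i ≢ j × j ≢ k
    third zero zero ne = ⊥-elim (ne refl)
    third zero (suc zero) _ = suc (suc zero) , (λ ()) , λ ()
    third zero (suc (suc zero)) _ = suc zero , (λ ()) , λ ()
    third (suc zero) zero _ = suc (suc zero) , (λ ()) , λ ()
    third (suc zero) (suc zero) ne = ⊥-elim (ne refl)
    third (suc zero) (suc (suc zero)) _ = zero , (λ ()) , λ ()
    third (suc (suc zero)) zero _ = suc zero , (λ ()) , λ ()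
    third (suc (suc zero)) (suc zero) _ = zero , (λ ()) , λ ()
    third (suc (suc zero)) (suc (suc zero)) ne = ⊥-elim (ne refl)

    module Functional (ℓ : Pt 3) (v : ℚ) (max : ∀ α → A α → val ℓ α ℚ.≤ v) where

      open Optimal {A = A} {ℓ} {v} max

      refute-up : ∀ {α i} → val ℓ α ≡ v → 0ℚ ℚ.< lookup ℓ i → ¬ canUp α i ≡ true
      refute-up {α} {i} e pos c = no-up α i e pos (inside-A (incr α i) c)

      predecessor : ∀ n → (0 <ᵇ n) ≡ true → n ≡ suc (pred n)
      predecessor (suc n) _ = refl

      refute-down : ∀ {α i} → val ℓ α ≡ v → lookup ℓ i ℚ.< 0ℚ → ¬ canDown α i ≡ true
      refute-down {α} {i} e neg c = let pos , ins = ∧⁻ {0 <ᵇ lookup α i} c in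
        no-down α i (predecessor (lookup α i) pos) e neg (inside-A _ ins)

      refute-move : ∀ {α i k} → val ℓ α ≡ v → lookup ℓ k ℚ.< lookup ℓ i → ¬ canMove α i k ≡ true
      refute-move {α} {i} {k} e k<i c = let pos , ins = ∧⁻ {0 <ᵇ lookup α k} c in
        no-move α i k (predecessor (lookup α k) pos) e k<i (inside-A _ ins)

      Cov : Set
      Cov = Covered {A = A} roots ℓ v

      drop : ∀ a {b} → ¬ a ≡ true → a ∨ b ≡ true → b ≡ true
      drop a ¬a e with ∨⁻ a e
      ... | inj₁ t = ⊥-elim (¬a t)
      ... | inj₂ t = t

      or : ∀ a {b} → a ∨ b ≡ true → ¬ b ≡ true → a ≡ true
      or a e ¬b with ∨⁻ a e
      ... | inj₁ t = t
      ... | inj₂ t = ⊥-elim (¬b t)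

      top-alone : ∀ i j k → i ≢ j → i ≢ k → j ≢ k → 0ℚ ℚ.< lookup ℓ i → lookup ℓ j ℚ.< lookup ℓ i → lookup ℓ k ℚ.< lookup ℓ i → Cov
      top-alone i j k i≢j i≢k j≢k pos j<i k<i = covered roots {ℓ} {v} plus (is i) i 2 (is-refl i) (cong suc (trans (nsum-is i p) (VP.lookup-replicate i 1)))
        (λ α a → subst (_≤ 2) (sym (nsum-is i α)) (inside-≤2 α (A-inside α a) i))
        λ α a e → trans (nsum-is i α) (≡ᵇ⁻ (or (lookup α i ≡ᵇ 2) (use single single-table α a i≢j i≢k j≢k)
          λ c → refute-move {α} {i} {k} e k<i (drop (canMove α i j) (refute-move {α} {i} {j} e j<i) (drop (canUp α i) (refute-up {α} {i} e pos) c))))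

      top-pair : ∀ i j k → i ≢ j → i ≢ k → j ≢ k → 0ℚ ℚ.< lookup ℓ i → lookup ℓ j ≡ lookup ℓ i → lookup ℓ k ℚ.< lookup ℓ i → Cov
      top-pair i j k i≢j i≢k j≢k pos j≡i k<i = covered roots {ℓ} {v} plus (others k) i 3 (others-i (is k i) refl)
        (cong suc (≡ᵇ⁻ (check₁⁻ (λ k → nsum (others k) p ≡ᵇ 2) refl k)))
        (λ α a → ≤ᵇ⁻ (use-bound (λ α → nsum (others k) α ≤ᵇ 3) (check₁-bound k) α a))
        λ α a e → ≡ᵇ⁻ (or (nsum (others k) α ≡ᵇ 3) (use pair pair-table α a i≢j i≢k j≢k)
          λ c → refute-move {α} {j} {k} e (subst (lookup ℓ k ℚ.<_) (sym j≡i) k<i)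
            (drop (canMove α i k) (refute-move {α} {i} {k} e k<i)
              (drop (canUp α j) (refute-up {α} {j} e (subst (0ℚ ℚ.<_) (sym j≡i) pos)) (drop (canUp α i) (refute-up {α} {i} e pos) c))))
        where
        others-i : ∀ b → is k i ≡ b → others k i ≡ true
        others-i true e = ⊥-elim (i≢k (sym (is⁻ k i e)))
        others-i false e = cong not e
        check₁-bound : ∀ k → Bound (λ α → nsum (others k) α ≤ᵇ 3)
        check₁-bound zero = refl
        check₁-bound (suc zero) = refl
        check₁-bound (suc (suc zero)) = refl

      bottom-zero : ∀ i j k → i ≢ j → i ≢ k → j ≢ k → lookup ℓ k ℚ.< 0ℚ → lookup ℓ k ℚ.< lookup ℓ i → Cov
      bottom-zero i j k i≢j i≢k j≢k neg k<i = covered roots {ℓ} {v} minus (is k) k 0 (is-refl k) (trans (nsum-is k p) (VP.lookup-replicate k 1))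
        (λ α a → z≤n)
        λ α a e → trans (nsum-is k α) (≡ᵇ⁻ (or (lookup α k ≡ᵇ 0) (use zero-low zero-low-table α a i≢j i≢k j≢k)
          λ c → refute-move {α} {i} {k} e k<i (drop (canDown α k) (refute-down {α} {k} e neg) c)))

      0≢1 : _≢_ {A = Fin 3} zero (suc zero)
      0≢1 ()
      0≢2 : _≢_ {A = Fin 3} zero (suc (suc zero))
      0≢2 ()
      1≢2 : _≢_ {A = Fin 3} (suc zero) (suc (suc zero))
      1≢2 ()

      constant : ∀ t → (∀ j → lookup ℓ j ≡ t) → ∃ (λ q → Hull A q × dot ℓ q ℚ.< v) → Cov
      constant t ℓ≡t (q , _ , lt) with ℚP.<-cmp t 0ℚ
      ... | tri> _ _ t>0 = covered roots {ℓ} {v} plus all zero 4 refl refl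
              (λ α a → ≤ᵇ⁻ (use-bound (λ α → nsum all α ≤ᵇ 4) refl α a))
              λ α a e → ≡ᵇ⁻ (or (nsum all α ≡ᵇ 4) (use total total-table α a 0≢1 0≢2 1≢2)
                λ c → up α e (suc (suc zero)) (drop (canUp α (suc zero)) (up α e (suc zero)) (drop (canUp α zero) (up α e zero) c)))
        where
        up : ∀ α → val ℓ α ≡ v → ∀ i → ¬ canUp α i ≡ true
        up α e i = refute-up {α} {i} e (subst (0ℚ ℚ.<_) (sym (ℓ≡t i)) t>0)
      ... | tri< t<0 _ _ = covered roots {ℓ} {v} minus all zero 2 refl refl
              (λ α a → ≤ᵇ⁻ (use-bound (λ α → 2 ≤ᵇ nsum all α) refl α a))
              λ α a e → ≡ᵇ⁻ (or (nsum all α ≡ᵇ 2) (use sum-low sum-low-table α a 0≢1 0≢2 1≢2)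
                λ c → down α e (suc (suc zero)) (drop (canDown α (suc zero)) (down α e (suc zero)) (drop (canDown α zero) (down α e zero) c)))
        where
        down : ∀ α → val ℓ α ≡ v → ∀ i → ¬ canDown α i ≡ true
        down α e i = refute-down {α} {i} e (subst (ℚ._< 0ℚ) (sym (ℓ≡t i)) t<0)
      ... | tri≈ _ t≡0 _ = covered roots {ℓ} {v} minus all zero 2 refl refl
              (λ α a → ≤ᵇ⁻ (use-bound (λ α → 2 ≤ᵇ nsum all α) refl α a))
              λ α a e → ⊥-elim (ℚP.<-irrefl (trans (vanish q) (sym (trans (sym e) (vanish (ofℕ α))))) lt)
        where
        vanish : ∀ q → dot ℓ q ≡ 0ℚ
        vanish q = trans (cong (λ z → dot z q) (vec-ext {u = ℓ} {V.replicate 3 0ℚ} λ j → trans (ℓ≡t j) (trans t≡0 (sym (VP.lookup-replicate j 0ℚ))))) (dot-zeroˡ q)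

      -- If the maximum of ℓ is not positive, then ℓ_k < 0 and the face lies in x_k = 0. If it is
      -- positive, the face lies in x_i = 2 when the maximum is attained only at i, and in x_i + x_j
      -- = 3 when it is attained at j too.
      spread : ∀ i k → (∀ j → lookup ℓ j ℚ.≤ lookup ℓ i) → lookup ℓ k ℚ.< lookup ℓ i → Cov
      spread i k max-i k<i with third i k (λ { refl → ℚP.<-irrefl refl k<i })
      ... | j , i≢j , j≢k = by-sign (0ℚ ℚP.<? lookup ℓ i) (lookup ℓ j ℚP.<? lookup ℓ i)
        where
        i≢k : i ≢ k
        i≢k refl = ℚP.<-irrefl refl k<i
        by-sign : Dec (0ℚ ℚ.< lookup ℓ i) → Dec (lookup ℓ j ℚ.< lookup ℓ i) → Cov
        by-sign (no npos) _ = bottom-zero i j k i≢j i≢k j≢k (ℚP.<-≤-trans k<i (ℚP.≮⇒≥ npos)) k<i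
        by-sign (yes pos) (yes j<i) = top-alone i j k i≢j i≢k j≢k pos j<i k<i
        by-sign (yes pos) (no j≮i) = top-pair i j k i≢j i≢k j≢k pos (ℚP.≤-antisym (max-i j) (ℚP.≮⇒≥ j≮i)) k<i

      cov : ∃ (λ q → Hull A q × dot ℓ q ℚ.< v) → Cov
      cov proper with argmax ℓ | argmin ℓ
      ... | i , max-i | k , min-k with lookup ℓ k ℚP.<? lookup ℓ i
      ...   | yes k<i = spread i k max-i k<i
      ...   | no k≮i = constant (lookup ℓ k) (λ j → ℚP.≤-antisym (ℚP.≤-trans (max-i j) (ℚP.≮⇒≥ k≮i)) (min-k j)) proper

    polytope-reflexive : IsReflexive (Hull A)
    polytope-reflexive = covered-reflexive roots λ ℓ v max proper → Functional.cov ℓ v max proper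

  private
    nonzero : ℤ → Bool
    nonzero z = not (ℤ.∣ z ∣ ≡ᵇ 0)

    equal : Bool → Bool → Bool
    equal true b = b
    equal false b = not b

    equal⁻ : ∀ a b → equal a b ≡ true → a ≡ b
    equal⁻ true true _ = refl
    equal⁻ false false _ = refl

    support : Vec ℕ 3 → Bool
    support α = nonzero (coeffG 1 lam₀ α)

    agree : ∀ (f g : Vec ℕ 3 → Bool) → allL (λ α → equal (f α) (g α)) cube ≡ true → ∀ {α} → α ∈ cube → f α ≡ g α
    agree f g e {α} α∈ = equal⁻ (f α) (g α) (allL⁻ {p = λ α → equal (f α) (g α)} cube e α∈)

    -- Evaluates the 27 coefficients of G with exponents in [0,2]³; all other exponents are excluded
    -- by the bound λ_1 = 2.
    support-table : ∀ {α} → α ∈ cube → support α ≡ inside α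
    support-table = agree support inside refl

    support-cube : ∀ α → InG 1 lam₀ α → α ∈ cube
    support-cube α a = ∈-cube α λ i → subst (_≤ 2) (atD-lookup 0 α i) (Witness.bounded (InG-witness {h = 1} {lam₀} {α} a) (toℕ i))

    nonzero⁺ : ∀ z → z ≢ + 0 → nonzero z ≡ true
    nonzero⁺ (+ zero) ne = ⊥-elim (ne refl)
    nonzero⁺ ℤ.+[1+ n ] ne = refl
    nonzero⁺ ℤ.-[1+ n ] ne = refl

    nonzero⁻ : ∀ z → nonzero z ≡ true → z ≢ + 0
    nonzero⁻ .(+ 0) () refl

    support-inside : ∀ α → InG 1 lam₀ α → inside α ≡ true
    support-inside α a = trans (sym (support-table (support-cube α a))) (nonzero⁺ (coeffG 1 lam₀ α) a)

    inside-support : ∀ α → inside α ≡ true → InG 1 lam₀ α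
    inside-support α e = nonzero⁻ (coeffG 1 lam₀ α) (trans (support-table (∈-cube α (inside-≤2 α e))) e)

  exceptional-reflexive : IsReflexive (NewtG 1 (2 ∷ 0 ∷ 0 ∷ []))
  exceptional-reflexive = Polytope.polytope-reflexive (InG 1 lam₀) support-inside inside-support

-- The four families and the equivalence.

at-from-lookup : ∀ {m} (lam : Vec ℕ m) (P : ℕ → ℕ → Set) → (∀ i → P (toℕ i) (lookup lam i)) → ∀ j → j < m → P j (at lam j)
at-from-lookup lam P h j j< with fin j<
... | i , refl = subst (P (toℕ i)) (sym (atD-lookup 0 lam i)) (h i)

twos : ∀ {j k} r → j < k → 2 ⊓ ((r + k * 2) ∸ j * 2) ≡ 2
twos {j} {k} r j<k = ℕP.m≤n⇒m⊓n≡m (ℕP.m+n≤o⇒m≤o∸n 2 (ℕP.≤-trans (ℕP.*-monoˡ-≤ 2 j<k) (ℕP.m≤n+m (k * 2) r)))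

reflexive⇒case : ∀ {n h} {lam : Vec ℕ (suc (suc n))} → 1 ≤ h → IsPartition lam → at lam (suc n) ≡ 0 →
  IsReflexive (NewtG h lam) → ReflexiveCase (suc (suc n)) h lam
reflexive⇒case {n} {h} {lam} 1≤h part last R = by-first-row (zero-or-positive (at lam 0))
  where
  dec : ∀ i → at lam (suc i) ≤ at lam i
  dec = decreasing-at {lam = lam} part
  zero-or-positive : ∀ x → x ≡ 0 ⊎ 1 ≤ x
  zero-or-positive zero = inj₁ refl
  zero-or-positive (suc x) = inj₂ (s≤s z≤n)
  by-first-row : at lam 0 ≡ 0 ⊎ 1 ≤ at lam 0 → ReflexiveCase (suc (suc n)) h lam
  -- For λ = 0 the bound x_i ≤ λ_1 leaves only the exponent 0, and the polytope is a point.
  by-first-row (inj₁ empty) = ⊥-elim (origin-not-reflexive {A = InG h lam} (λ α a i → ℕP.n≤0⇒n≡0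
    (subst₂ _≤_ (atD-lookup 0 α i) empty (Witness.bounded (InG-witness {h = h} {lam} {α} a) (toℕ i)))) R)
  by-first-row (inj₂ pos) = conditions-case {lam = lam} 1≤h dec last
    (reflexive-conditions {lam = lam} 1≤h dec last pos (InG h lam)
      (λ {α} {v} → InG-rearranged {h = h} {lam} {α} {v} 1≤h) (λ α → InG-witness {h = h} {lam} {α}) R)

case⇒reflexive : ∀ {n h} {lam : Vec ℕ (suc (suc n))} → 1 ≤ h → ReflexiveCase (suc (suc n)) h lam → IsReflexive (NewtG h lam)
case⇒reflexive {n} {h} {lam} 1≤h (inj₁ (k , 1≤k , m≡ , f)) = by-room (2 ≤? h * k)
  where
  n≡ : suc n ≡ k * 2
  n≡ = ℕP.suc-injective (trans m≡ (trans (ℕP.+-comm (2 * k) 1) (cong suc (ℕP.*-comm 2 k))))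
  entry : ∀ j → j < suc (suc n) → at lam j ≡ 2 ⊓ (k * 2 ∸ j * 2)
  entry = at-from-lookup lam (λ j x → x ≡ 2 ⊓ (k * 2 ∸ j * 2)) value
    where
    value : ∀ i → lookup lam i ≡ 2 ⊓ (k * 2 ∸ toℕ i * 2)
    value i with toℕ i <? k
    ... | yes p = trans (proj₁ (f i) p) (sym (twos 0 p))
    ... | no ¬p = trans (proj₂ (f i) (ℕP.≮⇒≥ ¬p)) (sym (cong (2 ⊓_) (ℕP.m≤n⇒m∸n≡0 (ℕP.*-monoˡ-≤ 2 (ℕP.≮⇒≥ ¬p)))))
  -- The rows from k on are empty in λ and must be able to reach length 2. Row k is the tightest of
  -- them.
  room : 2 ≤ h * k → ∀ j → at lam j ≡ 2 ⊓ (k * 2 ∸ j * 2) → 2 ≤ at lam j + h * j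
  room 2≤hk j e with j <? k
  ... | yes p = ℕP.≤-trans (ℕP.≤-reflexive (sym (trans e (twos 0 p)))) (ℕP.m≤m+n _ _)
  ... | no ¬p = ℕP.≤-trans 2≤hk (ℕP.≤-trans (ℕP.*-monoʳ-≤ h (ℕP.≮⇒≥ ¬p)) (ℕP.m≤n+m _ _))
  -- h k < 2 leaves only h = k = 1, that is m = 3 and λ = (2,0,0). The parameters and the length are
  -- generalised so that matching makes the vector concrete.
  small : ∀ h′ k {m} (lam′ : Vec ℕ m) → m ≡ suc (suc n) → 1 ≤ h′ → 1 ≤ k → ¬ 2 ≤ h′ * k → m ≡ 2 * k + 1 →
    (∀ i → (toℕ i < k → lookup lam′ i ≡ 2) × (k ≤ toℕ i → lookup lam′ i ≡ 0)) → IsReflexive (NewtG h′ lam′)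
  small (suc zero) (suc zero) (a ∷ b ∷ c ∷ []) _ _ _ _ refl f
    with proj₁ (f zero) (s≤s z≤n) | proj₂ (f (suc zero)) (s≤s z≤n) | proj₂ (f (suc (suc zero))) (s≤s z≤n)
  ... | refl | refl | refl = Exceptional.exceptional-reflexive
  small (suc zero) (suc (suc k)) _ _ _ _ ¬2 _ _ = ⊥-elim (¬2 (s≤s (s≤s z≤n)))
  small (suc (suc h′)) (suc k) _ _ _ _ ¬2 _ _ = ⊥-elim (¬2 (ℕP.*-mono-≤ {2} {suc (suc h′)} {1} {suc k} (s≤s (s≤s z≤n)) (s≤s z≤n)))
  by-room : Dec (2 ≤ h * k) → IsReflexive (NewtG h lam)
  by-room (yes 2≤hk) = cube-reflexive {h = h} {lam} 1≤h
        (λ j j< → trans (entry j j<) (cong (λ z → 2 ⊓ (z ∸ j * 2)) (sym n≡)))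
        λ j j< → room 2≤hk j (entry j j<)
  by-room (no 2≰hk) = small h k lam refl 1≤h 1≤k 2≰hk m≡ f
case⇒reflexive {n} {h} {lam} 1≤h (inj₂ (inj₁ (k , 1≤k , m≡ , f))) = cube-reflexive {h = h} {lam} 1≤h
    (λ j j< → trans (entry j j<) (cong (λ z → 2 ⊓ (z ∸ j * 2)) (sym n≡)))
    λ j j< → room j (entry j j<)
  where
  n≡ : suc n ≡ 1 + k * 2
  n≡ = ℕP.suc-injective (trans m≡ (trans (ℕP.+-comm (2 * k) 2) (cong (λ z → 2 + z) (ℕP.*-comm 2 k))))
  ones : 2 ⊓ (1 + k * 2 ∸ k * 2) ≡ 1
  ones = cong (2 ⊓_) (ℕP.m+n∸n≡m 1 (k * 2))
  entry : ∀ j → j < suc (suc n) → at lam j ≡ 2 ⊓ (1 + k * 2 ∸ j * 2)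
  entry = at-from-lookup lam (λ j x → x ≡ 2 ⊓ (1 + k * 2 ∸ j * 2)) value
    where
    value : ∀ i → lookup lam i ≡ 2 ⊓ (1 + k * 2 ∸ toℕ i * 2)
    value i with ℕP.<-cmp (toℕ i) k
    ... | tri< p _ _ = trans (proj₁ (f i) p) (sym (twos 1 p))
    ... | tri≈ _ p _ = trans (proj₁ (proj₂ (f i)) p) (sym (trans (cong (λ z → 2 ⊓ (1 + k * 2 ∸ z * 2)) p) ones))
    ... | tri> _ _ p = trans (proj₂ (proj₂ (f i)) p) (sym (cong (2 ⊓_) (ℕP.m≤n⇒m∸n≡0 (ℕP.≤-trans (ℕP.n≤1+n (1 + k * 2)) (ℕP.*-monoˡ-≤ 2 p)))))
  -- Row k has length 1 and may gain h k ≥ 1 boxes; a later row j is empty and may gain h j ≥ k + 1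
  -- ≥ 2. Hence h = 1 causes no exception in this family.
  room : ∀ j → at lam j ≡ 2 ⊓ (1 + k * 2 ∸ j * 2) → 2 ≤ at lam j + h * j
  room j e with ℕP.<-cmp j k
  ... | tri< p _ _ = ℕP.≤-trans (ℕP.≤-reflexive (sym (trans e (twos 1 p)))) (ℕP.m≤m+n _ _)
  ... | tri≈ _ refl _ = ℕP.+-mono-≤ (ℕP.≤-reflexive (sym (trans e ones))) (ℕP.*-mono-≤ 1≤h 1≤k)
  ... | tri> _ _ p = ℕP.≤-trans (ℕP.*-mono-≤ 1≤h (ℕP.≤-trans (s≤s 1≤k) p)) (ℕP.m≤n+m _ _)
case⇒reflexive {n} {h} {lam} 1≤h (inj₂ (inj₂ (inj₁ (2≤h , f)))) = simplex-reflexive {lam = lam} 1≤h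
    (λ j j< → at-from-lookup lam (λ j x → suc j < suc (suc n) → x ≡ suc (suc (suc n)))
       (λ i p → trans (proj₁ (f i) p) (ℕP.+-comm (suc (suc n)) 1)) j (ℕP.m<n⇒m<1+n j<) (s<s j<))
    (at-from-lookup lam (λ j x → suc j ≡ suc (suc n) → x ≡ 0) (λ i → proj₂ (f i)) (suc n) ℕP.≤-refl refl)
    (room h n 2≤h)
  where
  -- For h ≥ 2 the inequality h (m - 1) ≥ m + 1 fails only at (h, m) = (2, 2), where h (m - 1) = 2
  -- and the upper bound on Σ x is at distance one.
  room : ∀ h n → 2 ≤ h → suc (suc (suc n)) ≤ h * suc n ⊎ h * suc n ≡ 2
  room (suc (suc zero)) zero _ = inj₂ refl
  room (suc (suc (suc h))) zero _ = inj₁ (s≤s (s≤s (s≤s z≤n)))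
  room (suc zero) _ (s≤s ())
  room h (suc n) 2≤h = inj₁ (ℕP.≤-trans (subst (suc (suc (suc (suc n))) ≤_) (double n) (ℕP.m≤m+n _ n)) (ℕP.*-monoˡ-≤ (suc (suc n)) 2≤h))
    where
    double : ∀ n → suc (suc (suc (suc n))) + n ≡ 2 * suc (suc n)
    double = solve-∀
case⇒reflexive {lam = lam} 1≤h (inj₂ (inj₂ (inj₂ (refl , refl , f)))) = simplex-reflexive {lam = lam} 1≤h
    (at-from-lookup′ λ i → proj₁ (f i))
    (at-from-lookup lam (λ j x → j ≡ 2 → x ≡ 0) (λ i → proj₂ (f i)) 2 ℕP.≤-refl refl)
    (inj₂ refl)
  where
  at-from-lookup′ : (∀ i → toℕ i < 2 → lookup lam i ≡ 4) → ∀ j → j < 2 → at lam j ≡ 4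
  at-from-lookup′ g j j< = at-from-lookup lam (λ j x → j < 2 → x ≡ 4) g j (ℕP.m<n⇒m<1+n j<) j<

theorem4p24 : (m : ℕ) → 2 ≤ m → (h : ℕ) → 1 ≤ h →
    (lam : Vec ℕ m) → IsPartition lam → (∀ (i : Fin m) → suc (toℕ i) ≡ m → lookup lam i ≡ 0) →
    (IsReflexive (NewtG h lam) → ReflexiveCase m h lam) × (ReflexiveCase m h lam → IsReflexive (NewtG h lam))
theorem4p24 (suc (suc n)) _ h 1≤h lam part last = reflexive⇒case {lam = lam} 1≤h part last′ , case⇒reflexive {lam = lam} 1≤h
  where
  last′ : at lam (suc n) ≡ 0
  last′ = at-from-lookup lam (λ j x → suc j ≡ suc (suc n) → x ≡ 0) last (suc n) ℕP.≤-refl refl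
theorem4p24 (suc zero) (s≤s ())
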